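{- (i) Let $S\equiv\pm\{1, 3, 4, 5, 7, 9, 11, 16, 17, 18, 19, 20\}\pmod{42}$ and $T\equiv\pm\{1, 2, 3, 7, 8, 11, 13, 15, 17, 18, 19, 20\}\pmod{42}$. Then $p(S,n)=p(T,n-1)$ for all $n\geq 1$. (ii) Let $S\equiv\pm\{1, 2, 5, 6, 7, 9, 10, 11, 13, 15, 16, 19\}\pmod{42}$ and $T\equiv\pm\{1, 3, 4, 5, 6, 7, 11, 13, 15, 16, 17, 20\}\pmod{42}$. Then $p(S,n)=p(T,n)$ for all integers $n\ge0$ with $n\neq 2$. (iii) Let $S\equiv\pm\{1, 3, 4, 5, 7, 9, 10, 11, 12, 17, 19, 20\}\pmod{42}$ and $T\equiv\pm\{1, 2, 5, 7, 8, 9, 10, 11, 12, 13, 15, 19\}\pmod{42}$. Then $p(S,n)=p(T,n)$ for all integers $n\ge0$ with $n\neq 2$. (iv) Let $S\equiv\pm\{2, 3, 5, 7, 8, 9, 10, 11, 13, 17, 18, 19\}\pmod{42}$ and $T\equiv\pm\{1, 3, 5, 7, 8, 11, 13, 15, 16, 17, 18, 20\}\pmod{42}$. Then $p(S,n)=p(T,n-2)$ for all $n\geq 2$. (v) Let $S\equiv\pm\{3, 4, 5, 7, 8, 9, 10, 11, 12, 13, 17, 19\}\pmod{42}$ and $T\equiv\pm\{1, 4, 5, 7, 9, 12, 13, 15, 16, 17, 19, 20\}\pmod{42}$. Then $p(S,n)=p(T,n-3)$ for all $n\geq 3$. (vi) Let $S\equiv\pm\{1, 2, 4, 5, 6, 7,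 9, 13, 15, 16, 17, 19\}\pmod{42}$ and $T\equiv\pm\{1, 2, 3, 6, 7, 8, 10, 11, 13, 15, 17, 19\}\pmod{42}$. Then $p(S,n)=p(T,n)$ for all integers $n\ge0$ with $n\neq 3$.
   Context: For a set $S$ of positive integers and an integer $n\ge 0$, $p(S,n)$ denotes the number of partitions of $n$ into parts belonging to $S$ (so $p(S,0)=1$). The notation $S\equiv\pm\{r_1,\dots,r_k\}\pmod M$ means that $S$ is the set of all positive integers $n$ such that $n\equiv r_i$ or $n\equiv -r_i\pmod M$ for some $i$. -}

module Defs where

open import Data.Nat using (ℕ; zero; suc; _+_; _∸_; _≡ᵇ_; _≤ᵇ_; NonZero)
open import Data.Nat.DivMod using (_%_)
open import Data.Bool using (Bool; true; false; _∨_; if_then_else_)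
open import Data.List using (List; []; _∷_; map; filter; length)
open import Data.Bool.ListAction using (any; all)
open import Data.Bool using (T)
open import Relation.Nullary.Decidable using (T?)

-- A set S of positive integers is represented by its Boolean membership test
-- (only its values on positive integers are relevant, since parts are ≥ 1).

-- S ≡ ±{r₁,…,r_k} (mod M): n ∈ S iff n ≡ rᵢ or n ≡ -rᵢ (mod M) for some i
-- (n ≡ -r (mod M) is expressed as M ∣ n + r).
pm : (M : ℕ) .{{_ : NonZero M}} → List ℕ → ℕ → Bool
pm M rs n = any (λ r → (n % M ≡ᵇ r % M) ∨ ((n + r) % M ≡ᵇ 0)) rs

-- All partitions of n into (positive) parts of size at most k, each listed as
-- a non-increasing list of parts.  The fuel argument f ≥ n guarantees
-- termination (it decreases with each part taken).
partsLe : (f k n : ℕ) → List (List ℕ)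
partsLe f       k       zero    = [] ∷ []
partsLe zero    k       (suc n) = []
partsLe (suc f) zero    (suc n) = []
partsLe (suc f) (suc k) (suc n) =
  partsLe (suc f) k (suc n) ++′
  (if suc k ≤ᵇ suc n
     then map (suc k ∷_) (partsLe f (suc k) (suc n ∸ suc k))
     else [])
  where
  open import Data.List using () renaming (_++_ to _++′_)

partitions : ℕ → List (List ℕ)
partitions n = partsLe n n n

p : (ℕ → Bool) → ℕ → ℕ
p S n = length (filter (λ λs → T? (all S λs)) (partitions n))

module Submission where

-- Write [r] for ∏(1 - q^n) over n ≡ ± r (mod 42), so that the generating function of p(S,n) is the
-- inverse of a product of twelve [r]. Each identity then says
--   ± q^i [2][8][13][15] ± q^j [4][5][9][16] ± q^k ∏(the sixteen [r] with r ∉ {6,10,12,14}) = 0,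
-- or a conjugate of this one, with all r multiplied by a unit u modulo 42.
-- Let P_a, N_a = ∏(1 ∓ q^(21i+a))(1 ∓ q^(21i+21-a)), so that P_a = [a][21-a] and P_a N_a = [2a].
-- For u = 1 Weierstrass' three-term relation for theta functions of period q^21 gives
--   N₁P₆N₆P₇  = q N₂P₃N₃P₁₀ + P₃P₄N₄N₉
--   P₂P₅P₇P₉  = q P₁P₄P₆P₈ + P₁P₆P₈P₁₀
--   N₄N₅N₇N₉  = P₂P₇P₉P₁₀ + q² N₂N₃N₅N₇
-- and multiplying these by P₁P₈P₆N₅N₇, N₂P₃N₃N₅N₇ and P₁P₃P₄P₆P₈ lets the mixed terms cancel; after
-- multiplication by P₅ what remains is [6][10][12][14] times the identity.
-- Weierstrass' relation is a Plücker relation, as θ(x+y)θ(x-y) = β(x)α(y) - q^(x-y) α(x)β(y) by the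
-- Jacobi triple product. To avoid convergence everything takes place in a commutative ring in which
-- q^N = 0, where all products and sums are finite; in the end the ring is ℤ[[q]] modulo q^(n+1).

-- Replacing r by ur is not a map on series, so the identities for the other units cannot be deduced
-- from the case u = 1. Reducing an index ua modulo 21 and sign multiplies a theta function by a
-- sign and a power of q. Hence the three Weierstrass relations are instantiated afresh for every u,
-- with their own coefficients, and only the multiplication and cancellation of monomials are
-- uniform in u. As u and -u give the same residue classes, the units 1, 5, 11, 13, 17, 19 are all
-- there are, and they yield the six parts. Division by the products for S and T leaves the two
-- generating functions, times signed powers of q, and the single monomial ± q^k. In parts (ii),
-- (iii) and (vi) this monomial makes the counts differ by one at n = k, the excluded value; in the
-- other parts k = 0 and it only balances the constant term. Therefore a theta function carries an
-- argument together with its complement, and the complement supplies the exponents for negative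
-- indices.

open import Algebra.Bundles using (CommutativeMonoid; CommutativeRing; RawRing)
open import Data.Bool.Base using (Bool; true; false; if_then_else_; _∨_; T)
open import Data.Bool.ListAction using (all)
open import Data.Empty using (⊥-elim)
open import Data.Integer.Base as ℤ using (ℤ; +_; -[1+_]; ∣_∣; _⊖_)
import Data.Integer.Properties as ℤ
import Data.Integer.Tactic.RingSolver as ℤRing
open import Data.List.Base using (List; []; _∷_; _++_; concatMap; filter; length; map)
open import Data.List.Properties using (filter-++; length-++)
open import Data.List.Relation.Unary.All using (All; []; _∷_)
open import Data.Maybe.Base using (Maybe; just; nothing)
open import Data.Nat.Base as ℕ using (ℕ; zero; suc; z≤n; s≤s; _<_; _≤_; _∸_; _≤ᵇ_; _≡ᵇ_; NonZero)
open import Data.Nat.DivMod using (_%_; [m+kn]%n≡m%n)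
import Data.Nat.Properties as ℕ
import Data.Nat.Tactic.RingSolver as ℕRing
open import Data.Product using (∃; _×_; _,_; proj₁; proj₂)
open import Data.Sign.Base as Sign using (Sign; opposite) renaming (_*_ to _·_)
import Data.Sign.Properties as Sign
open import Data.Sum using (inj₁; inj₂)
open import Data.Unit using (⊤; tt)
open import Function using (_∘_; id)
open import Level using (0ℓ)
open import Relation.Binary.PropositionalEquality as ≡ using (_≡_; _≢_)
open import Relation.Nullary.Decidable using (T?; yes; no)

-- A ring solver over an arbitrary commutative ring

-- The ring solver of the standard library needs decidable coefficients; over an
-- arbitrary commutative ring we take formal differences m - n of naturals.
module DifferenceSolver {c ℓ} (R : CommutativeRing c ℓ) where
  open CommutativeRing R
  open import Algebra.Properties.Ring ring
  open import Algebra.Properties.Semiring.Mult semiring renaming (_×_ to _×′_)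
  open import Algebra.Solver.Ring.NaturalCoefficients.Default commutativeSemiring
    using (solve; _:=_; _:+_; _:*_)
  open import Algebra.Solver.Ring.AlmostCommutativeRing
  open import Relation.Binary.Reasoning.Setoid setoid

  private
    -- The semiring solver knows no negation. It treats -1 as a variable `ω`, and the relation
    -- `ω * ω ≈ 1#` is inserted by hand where it is needed.
    ω : Carrier
    ω = - 1#

    ω²≈1 : ω * ω ≈ 1#
    ω²≈1 = begin
      - 1# * - 1#    ≈⟨ -1*x≈-x (- 1#) ⟩
      - (- 1#)       ≈⟨ -‿involutive 1# ⟩
      1#             ∎

    ⟦_⟧₀ : ℕ × ℕ → Carrier
    ⟦ m , n ⟧₀ = m ×′ 1# + ω * (n ×′ 1#)

    -- The two extra clauses make the constants 0 and 1 of the solver definitionally 0# and 1#.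
    ⟦_⟧ : ℕ × ℕ → Carrier
    ⟦ 0 , 0 ⟧ = 0#
    ⟦ 1 , 0 ⟧ = 1#
    ⟦ x     ⟧ = ⟦ x ⟧₀

    ⟦⟧≈⟦⟧₀ : ∀ x → ⟦ x ⟧ ≈ ⟦ x ⟧₀
    ⟦⟧≈⟦⟧₀ (0 , 0)           = sym (trans (+-congˡ (zeroʳ ω)) (+-identityʳ 0#))
    ⟦⟧≈⟦⟧₀ (1 , 0)           = sym (trans (+-congˡ (zeroʳ ω)) (trans (+-identityʳ _) (+-identityʳ 1#)))
    ⟦⟧≈⟦⟧₀ (0 , suc _)       = refl
    ⟦⟧≈⟦⟧₀ (1 , suc _)       = refl
    ⟦⟧≈⟦⟧₀ (suc (suc _) , _) = refl

    differences : RawRing _ _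
    differences = record
      { Carrier = ℕ × ℕ
      ; _≈_ = _≡_
      ; _+_ = λ (a , b) (c , d) → a ℕ.+ c , b ℕ.+ d
      ; _*_ = λ (a , b) (c , d) → a ℕ.* c ℕ.+ b ℕ.* d , a ℕ.* d ℕ.+ b ℕ.* c
      ; -_ = λ (a , b) → b , a
      ; 0# = 0 , 0
      ; 1# = 1 , 0
      }

    *-homo : ∀ a b c d →
      (a ℕ.* c ℕ.+ b ℕ.* d) ×′ 1# + ω * ((a ℕ.* d ℕ.+ b ℕ.* c) ×′ 1#)
      ≈ ⟦ a , b ⟧₀ * ⟦ c , d ⟧₀
    *-homo a b c d = begin
      (a ℕ.* c ℕ.+ b ℕ.* d) ×′ 1# + ω * ((a ℕ.* d ℕ.+ b ℕ.* c) ×′ 1#)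
        ≈⟨ +-cong (two a c b d) (*-congˡ (two a d b c)) ⟩
      (a′ * c′ + b′ * d′) + ω * (a′ * d′ + b′ * c′)
        ≈⟨ +-congʳ (+-congˡ (trans (*-congʳ ω²≈1) (*-identityˡ _))) ⟨
      (a′ * c′ + ω * ω * (b′ * d′)) + ω * (a′ * d′ + b′ * c′)
        ≈⟨ solve 5 (λ a b c d w → (a :* c :+ w :* w :* (b :* d)) :+ w :* (a :* d :+ b :* c)
             := (a :+ w :* b) :* (c :+ w :* d)) refl a′ b′ c′ d′ ω ⟩
      ⟦ a , b ⟧₀ * ⟦ c , d ⟧₀ ∎
      where
      a′ = a ×′ 1#
      b′ = b ×′ 1#
      c′ = c ×′ 1#
      d′ = d ×′ 1#
      two : ∀ i j k l → (i ℕ.* j ℕ.+ k ℕ.* l) ×′ 1# ≈ (i ×′ 1#) * (j ×′ 1#) + (k ×′ 1#) * (l ×′ 1#)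
      two i j k l = trans (×-homo-+ 1# (i ℕ.* j) (k ℕ.* l)) (+-cong (×1-homo-* i j) (×1-homo-* k l))

    cancel : ∀ x y → x + (y + ω * y) ≈ x
    cancel x y = begin
      x + (y + ω * y)  ≈⟨ +-congˡ (+-congˡ (-1*x≈-x y)) ⟩
      x + (y + - y)    ≈⟨ +-congˡ (-‿inverseʳ y) ⟩
      x + 0#           ≈⟨ +-identityʳ x ⟩
      x                ∎

    homomorphism : differences -Raw-AlmostCommutative⟶ fromCommutativeRing R
    homomorphism = record
      { ⟦_⟧ = ⟦_⟧
      ; +-homo = λ x@(a , b) y@(c , d) → trans (⟦⟧≈⟦⟧₀ (a ℕ.+ c , b ℕ.+ d)) (trans
          (trans (+-cong (×-homo-+ 1# a c) (*-congˡ (×-homo-+ 1# b d)))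
            (solve 5 (λ a b c d w → (a :+ c) :+ w :* (b :+ d) := (a :+ w :* b) :+ (c :+ w :* d))
              refl (a ×′ 1#) (b ×′ 1#) (c ×′ 1#) (d ×′ 1#) ω))
          (sym (+-cong (⟦⟧≈⟦⟧₀ x) (⟦⟧≈⟦⟧₀ y))))
      ; *-homo = λ x@(a , b) y@(c , d) → trans (⟦⟧≈⟦⟧₀ (a ℕ.* c ℕ.+ b ℕ.* d , a ℕ.* d ℕ.+ b ℕ.* c)) (trans (*-homo a b c d)
          (sym (*-cong (⟦⟧≈⟦⟧₀ x) (⟦⟧≈⟦⟧₀ y))))
      ; -‿homo = λ x@(a , b) → trans (⟦⟧≈⟦⟧₀ (b , a)) (begin
          b ×′ 1# + ω * (a ×′ 1#)
            ≈⟨ +-congʳ (trans (*-congʳ ω²≈1) (*-identityˡ _)) ⟨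
          ω * ω * (b ×′ 1#) + ω * (a ×′ 1#)
            ≈⟨ solve 3 (λ a b w → w :* w :* b :+ w :* a := w :* (a :+ w :* b)) refl (a ×′ 1#) (b ×′ 1#) ω ⟩
          ω * ⟦ a , b ⟧₀
            ≈⟨ -1*x≈-x _ ⟩
          - ⟦ a , b ⟧₀
            ≈⟨ -‿cong (⟦⟧≈⟦⟧₀ x) ⟨
          - ⟦ a , b ⟧ ∎)
      ; 0-homo = refl
      ; 1-homo = refl
      }

    _≟_ : ∀ x y → Maybe (⟦ x ⟧ ≈ ⟦ y ⟧)
    x@(a , b) ≟ y@(c , d) with a ℕ.+ d ℕ.≟ c ℕ.+ b
    ... | no _ = nothing
    ... | yes eq = just (trans (⟦⟧≈⟦⟧₀ x) (trans (begin
      a′ + ω * b′                 ≈⟨ cancel _ d′ ⟨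
      a′ + ω * b′ + (d′ + ω * d′) ≈⟨ shuffle a′ b′ d′ ⟩
      (a′ + d′) + ω * (b′ + d′)   ≈⟨ +-congʳ (×-homo-+ 1# a d) ⟨
      (a ℕ.+ d) ×′ 1# + ω * (b′ + d′)  ≡⟨ ≡.cong (λ k → k ×′ 1# + ω * (b′ + d′)) eq ⟩
      (c ℕ.+ b) ×′ 1# + ω * (b′ + d′)  ≈⟨ +-cong (×-homo-+ 1# c b) (*-congˡ (+-comm b′ d′)) ⟩
      (c′ + b′) + ω * (d′ + b′)   ≈⟨ shuffle c′ d′ b′ ⟨
      c′ + ω * d′ + (b′ + ω * b′) ≈⟨ cancel _ b′ ⟩
      c′ + ω * d′ ∎) (sym (⟦⟧≈⟦⟧₀ y))))
      where
      a′ = a ×′ 1#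
      b′ = b ×′ 1#
      c′ = c ×′ 1#
      d′ = d ×′ 1#
      shuffle : ∀ x y z → x + ω * y + (z + ω * z) ≈ (x + z) + ω * (y + z)
      shuffle x y z = solve 4 (λ x y z w → x :+ w :* y :+ (z :+ w :* z) := (x :+ z) :+ w :* (y :+ z)) refl x y z ω

  open import Algebra.Solver.Ring differences (fromCommutativeRing R) homomorphism _≟_ public
    using (solve; _:=_; _:+_; _:*_; :-_; _:-_; con)

-- Finite products, and sums over the integers

module BigOperator {c ℓ} (M : CommutativeMonoid c ℓ) where
  open CommutativeMonoid M
  open import Algebra.Properties.CommutativeSemigroup commutativeSemigroup using (interchange)
  open import Relation.Binary.Reasoning.Setoid setoid

  big : ℕ → (ℕ → Carrier) → Carrier
  big zero    f = ε
  big (suc n) f = big n f ∙ f n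

  big-cong< : ∀ n {f g} → (∀ i → i < n → f i ≈ g i) → big n f ≈ big n g
  big-cong< zero    f≈g = refl
  big-cong< (suc n) f≈g =
    ∙-cong (big-cong< n λ i i<n → f≈g i (ℕ.m<n⇒m<1+n i<n)) (f≈g n (ℕ.n<1+n n))

  big-cong : ∀ n {f g} → (∀ i → f i ≈ g i) → big n f ≈ big n g
  big-cong n f≈g = big-cong< n λ i _ → f≈g i

  big-ε : ∀ n {f} → (∀ i → i < n → f i ≈ ε) → big n f ≈ ε
  big-ε zero    f≈ε = refl
  big-ε (suc n) f≈ε =
    trans (∙-cong (big-ε n λ i i<n → f≈ε i (ℕ.m<n⇒m<1+n i<n)) (f≈ε n (ℕ.n<1+n n))) (identityˡ ε)

  big-∙ : ∀ n f g → big n (λ i → f i ∙ g i) ≈ big n f ∙ big n g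
  big-∙ zero    f g = sym (identityˡ ε)
  big-∙ (suc n) f g = trans (∙-congʳ (big-∙ n f g)) (interchange _ _ _ _)

  big-+ : ∀ m n f → big (m ℕ.+ n) f ≈ big m f ∙ big n (λ i → f (m ℕ.+ i))
  big-+ m zero    f = trans (reflexive (≡.cong (λ k → big k f) (ℕ.+-identityʳ m))) (sym (identityʳ _))
  big-+ m (suc n) f = begin
    big (m ℕ.+ suc n) f            ≡⟨ ≡.cong (λ k → big k f) (ℕ.+-suc m n) ⟩
    big (m ℕ.+ n) f ∙ f (m ℕ.+ n)  ≈⟨ ∙-congʳ (big-+ m n f) ⟩
    (big m f ∙ big n (λ i → f (m ℕ.+ i))) ∙ f (m ℕ.+ n) ≈⟨ assoc _ _ _ ⟩
    big m f ∙ big (suc n) (λ i → f (m ℕ.+ i)) ∎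

  big-suc : ∀ n f → big (suc n) f ≈ f 0 ∙ big n (f ∘ suc)
  big-suc n f = trans (big-+ 1 n f) (∙-congʳ (identityˡ (f 0)))

  big-stable : ∀ {m n} f → m ≤ n → (∀ i → m ≤ i → f i ≈ ε) → big n f ≈ big m f
  big-stable {m} {n} f m≤n f≈ε = begin
    big n f                                       ≡⟨ ≡.cong (λ k → big k f) (ℕ.m+[n∸m]≡n m≤n) ⟨
    big (m ℕ.+ (n ∸ m)) f                         ≈⟨ big-+ m (n ∸ m) f ⟩
    big m f ∙ big (n ∸ m) (λ i → f (m ℕ.+ i))     ≈⟨ ∙-congˡ (big-ε (n ∸ m) λ i _ → f≈ε _ (ℕ.m≤m+n m i)) ⟩
    big m f ∙ ε                                   ≈⟨ identityʳ _ ⟩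
    big m f                                       ∎

  big-* : ∀ n k f → big (n ℕ.* k) f ≈ big n (λ i → big k (λ r → f (i ℕ.* k ℕ.+ r)))
  big-* zero    k f = refl
  big-* (suc n) k f = begin
    big (k ℕ.+ n ℕ.* k) f  ≡⟨ ≡.cong (λ j → big j f) (ℕ.+-comm k (n ℕ.* k)) ⟩
    big (n ℕ.* k ℕ.+ k) f  ≈⟨ big-+ (n ℕ.* k) k f ⟩
    big (n ℕ.* k) f ∙ _    ≈⟨ ∙-congʳ (big-* n k f) ⟩
    _                      ∎

  big-reverse : ∀ n f → big n f ≈ big n (λ i → f (n ∸ suc i))
  big-reverse zero    f = refl
  big-reverse (suc n) f = begin
    big n f ∙ f n                        ≈⟨ comm _ _ ⟩
    f n ∙ big n f                        ≈⟨ ∙-congˡ (big-reverse n f) ⟩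
    f n ∙ big n (λ i → f (n ∸ suc i))    ≈⟨ big-suc n (λ i → f (n ∸ i)) ⟨
    big (suc n) (λ i → f (n ∸ i))        ∎

  big-swap : ∀ m n (f : ℕ → ℕ → Carrier) → big m (λ i → big n (f i)) ≈ big n (λ j → big m (λ i → f i j))
  big-swap zero    n f = sym (big-ε n λ _ _ → refl)
  big-swap (suc m) n f = trans (∙-congʳ (big-swap m n f)) (sym (big-∙ n (λ j → big m (λ i → f i j)) (f m)))

module RingSums {c ℓ} (R : CommutativeRing c ℓ) where
  open CommutativeRing R
  open import Relation.Binary.Reasoning.Setoid setoid
  open BigOperator +-commutativeMonoid public
    renaming (big to ∑; big-cong< to ∑-cong<; big-cong to ∑-cong; big-ε to ∑-zero; big-∙ to ∑-distrib-+;
              big-+ to ∑-concat; big-suc to ∑-suc; big-swap to ∑-swap; big-reverse to ∑-reverse)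
    hiding (big-stable; big-*)
  open BigOperator *-commutativeMonoid public
    renaming (big to ∏; big-cong< to ∏-cong<; big-cong to ∏-cong; big-∙ to ∏-distrib-*; big-ε to ∏-one;
              big-suc to ∏-suc; big-* to ∏-blocks; big-stable to ∏-stable; big-swap to ∏-swap)
    hiding (big-+; big-reverse)

  ∑-*ˡ : ∀ n a f → ∑ n (λ i → a * f i) ≈ a * ∑ n f
  ∑-*ˡ zero    a f = sym (zeroʳ a)
  ∑-*ˡ (suc n) a f = trans (+-congʳ (∑-*ˡ n a f)) (sym (distribˡ a _ _))

  ∑-*ʳ : ∀ n a f → ∑ n (λ i → f i * a) ≈ ∑ n f * a
  ∑-*ʳ n a f = trans (∑-cong n λ i → *-comm (f i) a) (trans (∑-*ˡ n a f) (*-comm a _))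

  window : ℤ → ℕ → (ℤ → Carrier) → Carrier
  window a n f = ∑ n (λ i → f (a ℤ.+ + i))

  window-shift : ∀ c a n f → window a n (λ i → f (c ℤ.+ i)) ≈ window (c ℤ.+ a) n f
  window-shift c a n f = ∑-cong n λ i → reflexive (≡.cong f (≡.sym (ℤ.+-assoc c a (+ i))))

  window-parity : ∀ a n h →
    window (+ 2 ℤ.* a ℤ.- + 1) (n ℕ.* 2) h ≈ window a n (λ d → h (+ 2 ℤ.* d ℤ.- + 1) + h (+ 2 ℤ.* d))
  window-parity a zero    h = refl
  window-parity a (suc n) h = begin
    window (+ 2 ℤ.* a ℤ.- + 1) (n ℕ.* 2) h + h (b ℤ.+ + (n ℕ.* 2)) + h (b ℤ.+ + suc (n ℕ.* 2))
      ≈⟨ +-assoc _ _ _ ⟩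
    window (+ 2 ℤ.* a ℤ.- + 1) (n ℕ.* 2) h + (h (b ℤ.+ + (n ℕ.* 2)) + h (b ℤ.+ + suc (n ℕ.* 2)))
      ≈⟨ +-cong (window-parity a n h) (reflexive (≡.cong₂ (λ x y → h x + h y) odd even)) ⟩
    _ ∎
    where
    b = + 2 ℤ.* a ℤ.- + 1
    double : + (n ℕ.* 2) ≡ + 2 ℤ.* + n
    double = ≡.trans (ℤ.pos-* n 2) (ℤ.*-comm (+ n) (+ 2))
    odd : b ℤ.+ + (n ℕ.* 2) ≡ + 2 ℤ.* (a ℤ.+ + n) ℤ.- + 1
    odd = ≡.trans (≡.cong (λ z → b ℤ.+ z) double) (lemma a (+ n))
      where
      lemma : ∀ a n → + 2 ℤ.* a ℤ.- + 1 ℤ.+ + 2 ℤ.* n ≡ + 2 ℤ.* (a ℤ.+ n) ℤ.- + 1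
      lemma = ℤRing.solve-∀
    even : b ℤ.+ + suc (n ℕ.* 2) ≡ + 2 ℤ.* (a ℤ.+ + n)
    even = ≡.trans (≡.cong (λ z → b ℤ.+ (+ 1 ℤ.+ z)) double) (lemma a (+ n))
      where
      lemma : ∀ a n → + 2 ℤ.* a ℤ.- + 1 ℤ.+ (+ 1 ℤ.+ + 2 ℤ.* n) ≡ + 2 ℤ.* (a ℤ.+ n)
      lemma = ℤRing.solve-∀

  SupportedIn : ℕ → (ℤ → Carrier) → Set ℓ
  SupportedIn N f = ∀ n → N < ∣ n ∣ → f n ≈ 0#

  total : ℕ → (ℤ → Carrier) → Carrier
  total N = window (ℤ.- + N) (suc (N ℕ.+ N))

  -- The substitute for translation invariance of a sum over all integers: whichever window contains
  -- [-N, N], the i terms on its left and the j terms on its right vanish.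
  window-total : ∀ N i j f → SupportedIn N f →
    window (ℤ.- + (N ℕ.+ i)) (i ℕ.+ (suc (N ℕ.+ N) ℕ.+ j)) f ≈ total N f
  window-total N i j f supp = begin
    window a (i ℕ.+ (suc (N ℕ.+ N) ℕ.+ j)) f
      ≈⟨ ∑-concat i _ _ ⟩
    ∑ i (λ k → f (a ℤ.+ + k)) + ∑ (suc (N ℕ.+ N) ℕ.+ j) (λ k → f (a ℤ.+ + (i ℕ.+ k)))
      ≈⟨ +-cong (∑-zero i left) (∑-concat (suc (N ℕ.+ N)) j _) ⟩
    0# + (∑ (suc (N ℕ.+ N)) (λ k → f (a ℤ.+ + (i ℕ.+ k)))
          + ∑ j (λ k → f (a ℤ.+ + (i ℕ.+ (suc (N ℕ.+ N) ℕ.+ k)))))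
      ≈⟨ +-identityˡ _ ⟩
    _ ≈⟨ +-cong (∑-cong (suc (N ℕ.+ N)) λ k → reflexive (≡.cong f (middle k))) (∑-zero j right) ⟩
    total N f + 0#
      ≈⟨ +-identityʳ _ ⟩
    total N f ∎
    where
    a = ℤ.- + (N ℕ.+ i)
    middle : ∀ k → a ℤ.+ + (i ℕ.+ k) ≡ ℤ.- + N ℤ.+ + k
    middle k = lemma (+ N) (+ i) (+ k)
      where
      lemma : ∀ N i k → ℤ.- (N ℤ.+ i) ℤ.+ (i ℤ.+ k) ≡ ℤ.- N ℤ.+ k
      lemma = ℤRing.solve-∀
    left : ∀ k → k < i → f (a ℤ.+ + k) ≈ 0#
    left k k<i with ℕ.m≤n⇒∃[o]m+o≡n k<i
    ... | r , ≡.refl = supp _ (≡.subst (λ z → N < ∣ z ∣) (≡.sym (lemma (+ N) (+ k) (+ r)))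
                         (≡.subst (λ z → N < z) (≡.sym (ℤ.∣-i∣≡∣i∣ (+ (N ℕ.+ suc r)))) (ℕ.m<m+n N (s≤s z≤n))))
      where
      lemma : ∀ N k r → ℤ.- (N ℤ.+ (+ 1 ℤ.+ (k ℤ.+ r))) ℤ.+ k ≡ ℤ.- (N ℤ.+ (+ 1 ℤ.+ r))
      lemma = ℤRing.solve-∀
    right : ∀ k → k < j → f (a ℤ.+ + (i ℕ.+ (suc (N ℕ.+ N) ℕ.+ k))) ≈ 0#
    right k _ = supp _ (≡.subst (λ z → N < ∣ z ∣) (≡.sym (lemma (+ N) (+ i) (+ k)))
                         (s≤s (ℕ.m≤m+n N k)))
      where
      lemma : ∀ N i k → ℤ.- (N ℤ.+ i) ℤ.+ (i ℤ.+ (+ 1 ℤ.+ (N ℤ.+ N) ℤ.+ k)) ≡ + 1 ℤ.+ (N ℤ.+ k)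
      lemma = ℤRing.solve-∀

  -- The pairs (m , n) with m + n = 2d are (s + d , d - s), those with m + n = 2d - 1 are
  -- (s + d , d - s - 1); separating variables in both classes gives two products.
  total-product : ∀ N t w A B C D c → SupportedIn N t → SupportedIn N w → SupportedIn N A → SupportedIn N C →
    (∀ s d → t (s ℤ.+ d) * w (d ℤ.- s) ≈ A s * B d) →
    (∀ s d → t (s ℤ.+ d) * w (d ℤ.- s ℤ.- + 1) ≈ c * (C s * D d)) →
    total N t * total N w ≈ total N A * total N B + c * (total N C * total N D)
  total-product N t w A B C D c t-supp w-supp A-supp C-supp even odd = begin
    total N t * total N w
      ≈⟨ ∑-*ʳ (suc (N ℕ.+ N)) (total N w) _ ⟨
    ∑ (suc (N ℕ.+ N)) (λ i → t (-N ℤ.+ + i) * total N w)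
      ≈⟨ ∑-cong< (suc (N ℕ.+ N)) shear ⟩
    ∑ (suc (N ℕ.+ N)) (λ i → window P (suc (N ℕ.+ N) ℕ.* 2) (λ p → t (-N ℤ.+ + i) * w (p ℤ.- (-N ℤ.+ + i))))
      ≈⟨ ∑-swap (suc (N ℕ.+ N)) (suc (N ℕ.+ N) ℕ.* 2)
           (λ i k → t (-N ℤ.+ + i) * w (P ℤ.+ + k ℤ.- (-N ℤ.+ + i))) ⟩
    window P (suc (N ℕ.+ N) ℕ.* 2) h
      ≈⟨ window-parity -N (suc (N ℕ.+ N)) h ⟩
    total N (λ d → h (+ 2 ℤ.* d ℤ.- + 1) + h (+ 2 ℤ.* d))
      ≈⟨ ∑-cong< (suc (N ℕ.+ N)) (λ j j≤2N → +-cong (odd-part j j≤2N) (even-part j j≤2N)) ⟩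
    total N (λ d → c * (total N C * D d) + total N A * B d)
      ≈⟨ ∑-distrib-+ (suc (N ℕ.+ N)) _ _ ⟩
    _ ≈⟨ +-cong (trans (∑-*ˡ (suc (N ℕ.+ N)) c _) (*-congˡ (∑-*ˡ (suc (N ℕ.+ N)) (total N C) _)))
                (∑-*ˡ (suc (N ℕ.+ N)) (total N A) _) ⟩
    c * (total N C * total N D) + total N A * total N B
      ≈⟨ +-comm _ _ ⟩
    total N A * total N B + c * (total N C * total N D) ∎
    where
    -N = ℤ.- + N
    -- The sum p of two indices runs from -2N - 1 to 2N. The extra value at the lower end makes the
    -- range a union of pairs (2d - 1, 2d) with d from -N to N.
    P = + 2 ℤ.* -N ℤ.- + 1
    h : ℤ → Carrier
    h p = total N (λ m → t m * w (p ℤ.- m))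

    -- For |m| ≤ N the translated range p - m begins at or below -N - 1 and ends at or above N, so
    -- it contains the whole support of w.
    shear : ∀ i → i < suc (N ℕ.+ N) → t (-N ℤ.+ + i) * total N w
            ≈ window P (suc (N ℕ.+ N) ℕ.* 2) (λ p → t (-N ℤ.+ + i) * w (p ℤ.- (-N ℤ.+ + i)))
    shear i (s≤s i≤2N) with ℕ.m≤n⇒∃[o]m+o≡n i≤2N
    ... | r , i+r≡2N = sym (trans (∑-*ˡ (suc (N ℕ.+ N) ℕ.* 2) _ _) (*-congˡ (begin
      window P (suc (N ℕ.+ N) ℕ.* 2) (λ p → w (p ℤ.- m))
        ≈⟨ ∑-cong (suc (N ℕ.+ N) ℕ.* 2) (λ k → reflexive (≡.cong w (origin (+ k)))) ⟩
      window (ℤ.- + (N ℕ.+ suc i)) (suc (N ℕ.+ N) ℕ.* 2) w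
        ≡⟨ ≡.cong (λ l → window (ℤ.- + (N ℕ.+ suc i)) l w) len ⟩
      window (ℤ.- + (N ℕ.+ suc i)) (suc i ℕ.+ (suc (N ℕ.+ N) ℕ.+ r)) w
        ≈⟨ window-total N (suc i) r w w-supp ⟩
      total N w ∎)))
      where
      m = -N ℤ.+ + i
      origin : ∀ k → P ℤ.+ k ℤ.- m ≡ ℤ.- + (N ℕ.+ suc i) ℤ.+ k
      origin k = lemma (+ N) (+ i) k
        where
        lemma : ∀ N i k → + 2 ℤ.* ℤ.- N ℤ.- + 1 ℤ.+ k ℤ.- (ℤ.- N ℤ.+ i) ≡ ℤ.- (N ℤ.+ (+ 1 ℤ.+ i)) ℤ.+ k
        lemma = ℤRing.solve-∀
      len : suc (N ℕ.+ N) ℕ.* 2 ≡ suc i ℕ.+ (suc (N ℕ.+ N) ℕ.+ r)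
      len = ≡.trans (lemma₁ (N ℕ.+ N)) (≡.trans (≡.cong (λ x → suc x ℕ.+ suc (N ℕ.+ N)) (≡.sym i+r≡2N)) (lemma₂ i r (N ℕ.+ N)))
        where
        lemma₁ : ∀ n → suc n ℕ.* 2 ≡ suc n ℕ.+ suc n
        lemma₁ = ℕRing.solve-∀
        lemma₂ : ∀ i r n → suc (i ℕ.+ r) ℕ.+ suc n ≡ suc i ℕ.+ (suc n ℕ.+ r)
        lemma₂ = ℕRing.solve-∀

    -- Substituting m = d + s with |d| ≤ N moves the support into [-2N, 2N], a range that no longer
    -- depends on d, so that s and d can be summed separately.
    recentre : ∀ j → j < suc (N ℕ.+ N) → ∀ f → SupportedIn N f →
      total N f ≈ total (N ℕ.+ N) (λ s → f ((-N ℤ.+ + j) ℤ.+ s))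
    recentre j (s≤s j≤2N) f f-supp with ℕ.m≤n⇒∃[o]m+o≡n j≤2N
    ... | r , j+r≡2N = sym (begin
      total (N ℕ.+ N) (λ s → f (d ℤ.+ s))
        ≈⟨ window-shift d _ (suc (N ℕ.+ N ℕ.+ (N ℕ.+ N))) f ⟩
      window (d ℤ.+ ℤ.- + (N ℕ.+ N)) (suc (N ℕ.+ N ℕ.+ (N ℕ.+ N))) f
        ≡⟨ ≡.cong₂ (λ a l → window a l f) origin len ⟩
      window (ℤ.- + (N ℕ.+ r)) (r ℕ.+ (suc (N ℕ.+ N) ℕ.+ j)) f
        ≈⟨ window-total N r j f f-supp ⟩
      total N f ∎)
      where
      d = -N ℤ.+ + j
      origin : d ℤ.+ ℤ.- + (N ℕ.+ N) ≡ ℤ.- + (N ℕ.+ r)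
      origin = ≡.trans (≡.cong (λ n → d ℤ.+ ℤ.- + n) (≡.sym j+r≡2N)) (lemma (+ N) (+ j) (+ r))
        where
        lemma : ∀ N j r → ℤ.- N ℤ.+ j ℤ.+ ℤ.- (j ℤ.+ r) ≡ ℤ.- (N ℤ.+ r)
        lemma = ℤRing.solve-∀
      len : suc (N ℕ.+ N ℕ.+ (N ℕ.+ N)) ≡ r ℕ.+ (suc (N ℕ.+ N) ℕ.+ j)
      len = ≡.trans (≡.cong (λ x → suc (N ℕ.+ N ℕ.+ x)) (≡.sym j+r≡2N)) (lemma j r (N ℕ.+ N))
        where
        lemma : ∀ j r n → suc (n ℕ.+ (j ℕ.+ r)) ≡ r ℕ.+ (suc n ℕ.+ j)
        lemma = ℕRing.solve-∀

    diagonal : ∀ p → SupportedIn N (λ m → t m * w (p ℤ.- m))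
    diagonal p m N<m = trans (*-congʳ (t-supp m N<m)) (zeroˡ _)

    widen : ∀ f → SupportedIn N f → total (N ℕ.+ N) f ≈ total N f
    widen f f-supp = begin
      total (N ℕ.+ N) f
        ≡⟨ ≡.cong (λ l → window (ℤ.- + (N ℕ.+ N)) l f) (lemma N) ⟩
      window (ℤ.- + (N ℕ.+ N)) (N ℕ.+ (suc (N ℕ.+ N) ℕ.+ N)) f
        ≈⟨ window-total N N N f f-supp ⟩
      total N f ∎
      where
      lemma : ∀ N → suc (N ℕ.+ N ℕ.+ (N ℕ.+ N)) ≡ N ℕ.+ (suc (N ℕ.+ N) ℕ.+ N)
      lemma = ℕRing.solve-∀

    even-part : ∀ j → j < suc (N ℕ.+ N) → h (+ 2 ℤ.* (-N ℤ.+ + j)) ≈ total N A * B (-N ℤ.+ + j)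
    even-part j j<2N = begin
      h (+ 2 ℤ.* d)
        ≈⟨ recentre j j<2N _ (diagonal (+ 2 ℤ.* d)) ⟩
      total (N ℕ.+ N) (λ s → t (d ℤ.+ s) * w (+ 2 ℤ.* d ℤ.- (d ℤ.+ s)))
        ≈⟨ ∑-cong L (λ k → trans (reflexive (≡.cong₂ (λ x y → t x * w y) (ℤ.+-comm d _) (lemma d _))) (even _ d)) ⟩
      total (N ℕ.+ N) (λ s → A s * B d)
        ≈⟨ ∑-*ʳ L (B d) _ ⟩
      total (N ℕ.+ N) A * B d
        ≈⟨ *-congʳ (widen A A-supp) ⟩
      total N A * B d ∎
      where
      d = -N ℤ.+ + j
      L = suc (N ℕ.+ N ℕ.+ (N ℕ.+ N))
      lemma : ∀ d s → + 2 ℤ.* d ℤ.- (d ℤ.+ s) ≡ d ℤ.- s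
      lemma = ℤRing.solve-∀

    odd-part : ∀ j → j < suc (N ℕ.+ N) →
      h (+ 2 ℤ.* (-N ℤ.+ + j) ℤ.- + 1) ≈ c * (total N C * D (-N ℤ.+ + j))
    odd-part j j<2N = begin
      h (+ 2 ℤ.* d ℤ.- + 1)
        ≈⟨ recentre j j<2N _ (diagonal (+ 2 ℤ.* d ℤ.- + 1)) ⟩
      total (N ℕ.+ N) (λ s → t (d ℤ.+ s) * w (+ 2 ℤ.* d ℤ.- + 1 ℤ.- (d ℤ.+ s)))
        ≈⟨ ∑-cong L (λ k → trans (reflexive (≡.cong₂ (λ x y → t x * w y) (ℤ.+-comm d _) (lemma d _))) (odd _ d)) ⟩
      total (N ℕ.+ N) (λ s → c * (C s * D d))
        ≈⟨ ∑-*ˡ L c _ ⟩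
      c * total (N ℕ.+ N) (λ s → C s * D d)
        ≈⟨ *-congˡ (trans (∑-*ʳ L (D d) _) (*-congʳ (widen C C-supp))) ⟩
      c * (total N C * D d) ∎
      where
      d = -N ℤ.+ + j
      L = suc (N ℕ.+ N ℕ.+ (N ℕ.+ N))
      lemma : ∀ d s → + 2 ℤ.* d ℤ.- + 1 ℤ.- (d ℤ.+ s) ≡ d ℤ.- s ℤ.- + 1
      lemma = ℤRing.solve-∀

-- The Jacobi triple product for a nilpotent parameter

-- This is n(n - 1)/2, the exponent of Q that goes with x^n in the Jacobi triple product.
triangle : ℕ → ℕ
triangle zero    = 0
triangle (suc n) = n ℕ.+ triangle n

module NilpotentParameter {c ℓ} (R : CommutativeRing c ℓ) (q : CommutativeRing.Carrier R) (N : ℕ) where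
  open CommutativeRing R
  open import Algebra.Properties.CommutativeSemiring.Exp commutativeSemiring
  open import Algebra.Properties.Ring ring using (-0#≈0#)
  open import Relation.Binary.Reasoning.Setoid setoid
  open RingSums R
  open DifferenceSolver R

  Unit : Carrier → Set _
  Unit x = ∃ λ y → x * y ≈ 1#

  unit-* : ∀ {x y} → Unit x → Unit y → Unit (x * y)
  unit-* {x} {y} (x⁻¹ , xx⁻¹) (y⁻¹ , yy⁻¹) = x⁻¹ * y⁻¹ , (begin
    (x * y) * (x⁻¹ * y⁻¹)
      ≈⟨ solve 4 (λ x y x′ y′ → (x :* y) :* (x′ :* y′) := (x :* x′) :* (y :* y′)) refl x y x⁻¹ y⁻¹ ⟩
    (x * x⁻¹) * (y * y⁻¹)  ≈⟨ *-cong xx⁻¹ yy⁻¹ ⟩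
    1# * 1#                ≈⟨ *-identityˡ 1# ⟩
    1#                     ∎)

  unit-cancel : ∀ {u x y} → Unit u → u * x ≈ u * y → x ≈ y
  unit-cancel {u} {x} {y} (u⁻¹ , uu⁻¹) ux≈uy = begin
    x              ≈⟨ undo x ⟨
    u⁻¹ * (u * x)  ≈⟨ *-congˡ ux≈uy ⟩
    u⁻¹ * (u * y)  ≈⟨ undo y ⟩
    y              ∎
    where
    undo : ∀ z → u⁻¹ * (u * z) ≈ z
    undo z = begin
      u⁻¹ * (u * z)  ≈⟨ *-assoc _ _ _ ⟨
      u⁻¹ * u * z    ≈⟨ *-congʳ (trans (*-comm u⁻¹ u) uu⁻¹) ⟩
      1# * z         ≈⟨ *-identityˡ z ⟩
      z              ∎

  unit-∏ : ∀ n {f} → (∀ i → Unit (f i)) → Unit (∏ n f)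
  unit-∏ zero    units = 1# , *-identityˡ 1#
  unit-∏ (suc n) units = unit-* (unit-∏ n units) (units n)

  geometric : ∀ x n → (1# - x) * ∑ n (x ^_) ≈ 1# - x ^ n
  geometric x zero    = trans (zeroʳ _) (sym (-‿inverseʳ 1#))
  geometric x (suc n) = begin
    (1# - x) * (∑ n (x ^_) + x ^ n)             ≈⟨ distribˡ _ _ _ ⟩
    (1# - x) * ∑ n (x ^_) + (1# - x) * x ^ n    ≈⟨ +-congʳ (geometric x n) ⟩
    (1# - x ^ n) + (1# - x) * x ^ n
      ≈⟨ solve 2 (λ x p → (con (1 , 0) :- p) :+ (con (1 , 0) :- x) :* p := con (1 , 0) :- x :* p) refl x (x ^ n) ⟩
    1# - x * x ^ n                              ∎

  module Nilpotent (q^N≈0 : q ^ N ≈ 0#) where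

    q^≈0 : ∀ k → N ≤ k → q ^ k ≈ 0#
    q^≈0 k N≤k = begin
      q ^ k                     ≡⟨ ≡.cong (q ^_) (ℕ.m+[n∸m]≡n N≤k) ⟨
      q ^ (N ℕ.+ (k ∸ N))       ≈⟨ ^-homo-* q N (k ∸ N) ⟩
      q ^ N * q ^ (k ∸ N)       ≈⟨ *-congʳ q^N≈0 ⟩
      0# * q ^ (k ∸ N)          ≈⟨ zeroˡ _ ⟩
      0#                        ∎

    inverse : ∀ k .{{_ : NonZero k}} → (1# - q ^ k) * ∑ N ((q ^ k) ^_) ≈ 1#
    inverse k = begin
      (1# - q ^ k) * ∑ N ((q ^ k) ^_)  ≈⟨ geometric (q ^ k) N ⟩
      1# - (q ^ k) ^ N                 ≈⟨ +-congˡ (-‿cong (trans (^-assocʳ q k N) (q^≈0 _ (ℕ.m≤n*m N k)))) ⟩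
      1# - 0#                          ≈⟨ trans (+-congˡ -0#≈0#) (+-identityʳ 1#) ⟩
      1#                               ∎

    unit-1-q^ : ∀ k .{{_ : NonZero k}} → Unit (1# - q ^ k)
    unit-1-q^ k = _ , inverse k

    module Base (m : ℕ) .{{_ : NonZero m}} where

      Q : Carrier
      Q = q ^ m

      Q^≈0 : ∀ k → N ≤ k → Q ^ k ≈ 0#
      Q^≈0 k N≤k = trans (^-assocʳ q m k) (q^≈0 _ (ℕ.≤-trans N≤k (ℕ.m≤n*m k m)))

      factor : ℕ → Carrier
      factor i = 1# - Q ^ suc i

      factor⁻¹ : ℕ → Carrier
      factor⁻¹ i = ∑ N ((q ^ (m ℕ.* suc i)) ^_)

      factor-inverse : ∀ i → factor i * factor⁻¹ i ≈ 1#
      factor-inverse i = trans (*-congʳ (+-congˡ (-‿cong (^-assocʳ q m (suc i)))))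
                               (inverse (m ℕ.* suc i) {{ℕ.m*n≢0 m (suc i)}})

      qfac : ℕ → Carrier
      qfac n = ∏ n factor

      qfac⁻¹ : ℕ → Carrier
      qfac⁻¹ n = ∏ n factor⁻¹

      qfac-inverse : ∀ n → qfac n * qfac⁻¹ n ≈ 1#
      qfac-inverse n = trans (sym (∏-distrib-* n _ _)) (∏-one n λ i _ → factor-inverse i)

      qfac-stable : ∀ {n} → N ≤ n → qfac n ≈ qfac N
      qfac-stable N≤n = ∏-stable factor N≤n λ i N≤i →
        trans (+-congˡ (trans (-‿cong (Q^≈0 (suc i) (ℕ.m≤n⇒m≤1+n N≤i))) -0#≈0#)) (+-identityʳ 1#)

      qfac⁻¹-stable : ∀ {n} → N ≤ n → qfac⁻¹ n ≈ qfac⁻¹ N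
      qfac⁻¹-stable {n} N≤n = unit-cancel (_ , qfac-inverse N) (begin
        qfac N * qfac⁻¹ n   ≈⟨ *-congʳ (qfac-stable N≤n) ⟨
        qfac n * qfac⁻¹ n   ≈⟨ qfac-inverse n ⟩
        1#                  ≈⟨ qfac-inverse N ⟨
        qfac N * qfac⁻¹ N   ∎)

      -- The Gaussian binomial coefficient of k + l over k.
      binom : ℕ → ℕ → Carrier
      binom k l = qfac (k ℕ.+ l) * (qfac⁻¹ k * qfac⁻¹ l)

      binom-comm : ∀ k l → binom k l ≈ binom l k
      binom-comm k l = *-cong (reflexive (≡.cong qfac (ℕ.+-comm k l))) (*-comm _ _)

      binom-0ˡ : ∀ l → binom 0 l ≈ 1#
      binom-0ˡ l = trans (*-congˡ (*-identityˡ _)) (qfac-inverse l)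

      binom-0ʳ : ∀ k → binom k 0 ≈ 1#
      binom-0ʳ k = trans (binom-comm k 0) (binom-0ˡ k)

      -- With x = Q^(k+1) and y = Q^(l+1), the top factor is 1 - yx = (1 - y) + y(1 - x), and in
      -- each summand one factor cancels against its inverse.
      binom-pascal : ∀ k l → binom (suc k) (suc l) ≈ binom (suc k) l + Q ^ suc l * binom k (suc l)
      binom-pascal k l = begin
        qfac (suc k ℕ.+ suc l) * ((qfac⁻¹ k * g) * (qfac⁻¹ l * h))
          ≡⟨ ≡.cong (λ n → qfac n * ((qfac⁻¹ k * g) * (qfac⁻¹ l * h))) (ℕ.+-suc (suc k) l) ⟩
        (A * (1# - Q ^ suc (suc (k ℕ.+ l)))) * ((qfac⁻¹ k * g) * (qfac⁻¹ l * h))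
          ≈⟨ *-congʳ (*-congˡ (+-congˡ (-‿cong power))) ⟩
        (A * (1# - y * x)) * ((qfac⁻¹ k * g) * (qfac⁻¹ l * h))
          ≈⟨ solve 7 (λ A x y k g l h →
               (A :* (con (1 , 0) :- y :* x)) :* ((k :* g) :* (l :* h))
               := ((con (1 , 0) :- y) :* h) :* (A :* ((k :* g) :* l))
                  :+ y :* (((con (1 , 0) :- x) :* g) :* (A :* (k :* (l :* h)))))
             refl A x y (qfac⁻¹ k) g (qfac⁻¹ l) h ⟩
        (factor l * h) * (A * ((qfac⁻¹ k * g) * qfac⁻¹ l)) + y * ((factor k * g) * (A * (qfac⁻¹ k * (qfac⁻¹ l * h))))
          ≈⟨ +-cong (trans (*-congʳ (factor-inverse l)) (*-identityˡ _))
                    (*-congˡ (trans (*-congʳ (factor-inverse k)) (*-identityˡ _))) ⟩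
        A * ((qfac⁻¹ k * g) * qfac⁻¹ l) + y * (A * (qfac⁻¹ k * (qfac⁻¹ l * h)))
          ≡⟨ ≡.cong (λ n → A * ((qfac⁻¹ k * g) * qfac⁻¹ l) + y * (qfac n * (qfac⁻¹ k * (qfac⁻¹ l * h)))) (ℕ.+-suc k l) ⟨
        binom (suc k) l + Q ^ suc l * binom k (suc l) ∎
        where
        A = qfac (suc (k ℕ.+ l))
        x = Q ^ suc k
        y = Q ^ suc l
        g = factor⁻¹ k
        h = factor⁻¹ l
        power : Q ^ suc (suc (k ℕ.+ l)) ≈ y * x
        power = begin
          Q ^ suc (suc (k ℕ.+ l))  ≡⟨ ≡.cong (Q ^_) (lemma k l) ⟩
          Q ^ (suc l ℕ.+ suc k)    ≈⟨ ^-homo-* Q (suc l) (suc k) ⟩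
          y * x                    ∎
          where
          lemma : ∀ k l → suc (suc (k ℕ.+ l)) ≡ suc l ℕ.+ suc k
          lemma = ℕRing.solve-∀

      -- Plays the part of the limit of the Gaussian binomial: every factor 1 - Q^i with i ≥ N
      -- equals 1, so two of the three factorials cancel.
      binom-limit : ∀ {k l} → N ≤ k → N ≤ l → binom k l ≈ qfac⁻¹ N
      binom-limit {k} {l} N≤k N≤l = begin
        qfac (k ℕ.+ l) * (qfac⁻¹ k * qfac⁻¹ l)
          ≈⟨ *-cong (qfac-stable (ℕ.≤-trans N≤k (ℕ.m≤m+n k l)))
                    (*-cong (qfac⁻¹-stable N≤k) (qfac⁻¹-stable N≤l)) ⟩
        qfac N * (qfac⁻¹ N * qfac⁻¹ N)  ≈⟨ *-assoc _ _ _ ⟨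
        qfac N * qfac⁻¹ N * qfac⁻¹ N    ≈⟨ *-congʳ (qfac-inverse N) ⟩
        1# * qfac⁻¹ N                   ≈⟨ *-identityˡ _ ⟩
        qfac⁻¹ N                        ∎

      -- The term x^k Q^(k(k-1)/2) for an integer k, where x′ stands for Q/x. For k = -n it is x′^n
      -- Q^(n(n-1)/2), which needs no inverse of x.
      thetaTerm : Carrier → Carrier → ℤ → Carrier
      thetaTerm x x′ (+ j)      = x ^ j * Q ^ triangle j
      thetaTerm x x′ (-[1+ j ]) = x′ ^ suc j * Q ^ triangle (suc j)

      thetaTerm-neg : ∀ x x′ j → thetaTerm x x′ (0 ⊖ j) ≈ thetaTerm x′ x (+ j)
      thetaTerm-neg x x′ zero    = refl
      thetaTerm-neg x x′ (suc j) = refl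

      -- The sum side of the finite Jacobi triple product, that is, the q-binomial theorem with its
      -- index shifted by n. Here m and n are the numbers of factors in x and in x′.
      finiteTheta : Carrier → Carrier → ℕ → ℕ → Carrier
      finiteTheta x x′ m n =
        ∑ (suc (m ℕ.+ n)) (λ j → binom j (m ℕ.+ n ∸ j) * thetaTerm x x′ (j ⊖ n))

      module _ (x x′ : Carrier) (x*x′≈Q : x * x′ ≈ Q) where

        -- Consecutive terms have the ratio x Q^k with k = i - n, and k + l = m. Below zero the
        -- factor x comes out of x * x′ = Q.
        thetaTerm-raise : ∀ i n l m → i ℕ.+ l ≡ m ℕ.+ n →
          Q ^ l * thetaTerm x x′ (suc i ⊖ n) ≈ thetaTerm x x′ (i ⊖ n) * (x * Q ^ m)
        thetaTerm-raise i zero l m eq = begin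
          Q ^ l * ((x * x ^ i) * Q ^ (i ℕ.+ triangle i))
            ≈⟨ *-congˡ (*-congˡ (^-homo-* Q i (triangle i))) ⟩
          Q ^ l * ((x * x ^ i) * (Q ^ i * Q ^ triangle i))
            ≈⟨ solve 5 (λ l x xi i t → l :* ((x :* xi) :* (i :* t)) := (xi :* t) :* (x :* (i :* l)))
               refl (Q ^ l) x (x ^ i) (Q ^ i) (Q ^ triangle i) ⟩
          (x ^ i * Q ^ triangle i) * (x * (Q ^ i * Q ^ l))
            ≈⟨ *-congˡ (*-congˡ (^-homo-* Q i l)) ⟨
          (x ^ i * Q ^ triangle i) * (x * Q ^ (i ℕ.+ l))
            ≡⟨ ≡.cong (λ k → (x ^ i * Q ^ triangle i) * (x * Q ^ k)) (≡.trans eq (ℕ.+-identityʳ m)) ⟩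
          (x ^ i * Q ^ triangle i) * (x * Q ^ m) ∎
        thetaTerm-raise zero (suc n) l m eq = begin
          Q ^ l * thetaTerm x x′ (1 ⊖ suc n)
            ≡⟨ ≡.cong (λ z → Q ^ l * thetaTerm x x′ z) (ℤ.[1+m]⊖[1+n]≡m⊖n 0 n) ⟩
          Q ^ l * thetaTerm x x′ (0 ⊖ n)
            ≈⟨ *-congˡ (thetaTerm-neg x x′ n) ⟩
          Q ^ l * (x′ ^ n * Q ^ triangle n)
            ≡⟨ ≡.cong (λ k → Q ^ k * (x′ ^ n * Q ^ triangle n)) (≡.trans eq (ℕ.+-suc m n)) ⟩
          (Q * Q ^ (m ℕ.+ n)) * (x′ ^ n * Q ^ triangle n)
            ≈⟨ *-congʳ (*-cong (sym x*x′≈Q) (^-homo-* Q m n)) ⟩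
          ((x * x′) * (Q ^ m * Q ^ n)) * (x′ ^ n * Q ^ triangle n)
            ≈⟨ solve 6 (λ x x′ m n xn t → ((x :* x′) :* (m :* n)) :* (xn :* t) := ((x′ :* xn) :* (n :* t)) :* (x :* m))
               refl x x′ (Q ^ m) (Q ^ n) (x′ ^ n) (Q ^ triangle n) ⟩
          ((x′ * x′ ^ n) * (Q ^ n * Q ^ triangle n)) * (x * Q ^ m)
            ≈⟨ *-congʳ (*-congˡ (^-homo-* Q n (triangle n))) ⟨
          (x′ ^ suc n * Q ^ triangle (suc n)) * (x * Q ^ m) ∎
        thetaTerm-raise (suc i) (suc n) l m eq = begin
          Q ^ l * thetaTerm x x′ (suc (suc i) ⊖ suc n)
            ≡⟨ ≡.cong (λ z → Q ^ l * thetaTerm x x′ z) (ℤ.[1+m]⊖[1+n]≡m⊖n (suc i) n) ⟩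
          Q ^ l * thetaTerm x x′ (suc i ⊖ n)
            ≈⟨ thetaTerm-raise i n l m (ℕ.suc-injective (≡.trans eq (ℕ.+-suc m n))) ⟩
          thetaTerm x x′ (i ⊖ n) * (x * Q ^ m)
            ≡⟨ ≡.cong (λ z → thetaTerm x x′ z * (x * Q ^ m)) (ℤ.[1+m]⊖[1+n]≡m⊖n i n) ⟨
          thetaTerm x x′ (suc i ⊖ suc n) * (x * Q ^ m) ∎

        -- The q-Pascal rule splits every inner coefficient in two. The first parts form the old
        -- sum; in the second parts the power of Q and the raised index combine to the constant
        -- factor x Q^m, which leaves the old sum again.
        finiteTheta-step : ∀ m n → finiteTheta x x′ (suc m) n ≈ finiteTheta x x′ m n * (1# + x * Q ^ m)
        finiteTheta-step m n = begin
          ∑ (suc (suc s)) f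
            ≈⟨ ∑-suc (suc s) f ⟩
          f 0 + (∑ s (f ∘ suc) + f (suc s))
            ≈⟨ +-cong first (+-cong (∑-cong< s middle) last) ⟩
          g 0 + (∑ s (λ i → g (suc i) + h i) + h s)
            ≈⟨ +-congˡ (+-congʳ (∑-distrib-+ s (g ∘ suc) h)) ⟩
          g 0 + ((∑ s (g ∘ suc) + ∑ s h) + h s)
            ≈⟨ solve 4 (λ a b c d → a :+ ((b :+ c) :+ d) := (a :+ b) :+ (c :+ d)) refl (g 0) _ _ (h s) ⟩
          (g 0 + ∑ s (g ∘ suc)) + ∑ (suc s) h
            ≈⟨ +-cong (sym (∑-suc s g)) (trans (∑-cong< (suc s) raise) (∑-*ʳ (suc s) (x * Q ^ m) g)) ⟩
          ∑ (suc s) g + ∑ (suc s) g * (x * Q ^ m)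
            ≈⟨ solve 2 (λ a b → a :+ a :* b := a :* (con (1 , 0) :+ b)) refl _ (x * Q ^ m) ⟩
          ∑ (suc s) g * (1# + x * Q ^ m) ∎
          where
          s = m ℕ.+ n
          X : ℕ → Carrier
          X j = thetaTerm x x′ (j ⊖ n)
          f g h : ℕ → Carrier
          f j = binom j (suc s ∸ j) * X j
          g j = binom j (s ∸ j) * X j
          h i = Q ^ (s ∸ i) * binom i (s ∸ i) * X (suc i)
          first : f 0 ≈ g 0
          first = *-congʳ (trans (binom-0ˡ (suc s)) (sym (binom-0ˡ s)))
          last : f (suc s) ≈ h s
          last = *-congʳ (begin
            binom (suc s) (s ∸ s)        ≡⟨ ≡.cong (binom (suc s)) (ℕ.n∸n≡0 s) ⟩
            binom (suc s) 0              ≈⟨ trans (binom-0ʳ (suc s)) (sym (binom-0ʳ s)) ⟩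
            binom s 0                    ≈⟨ *-identityˡ _ ⟨
            Q ^ 0 * binom s 0            ≡⟨ ≡.cong (λ k → Q ^ k * binom s k) (ℕ.n∸n≡0 s) ⟨
            Q ^ (s ∸ s) * binom s (s ∸ s) ∎)
          middle : ∀ i → i < s → f (suc i) ≈ g (suc i) + h i
          middle i i<s = begin
            binom (suc i) (s ∸ i) * X (suc i)
              ≡⟨ ≡.cong (λ k → binom (suc i) k * X (suc i)) eq ⟩
            binom (suc i) (suc (s ∸ suc i)) * X (suc i)
              ≈⟨ *-congʳ (binom-pascal i (s ∸ suc i)) ⟩
            (binom (suc i) (s ∸ suc i) + Q ^ suc (s ∸ suc i) * binom i (suc (s ∸ suc i))) * X (suc i)
              ≈⟨ distribʳ _ _ _ ⟩
            g (suc i) + Q ^ suc (s ∸ suc i) * binom i (suc (s ∸ suc i)) * X (suc i)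
              ≡⟨ ≡.cong (λ k → g (suc i) + Q ^ k * binom i k * X (suc i)) eq ⟨
            g (suc i) + h i ∎
            where
            eq : s ∸ i ≡ suc (s ∸ suc i)
            eq = ℕ.+-∸-assoc 1 i<s
          raise : ∀ i → i < suc s → h i ≈ g i * (x * Q ^ m)
          raise i (s≤s i≤s) = begin
            Q ^ (s ∸ i) * binom i (s ∸ i) * X (suc i)
              ≈⟨ solve 3 (λ a b c → a :* b :* c := b :* (a :* c)) refl (Q ^ (s ∸ i)) _ _ ⟩
            binom i (s ∸ i) * (Q ^ (s ∸ i) * X (suc i))
              ≈⟨ *-congˡ (thetaTerm-raise i n (s ∸ i) m (ℕ.m+[n∸m]≡n i≤s)) ⟩
            binom i (s ∸ i) * (X i * (x * Q ^ m))
              ≈⟨ *-assoc _ _ _ ⟨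
            g i * (x * Q ^ m) ∎

        finiteTheta-product : ∀ m n → finiteTheta x x′ m n ≈ finiteTheta x x′ 0 n * ∏ m (λ i → 1# + x * Q ^ i)
        finiteTheta-product zero    n = sym (*-identityʳ _)
        finiteTheta-product (suc m) n = trans (finiteTheta-step m n)
          (trans (*-congʳ (finiteTheta-product m n)) (*-assoc _ _ _))

      finiteTheta-0-0 : ∀ x x′ → finiteTheta x x′ 0 0 ≈ 1#
      finiteTheta-0-0 x x′ = begin
        0# + binom 0 0 * (1# * 1#)  ≈⟨ +-identityˡ _ ⟩
        binom 0 0 * (1# * 1#)       ≈⟨ *-cong (binom-0ˡ 0) (*-identityˡ 1#) ⟩
        1# * 1#                     ≈⟨ *-identityˡ 1# ⟩
        1#                          ∎

      -- Reversing the order of summation exchanges x and x′, so the factors in x′ are produced by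
      -- the same recursion as those in x.
      finiteTheta-swap : ∀ x x′ n → finiteTheta x x′ 0 n ≈ finiteTheta x′ x n 0
      finiteTheta-swap x x′ n = begin
        ∑ (suc n) (λ j → binom j (n ∸ j) * thetaTerm x x′ (j ⊖ n))
          ≈⟨ ∑-reverse (suc n) _ ⟩
        ∑ (suc n) (λ j → binom (n ∸ j) (n ∸ (n ∸ j)) * thetaTerm x x′ ((n ∸ j) ⊖ n))
          ≈⟨ ∑-cong< (suc n) termwise ⟩
        ∑ (suc n) (λ j → binom j (n ∸ j) * thetaTerm x′ x (j ⊖ 0))
          ≡⟨ ≡.cong (λ k → ∑ (suc k) (λ j → binom j (k ∸ j) * thetaTerm x′ x (j ⊖ 0))) (ℕ.+-identityʳ n) ⟨
        finiteTheta x′ x n 0 ∎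
        where
        termwise : ∀ j → j < suc n →
          binom (n ∸ j) (n ∸ (n ∸ j)) * thetaTerm x x′ ((n ∸ j) ⊖ n) ≈ binom j (n ∸ j) * thetaTerm x′ x (+ j)
        termwise j (s≤s j≤n) = *-cong
          (trans (reflexive (≡.cong (binom (n ∸ j)) (ℕ.m∸[m∸n]≡n j≤n))) (binom-comm (n ∸ j) j))
          (trans (reflexive (≡.cong (thetaTerm x x′) index)) (thetaTerm-neg x x′ j))
          where
          index : (n ∸ j) ⊖ n ≡ 0 ⊖ j
          index = ≡.trans (≡.cong ((n ∸ j) ⊖_) (≡.sym (ℕ.m∸n+n≡m j≤n)))
            (≡.trans (≡.cong (_⊖ (n ∸ j ℕ.+ j)) (≡.sym (ℕ.+-identityʳ (n ∸ j)))) (ℤ.+-cancelˡ-⊖ (n ∸ j) 0 j))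

      finiteTripleProduct : ∀ x x′ → x * x′ ≈ Q → ∀ m n →
        finiteTheta x x′ m n ≈ ∏ m (λ i → 1# + x * Q ^ i) * ∏ n (λ i → 1# + x′ * Q ^ i)
      finiteTripleProduct x x′ xx′≈Q m n = begin
        finiteTheta x x′ m n
          ≈⟨ finiteTheta-product x x′ xx′≈Q m n ⟩
        finiteTheta x x′ 0 n * Πx
          ≈⟨ *-congʳ (finiteTheta-swap x x′ n) ⟩
        finiteTheta x′ x n 0 * Πx
          ≈⟨ *-congʳ (finiteTheta-product x′ x (trans (*-comm x′ x) xx′≈Q) n 0) ⟩
        (finiteTheta x′ x 0 0 * Πx′) * Πx
          ≈⟨ *-congʳ (trans (*-congʳ (finiteTheta-0-0 x′ x)) (*-identityˡ _)) ⟩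
        Πx′ * Πx
          ≈⟨ *-comm _ _ ⟩
        Πx * Πx′ ∎
        where
        Πx = ∏ m (λ i → 1# + x * Q ^ i)
        Πx′ = ∏ n (λ i → 1# + x′ * Q ^ i)

      tripleProduct : ∀ x x′ → x * x′ ≈ Q → SupportedIn N (thetaTerm x x′) →
        ∏ (N ℕ.+ N) (λ i → 1# + x * Q ^ i) * ∏ (N ℕ.+ N) (λ i → 1# + x′ * Q ^ i)
        ≈ qfac⁻¹ N * total N (thetaTerm x x′)
      tripleProduct x x′ xx′≈Q supp = begin
        ∏ K (λ i → 1# + x * Q ^ i) * ∏ K (λ i → 1# + x′ * Q ^ i)
          ≈⟨ finiteTripleProduct x x′ xx′≈Q K K ⟨
        ∑ (suc (K ℕ.+ K)) (λ j → binom j (K ℕ.+ K ∸ j) * thetaTerm x x′ (j ⊖ K))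
          ≈⟨ ∑-cong (suc (K ℕ.+ K)) limit ⟩
        ∑ (suc (K ℕ.+ K)) (λ j → qfac⁻¹ N * thetaTerm x x′ (j ⊖ K))
          ≈⟨ ∑-*ˡ (suc (K ℕ.+ K)) (qfac⁻¹ N) _ ⟩
        qfac⁻¹ N * ∑ (suc (K ℕ.+ K)) (λ j → thetaTerm x x′ (j ⊖ K))
          ≈⟨ *-congˡ (∑-cong (suc (K ℕ.+ K)) λ j → reflexive (≡.cong (thetaTerm x x′) (≡.sym (ℤ.-m+n≡n⊖m K j)))) ⟩
        qfac⁻¹ N * window (ℤ.- + K) (suc (K ℕ.+ K)) (thetaTerm x x′)
          ≡⟨ ≡.cong (λ l → qfac⁻¹ N * window (ℤ.- + K) l (thetaTerm x x′)) (lemma N) ⟩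
        qfac⁻¹ N * window (ℤ.- + K) (N ℕ.+ (suc (N ℕ.+ N) ℕ.+ N)) (thetaTerm x x′)
          ≈⟨ *-congˡ (window-total N N N (thetaTerm x x′) supp) ⟩
        qfac⁻¹ N * total N (thetaTerm x x′) ∎
        where
        -- With 2N factors on either side, each term with |j - K| ≤ N has both entries of its
        -- binomial at least N, hence the limiting coefficient. All other terms vanish by the
        -- support hypothesis.
        K = N ℕ.+ N
        lemma : ∀ N → suc (N ℕ.+ N ℕ.+ (N ℕ.+ N)) ≡ N ℕ.+ (suc (N ℕ.+ N) ℕ.+ N)
        lemma = ℕRing.solve-∀
        central : ∀ j → ∣ j ⊖ K ∣ ≤ N → N ≤ j × N ≤ K ℕ.+ K ∸ j
        central j near with ℕ.≤-total j K
        ... | inj₁ j≤K = ℕ.+-cancelʳ-≤ N N j (ℕ.≤-trans (ℕ.m≤n+m∸n K j) (ℕ.+-monoʳ-≤ j (≡.subst (_≤ N) (ℤ.∣⊖∣-≤ j≤K) near)))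
                       , ℕ.m+n≤o⇒m≤o∸n N (ℕ.+-mono-≤ (ℕ.m≤m+n N N) j≤K)
        ... | inj₂ K≤j = ℕ.≤-trans (ℕ.m≤m+n N N) K≤j
                       , ℕ.m+n≤o⇒m≤o∸n N (ℕ.≤-trans (ℕ.+-monoʳ-≤ N j≤K+N) (ℕ.≤-reflexive (shuffle N)))
          where
          shuffle : ∀ N → N ℕ.+ (N ℕ.+ N ℕ.+ N) ≡ (N ℕ.+ N) ℕ.+ (N ℕ.+ N)
          shuffle = ℕRing.solve-∀
          j≤K+N : j ≤ K ℕ.+ N
          j≤K+N = ℕ.≤-trans (ℕ.m≤n+m∸n j K)
            (ℕ.+-monoʳ-≤ K (≡.subst (_≤ N) (≡.trans (ℤ.∣m⊖n∣≡∣n⊖m∣ j K) (ℤ.∣⊖∣-≤ K≤j)) near))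
        limit : ∀ j → binom j (K ℕ.+ K ∸ j) * thetaTerm x x′ (j ⊖ K) ≈ qfac⁻¹ N * thetaTerm x x′ (j ⊖ K)
        limit j with ∣ j ⊖ K ∣ ℕ.≤? N
        ... | yes near = *-congʳ (binom-limit (proj₁ (central j near)) (proj₂ (central j near)))
        ... | no far   = trans (*-congˡ vanish) (trans (zeroʳ _) (sym (trans (*-congˡ vanish) (zeroʳ _))))
          where
          vanish : thetaTerm x x′ (j ⊖ K) ≈ 0#
          vanish = supp (j ⊖ K) (ℕ.≰⇒> far)

-- Weierstrass' three-term relation

triangle-double : ∀ n → + 2 ℤ.* + triangle n ≡ + n ℤ.* + n ℤ.- + n
triangle-double zero    = ≡.refl
triangle-double (suc n) = begin
  + 2 ℤ.* (+ n ℤ.+ + triangle n)              ≡⟨ ℤ.*-distribˡ-+ (+ 2) (+ n) (+ triangle n) ⟩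
  + 2 ℤ.* + n ℤ.+ + 2 ℤ.* + triangle n        ≡⟨ ≡.cong (λ z → + 2 ℤ.* + n ℤ.+ z) (triangle-double n) ⟩
  + 2 ℤ.* + n ℤ.+ (+ n ℤ.* + n ℤ.- + n)       ≡⟨ lemma (+ n) ⟩
  (+ 1 ℤ.+ + n) ℤ.* (+ 1 ℤ.+ + n) ℤ.- (+ 1 ℤ.+ + n) ∎
  where
  open ≡.≡-Reasoning
  lemma : ∀ n → + 2 ℤ.* n ℤ.+ (n ℤ.* n ℤ.- n) ≡ (+ 1 ℤ.+ n) ℤ.* (+ 1 ℤ.+ n) ℤ.- (+ 1 ℤ.+ n)
  lemma = ℤRing.solve-∀

n≤triangle[1+n] : ∀ n → n ≤ triangle (suc n)
n≤triangle[1+n] n = ℕ.m≤m+n n (triangle n)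

-- For u + v = p this is the quadratic p k(k - 1)/2 + u k at every integer k; the complement v keeps
-- it a natural number for negative k.
exponent : (p u v : ℕ) → ℤ → ℕ
exponent p u v (+ n)      = p ℕ.* triangle n ℕ.+ u ℕ.* n
exponent p u v (-[1+ n ]) = p ℕ.* triangle (suc n) ℕ.+ v ℕ.* suc n

-- Doubling clears the denominator and merges the two signs of k, so that identities between
-- exponents become polynomial identities over the integers.
exponent-double : ∀ u v k →
  + 2 ℤ.* + exponent (u ℕ.+ v) u v k ≡ + (u ℕ.+ v) ℤ.* (k ℤ.* k) ℤ.+ (+ u ℤ.- + v) ℤ.* k
exponent-double u v k = go k
  where
  open ≡.≡-Reasoning
  p = u ℕ.+ v
  expand : ∀ w n → + 2 ℤ.* + (p ℕ.* triangle n ℕ.+ w ℕ.* n) ≡ + p ℤ.* (+ n ℤ.* + n ℤ.- + n) ℤ.+ + 2 ℤ.* (+ w ℤ.* + n)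
  expand w n = begin
    + 2 ℤ.* (+ (p ℕ.* triangle n) ℤ.+ + (w ℕ.* n))
      ≡⟨ ≡.cong₂ (λ x y → + 2 ℤ.* (x ℤ.+ y)) (ℤ.pos-* p (triangle n)) (ℤ.pos-* w n) ⟩
    + 2 ℤ.* (+ p ℤ.* + triangle n ℤ.+ + w ℤ.* + n)
      ≡⟨ lemma (+ p) (+ triangle n) (+ w ℤ.* + n) ⟩
    + p ℤ.* (+ 2 ℤ.* + triangle n) ℤ.+ + 2 ℤ.* (+ w ℤ.* + n)
      ≡⟨ ≡.cong (λ z → + p ℤ.* z ℤ.+ + 2 ℤ.* (+ w ℤ.* + n)) (triangle-double n) ⟩
    + p ℤ.* (+ n ℤ.* + n ℤ.- + n) ℤ.+ + 2 ℤ.* (+ w ℤ.* + n) ∎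
    where
    lemma : ∀ p t z → + 2 ℤ.* (p ℤ.* t ℤ.+ z) ≡ p ℤ.* (+ 2 ℤ.* t) ℤ.+ + 2 ℤ.* z
    lemma = ℤRing.solve-∀
  go : ∀ k → + 2 ℤ.* + exponent p u v k ≡ + p ℤ.* (k ℤ.* k) ℤ.+ (+ u ℤ.- + v) ℤ.* k
  go (+ n)    = ≡.trans (expand u n) (lemma (+ u) (+ v) (+ n))
    where
    lemma : ∀ u v n → (u ℤ.+ v) ℤ.* (n ℤ.* n ℤ.- n) ℤ.+ + 2 ℤ.* (u ℤ.* n) ≡ (u ℤ.+ v) ℤ.* (n ℤ.* n) ℤ.+ (u ℤ.- v) ℤ.* n
    lemma = ℤRing.solve-∀
  go -[1+ n ] = ≡.trans (expand v (suc n)) (lemma (+ u) (+ v) (+ suc n))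
    where
    lemma : ∀ u v n → (u ℤ.+ v) ℤ.* (n ℤ.* n ℤ.- n) ℤ.+ + 2 ℤ.* (v ℤ.* n)
            ≡ (u ℤ.+ v) ℤ.* (ℤ.- n ℤ.* ℤ.- n) ℤ.+ (u ℤ.- v) ℤ.* ℤ.- n
    lemma = ℤRing.solve-∀

double-injective : ∀ {m n} → + 2 ℤ.* + m ≡ + 2 ℤ.* + n → m ≡ n
double-injective {m} {n} eq = ℤ.+-injective (ℤ.*-cancelˡ-≡ (+ 2) (+ m) (+ n) eq)

-- Here b + d, b are the arguments x + y, x - y of a pair of theta functions, so d = 2y and r = p - 2x.
module PairExponents (b d r : ℕ) where

  private
    a a′ p b′ : ℕ
    a = b ℕ.+ d
    a′ = b ℕ.+ r
    p = a ℕ.+ a′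
    b′ = a ℕ.+ r

    two : ∀ x y → + 2 ℤ.* + (x ℕ.+ y) ≡ + 2 ℤ.* + x ℤ.+ + 2 ℤ.* + y
    two x y = ℤ.*-distribˡ-+ (+ 2) (+ x) (+ y)

    at : ∀ u v {p} → u ℕ.+ v ≡ p → ∀ k →
      + 2 ℤ.* + exponent p u v k ≡ + p ℤ.* (k ℤ.* k) ℤ.+ (+ u ℤ.- + v) ℤ.* k
    at u v ≡.refl = exponent-double u v

    sum₁ : b′ ℕ.+ b ≡ p
    sum₁ = lemma b d r
      where
      lemma : ∀ b d r → b ℕ.+ d ℕ.+ r ℕ.+ b ≡ b ℕ.+ d ℕ.+ (b ℕ.+ r)
      lemma = ℕRing.solve-∀

    sum₂ : b ℕ.+ b ℕ.+ d ℕ.+ (p ℕ.+ r) ≡ p ℕ.+ p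
    sum₂ = lemma b d r
      where
      lemma : ∀ b d r → b ℕ.+ b ℕ.+ d ℕ.+ (b ℕ.+ d ℕ.+ (b ℕ.+ r) ℕ.+ r) ≡ b ℕ.+ d ℕ.+ (b ℕ.+ r) ℕ.+ (b ℕ.+ d ℕ.+ (b ℕ.+ r))
      lemma = ℕRing.solve-∀

    sum₃ : p ℕ.+ d ℕ.+ (b ℕ.+ b ℕ.+ r) ≡ p ℕ.+ p
    sum₃ = lemma b d r
      where
      lemma : ∀ b d r → b ℕ.+ d ℕ.+ (b ℕ.+ r) ℕ.+ d ℕ.+ (b ℕ.+ b ℕ.+ r) ≡ b ℕ.+ d ℕ.+ (b ℕ.+ r) ℕ.+ (b ℕ.+ d ℕ.+ (b ℕ.+ r))
      lemma = ℕRing.solve-∀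

    sum₄ : p ℕ.+ (b ℕ.+ b ℕ.+ d) ℕ.+ r ≡ p ℕ.+ p
    sum₄ = lemma b d r
      where
      lemma : ∀ b d r → b ℕ.+ d ℕ.+ (b ℕ.+ r) ℕ.+ (b ℕ.+ b ℕ.+ d) ℕ.+ r ≡ b ℕ.+ d ℕ.+ (b ℕ.+ r) ℕ.+ (b ℕ.+ d ℕ.+ (b ℕ.+ r))
      lemma = ℕRing.solve-∀

    sum₅ : d ℕ.+ (p ℕ.+ (b ℕ.+ b ℕ.+ r)) ≡ p ℕ.+ p
    sum₅ = lemma b d r
      where
      lemma : ∀ b d r → d ℕ.+ (b ℕ.+ d ℕ.+ (b ℕ.+ r) ℕ.+ (b ℕ.+ b ℕ.+ r)) ≡ b ℕ.+ d ℕ.+ (b ℕ.+ r) ℕ.+ (b ℕ.+ d ℕ.+ (b ℕ.+ r))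
      lemma = ℕRing.solve-∀

  -- As (s + e)² + (e - s)² = 2s² + 2e², the mixed terms cancel and the variables separate, with p
  -- doubled.
  exponent-even : ∀ s e →
    exponent p a a′ (s ℤ.+ e) ℕ.+ exponent p b′ b (e ℤ.- s)
    ≡ exponent (p ℕ.+ p) (b ℕ.+ b ℕ.+ d) (p ℕ.+ r) s ℕ.+ exponent (p ℕ.+ p) (p ℕ.+ d) (b ℕ.+ b ℕ.+ r) e
  exponent-even s e = double-injective (≡.trans (two E₁ E₂) (≡.trans
    (≡.cong₂ ℤ._+_ (at a a′ ≡.refl (s ℤ.+ e)) (at b′ b sum₁ (e ℤ.- s)))
    (≡.trans (lemma (+ b) (+ d) (+ r) s e) (≡.sym (≡.trans (two E₃ E₄)
    (≡.cong₂ ℤ._+_ (at (b ℕ.+ b ℕ.+ d) (p ℕ.+ r) sum₂ s) (at (p ℕ.+ d) (b ℕ.+ b ℕ.+ r) sum₃ e)))))))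
    where
    E₁ = exponent p a a′ (s ℤ.+ e)
    E₂ = exponent p b′ b (e ℤ.- s)
    E₃ = exponent (p ℕ.+ p) (b ℕ.+ b ℕ.+ d) (p ℕ.+ r) s
    E₄ = exponent (p ℕ.+ p) (p ℕ.+ d) (b ℕ.+ b ℕ.+ r) e
    lemma : ∀ b d r s e → let p = b ℤ.+ d ℤ.+ (b ℤ.+ r) in
      (p ℤ.* ((s ℤ.+ e) ℤ.* (s ℤ.+ e)) ℤ.+ ((b ℤ.+ d) ℤ.- (b ℤ.+ r)) ℤ.* (s ℤ.+ e))
      ℤ.+ (p ℤ.* ((e ℤ.- s) ℤ.* (e ℤ.- s)) ℤ.+ ((b ℤ.+ d ℤ.+ r) ℤ.- b) ℤ.* (e ℤ.- s))
      ≡ ((p ℤ.+ p) ℤ.* (s ℤ.* s) ℤ.+ ((b ℤ.+ b ℤ.+ d) ℤ.- (p ℤ.+ r)) ℤ.* s)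
        ℤ.+ ((p ℤ.+ p) ℤ.* (e ℤ.* e) ℤ.+ ((p ℤ.+ d) ℤ.- (b ℤ.+ b ℤ.+ r)) ℤ.* e)
    lemma = ℤRing.solve-∀

  -- The shift of the second index by one moves both exponents by p, half of the new period, and
  -- leaves the constant b.
  exponent-odd : ∀ s e →
    exponent p a a′ (s ℤ.+ e) ℕ.+ exponent p b′ b (e ℤ.- s ℤ.- + 1)
    ≡ b ℕ.+ (exponent (p ℕ.+ p) (p ℕ.+ (b ℕ.+ b ℕ.+ d)) r s ℕ.+ exponent (p ℕ.+ p) d (p ℕ.+ (b ℕ.+ b ℕ.+ r)) e)
  exponent-odd s e = double-injective (≡.trans (two E₁ E₂) (≡.trans
    (≡.cong₂ ℤ._+_ (at a a′ ≡.refl (s ℤ.+ e)) (at b′ b sum₁ (e ℤ.- s ℤ.- + 1)))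
    (≡.trans (lemma (+ b) (+ d) (+ r) s e) (≡.sym (≡.trans (two b (E₃ ℕ.+ E₄))
    (≡.cong (λ z → + 2 ℤ.* + b ℤ.+ z) (≡.trans (two E₃ E₄)
    (≡.cong₂ ℤ._+_ (at (p ℕ.+ (b ℕ.+ b ℕ.+ d)) r sum₄ s) (at d (p ℕ.+ (b ℕ.+ b ℕ.+ r)) sum₅ e)))))))))
    where
    E₁ = exponent p a a′ (s ℤ.+ e)
    E₂ = exponent p b′ b (e ℤ.- s ℤ.- + 1)
    E₃ = exponent (p ℕ.+ p) (p ℕ.+ (b ℕ.+ b ℕ.+ d)) r s
    E₄ = exponent (p ℕ.+ p) d (p ℕ.+ (b ℕ.+ b ℕ.+ r)) e
    lemma : ∀ b d r s e → let p = b ℤ.+ d ℤ.+ (b ℤ.+ r); f = e ℤ.- s ℤ.- + 1 in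
      (p ℤ.* ((s ℤ.+ e) ℤ.* (s ℤ.+ e)) ℤ.+ ((b ℤ.+ d) ℤ.- (b ℤ.+ r)) ℤ.* (s ℤ.+ e))
      ℤ.+ (p ℤ.* (f ℤ.* f) ℤ.+ ((b ℤ.+ d ℤ.+ r) ℤ.- b) ℤ.* f)
      ≡ + 2 ℤ.* b ℤ.+ (((p ℤ.+ p) ℤ.* (s ℤ.* s) ℤ.+ ((p ℤ.+ (b ℤ.+ b ℤ.+ d)) ℤ.- r) ℤ.* s)
        ℤ.+ ((p ℤ.+ p) ℤ.* (e ℤ.* e) ℤ.+ (d ℤ.- (p ℤ.+ (b ℤ.+ b ℤ.+ r))) ℤ.* e))
    lemma = ℤRing.solve-∀

module SignedTheta {c ℓ} (R : CommutativeRing c ℓ) (q : CommutativeRing.Carrier R) (N : ℕ) where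
  open CommutativeRing R
  open import Algebra.Properties.CommutativeSemiring.Exp commutativeSemiring
  open import Algebra.Properties.Ring ring
  open import Relation.Binary.Reasoning.Setoid setoid
  open RingSums R
  open DifferenceSolver R
  open NilpotentParameter R q N

  sgn : Sign → Carrier
  sgn Sign.+ = 1#
  sgn Sign.- = - 1#

  sgn-opposite : ∀ s → sgn (opposite s) ≈ - sgn s
  sgn-opposite Sign.+ = refl
  sgn-opposite Sign.- = sym (-‿involutive 1#)

  sgn-· : ∀ s t → sgn (s · t) ≈ sgn s * sgn t
  sgn-· Sign.+ t = sym (*-identityˡ _)
  sgn-· Sign.- t = trans (sgn-opposite t) (sym (-1*x≈-x (sgn t)))

  sgn² : ∀ s → sgn s * sgn s ≈ 1#
  sgn² s = trans (sym (sgn-· s s)) (reflexive (≡.cong sgn (Sign.s*s≡+ s)))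

  signPower : Sign → ℤ → Carrier
  signPower s k = sgn s ^ ∣ k ∣

  signPower-⊖ : ∀ s m n → signPower s (m ⊖ n) ≈ sgn s ^ m * sgn s ^ n
  signPower-⊖ s m       zero    = sym (*-identityʳ _)
  signPower-⊖ s zero    (suc n) = sym (*-identityˡ _)
  signPower-⊖ s (suc m) (suc n) = begin
    signPower s (suc m ⊖ suc n)  ≡⟨ ≡.cong (signPower s) (ℤ.[1+m]⊖[1+n]≡m⊖n m n) ⟩
    signPower s (m ⊖ n)          ≈⟨ signPower-⊖ s m n ⟩
    sgn s ^ m * sgn s ^ n        ≈⟨ trans (*-congʳ (sgn² s)) (*-identityˡ _) ⟨
    (sgn s * sgn s) * (sgn s ^ m * sgn s ^ n)
      ≈⟨ solve 3 (λ s x y → (s :* s) :* (x :* y) := (s :* x) :* (s :* y)) refl (sgn s) (sgn s ^ m) (sgn s ^ n) ⟩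
    sgn s ^ suc m * sgn s ^ suc n ∎

  signPower-+ : ∀ s j k → signPower s (j ℤ.+ k) ≈ signPower s j * signPower s k
  signPower-+ s (+ m)    (+ n)    = ^-homo-* (sgn s) m n
  signPower-+ s (+ m)    -[1+ n ] = signPower-⊖ s m (suc n)
  signPower-+ s -[1+ m ] (+ n)    = trans (signPower-⊖ s n (suc m)) (*-comm _ _)
  signPower-+ s -[1+ m ] -[1+ n ] = trans (reflexive (≡.cong (λ k → sgn s ^ suc k) (≡.sym (ℕ.+-suc m n)))) (^-homo-* (sgn s) (suc m) (suc n))

  signPower-- : ∀ s j k → signPower s (j ℤ.- k) ≈ signPower s j * signPower s k
  signPower-- s j k = trans (signPower-+ s j (ℤ.- k)) (*-congˡ (reflexive (≡.cong (sgn s ^_) (ℤ.∣-i∣≡∣i∣ k))))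

  signPower-· : ∀ s t k → signPower (s · t) k ≈ signPower s k * signPower t k
  signPower-· s t k = trans (^-congˡ ∣ k ∣ (sgn-· s t)) (^-distrib-* (sgn s) (sgn t) ∣ k ∣)

  term : Sign → (p u v : ℕ) → ℤ → Carrier
  term s p u v k = signPower s k * q ^ exponent p u v k

  module SignedNilpotent (q^N≈0 : q ^ N ≈ 0#) where
    open Nilpotent q^N≈0

    -- The exponent is at least `triangle` of |k|, hence at least |k| - 1. This reaches N as soon as
    -- |k| > N, which is why supports are described by a strict inequality.
    term-supported : ∀ s p .{{_ : NonZero p}} u v → SupportedIn N (term s p u v)
    term-supported s p u v k N<k = trans (*-congˡ (q^≈0 _ (bound k N<k))) (zeroʳ _)
      where
      bound : ∀ k → N < ∣ k ∣ → N ≤ exponent p u v k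
      large : ∀ n w → N < suc n → N ≤ p ℕ.* triangle (suc n) ℕ.+ w ℕ.* suc n
      large n w (s≤s N≤n) = ℕ.≤-trans N≤n (ℕ.≤-trans (n≤triangle[1+n] n)
        (ℕ.≤-trans (ℕ.m≤n*m _ p) (ℕ.m≤m+n _ (w ℕ.* suc n))))
      bound (+ suc n) = large n u
      bound -[1+ n ]  = large n v

    module Period (m : ℕ) .{{_ : NonZero m}} where
      open Base m

      -- The number 2N of factors is the one in `tripleProduct`; splitting them by the parity of i
      -- later gives the N factors of each `φ`.
      halfTheta : Sign → ℕ → Carrier
      halfTheta s a = ∏ (N ℕ.+ N) (λ i → 1# + sgn s * q ^ a * Q ^ i)

      θ′ : Sign → ℕ → ℕ → Carrier
      θ′ s a a′ = halfTheta s a * halfTheta s a′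

      -- For u + v = m these are the series of s^k q^(mk² + uk) and of s^k q^(mk² - (m-u)k) over the
      -- integers k: a theta series of period 2m and its translate by half a period.
      α β : Sign → ℕ → ℕ → Carrier
      α s u v = total N (term s (m ℕ.+ m) (m ℕ.+ u) v)
      β s u v = total N (term s (m ℕ.+ m) u (m ℕ.+ v))

      θ′-series : ∀ s a a′ → a ℕ.+ a′ ≡ m → θ′ s a a′ ≈ qfac⁻¹ N * total N (term s m a a′)
      θ′-series s a a′ a+a′≡m = trans
        (tripleProduct (sgn s * q ^ a) (sgn s * q ^ a′) product supported)
        (*-congˡ (∑-cong (suc (N ℕ.+ N)) λ i → termwise (ℤ.- + N ℤ.+ + i)))
        where
        product : (sgn s * q ^ a) * (sgn s * q ^ a′) ≈ Q
        product = begin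
          (sgn s * q ^ a) * (sgn s * q ^ a′)
            ≈⟨ solve 3 (λ s x y → (s :* x) :* (s :* y) := (s :* s) :* (x :* y)) refl (sgn s) _ _ ⟩
          (sgn s * sgn s) * (q ^ a * q ^ a′)  ≈⟨ *-cong (sgn² s) (sym (^-homo-* q a a′)) ⟩
          1# * q ^ (a ℕ.+ a′)                 ≈⟨ *-identityˡ _ ⟩
          q ^ (a ℕ.+ a′)                      ≡⟨ ≡.cong (q ^_) a+a′≡m ⟩
          Q                                   ∎
        monomial : ∀ w n → (sgn s * q ^ w) ^ n * Q ^ triangle n ≈ sgn s ^ n * q ^ (m ℕ.* triangle n ℕ.+ w ℕ.* n)
        monomial w n = begin
          (sgn s * q ^ w) ^ n * Q ^ triangle n
            ≈⟨ *-cong (^-distrib-* (sgn s) (q ^ w) n) (^-assocʳ q m (triangle n)) ⟩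
          (sgn s ^ n * (q ^ w) ^ n) * q ^ (m ℕ.* triangle n)
            ≈⟨ *-assoc _ _ _ ⟩
          sgn s ^ n * ((q ^ w) ^ n * q ^ (m ℕ.* triangle n))
            ≈⟨ *-congˡ (*-congʳ (^-assocʳ q w n)) ⟩
          sgn s ^ n * (q ^ (w ℕ.* n) * q ^ (m ℕ.* triangle n))
            ≈⟨ *-congˡ (trans (*-comm _ _) (sym (^-homo-* q (m ℕ.* triangle n) (w ℕ.* n)))) ⟩
          sgn s ^ n * q ^ (m ℕ.* triangle n ℕ.+ w ℕ.* n) ∎
        termwise : ∀ k → thetaTerm (sgn s * q ^ a) (sgn s * q ^ a′) k ≈ term s m a a′ k
        termwise (+ n)    = monomial a n
        termwise -[1+ n ] = monomial a′ (suc n)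
        supported : SupportedIn N (thetaTerm (sgn s * q ^ a) (sgn s * q ^ a′))
        supported k N<k = trans (termwise k) (term-supported s m a a′ k N<k)

      series-product : ∀ s t b d r → (b ℕ.+ d) ℕ.+ (b ℕ.+ r) ≡ m →
        total N (term s m (b ℕ.+ d) (b ℕ.+ r)) * total N (term t m (b ℕ.+ d ℕ.+ r) b)
        ≈ β (s · t) (b ℕ.+ b ℕ.+ d) r * α (s · t) d (b ℕ.+ b ℕ.+ r)
          + sgn t * q ^ b * (α (s · t) (b ℕ.+ b ℕ.+ d) r * β (s · t) d (b ℕ.+ b ℕ.+ r))
      series-product s t b d r ≡.refl = total-product N
        (term s m a a′) (term t m b′ b)
        (term κ (m ℕ.+ m) X (m ℕ.+ r)) (term κ (m ℕ.+ m) (m ℕ.+ d) Y′)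
        (term κ (m ℕ.+ m) (m ℕ.+ X) r) (term κ (m ℕ.+ m) d (m ℕ.+ Y′))
        (sgn t * q ^ b)
        (term-supported s m a a′) (term-supported t m b′ b)
        (term-supported κ (m ℕ.+ m) X (m ℕ.+ r)) (term-supported κ (m ℕ.+ m) (m ℕ.+ X) r)
        even odd
        where
        a = b ℕ.+ d
        a′ = b ℕ.+ r
        b′ = b ℕ.+ d ℕ.+ r
        X = b ℕ.+ b ℕ.+ d
        Y′ = b ℕ.+ b ℕ.+ r
        κ = s · t
        instance
          2m≢0 : NonZero (m ℕ.+ m)
          2m≢0 = ℕ.>-nonZero (ℕ.≤-trans (ℕ.>-nonZero⁻¹ m) (ℕ.m≤m+n m m))
        shape : ∀ x y z w → (x * y) * (z * w) ≈ (x * z) * (y * w)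
        shape = solve 4 (λ x y z w → (x :* y) :* (z :* w) := (x :* z) :* (y :* w)) refl
        even : ∀ i e → term s m a a′ (i ℤ.+ e) * term t m b′ b (e ℤ.- i)
               ≈ term κ (m ℕ.+ m) X (m ℕ.+ r) i * term κ (m ℕ.+ m) (m ℕ.+ d) Y′ e
        even i e = begin
          (signPower s (i ℤ.+ e) * q ^ E₁) * (signPower t (e ℤ.- i) * q ^ E₂)
            ≈⟨ shape _ _ _ _ ⟩
          (signPower s (i ℤ.+ e) * signPower t (e ℤ.- i)) * (q ^ E₁ * q ^ E₂)
            ≈⟨ *-cong (*-cong (signPower-+ s i e) (signPower-- t e i)) (sym (^-homo-* q E₁ E₂)) ⟩
          ((signPower s i * signPower s e) * (signPower t e * signPower t i)) * q ^ (E₁ ℕ.+ E₂)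
            ≈⟨ *-cong (solve 4 (λ si se te ti → (si :* se) :* (te :* ti) := (si :* ti) :* (se :* te)) refl _ _ _ _)
                      (reflexive (≡.cong (q ^_) (PairExponents.exponent-even b d r i e))) ⟩
          ((signPower s i * signPower t i) * (signPower s e * signPower t e)) * q ^ (E₃ ℕ.+ E₄)
            ≈⟨ *-cong (*-cong (sym (signPower-· s t i)) (sym (signPower-· s t e))) (^-homo-* q E₃ E₄) ⟩
          (signPower κ i * signPower κ e) * (q ^ E₃ * q ^ E₄)
            ≈⟨ shape _ _ _ _ ⟩
          (signPower κ i * q ^ E₃) * (signPower κ e * q ^ E₄) ∎
          where
          E₁ = exponent m a a′ (i ℤ.+ e)
          E₂ = exponent m b′ b (e ℤ.- i)
          E₃ = exponent (m ℕ.+ m) X (m ℕ.+ r) i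
          E₄ = exponent (m ℕ.+ m) (m ℕ.+ d) Y′ e
        odd : ∀ i e → term s m a a′ (i ℤ.+ e) * term t m b′ b (e ℤ.- i ℤ.- + 1)
              ≈ sgn t * q ^ b * (term κ (m ℕ.+ m) (m ℕ.+ X) r i * term κ (m ℕ.+ m) d (m ℕ.+ Y′) e)
        odd i e = begin
          (signPower s (i ℤ.+ e) * q ^ E₁) * (signPower t (e ℤ.- i ℤ.- + 1) * q ^ E₂)
            ≈⟨ shape _ _ _ _ ⟩
          (signPower s (i ℤ.+ e) * signPower t (e ℤ.- i ℤ.- + 1)) * (q ^ E₁ * q ^ E₂)
            ≈⟨ *-cong (*-cong (signPower-+ s i e)
                 (trans (signPower-- t (e ℤ.- i) (+ 1)) (*-cong (signPower-- t e i) (*-identityʳ _))))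
                 (sym (^-homo-* q E₁ E₂)) ⟩
          ((signPower s i * signPower s e) * ((signPower t e * signPower t i) * sgn t)) * q ^ (E₁ ℕ.+ E₂)
            ≈⟨ *-cong (solve 5 (λ si se te ti t → (si :* se) :* ((te :* ti) :* t) := t :* ((si :* ti) :* (se :* te))) refl _ _ _ _ _)
                      (reflexive (≡.cong (q ^_) (PairExponents.exponent-odd b d r i e))) ⟩
          (sgn t * ((signPower s i * signPower t i) * (signPower s e * signPower t e))) * q ^ (b ℕ.+ (E₃ ℕ.+ E₄))
            ≈⟨ *-cong (*-congˡ (*-cong (sym (signPower-· s t i)) (sym (signPower-· s t e))))
                      (trans (^-homo-* q b (E₃ ℕ.+ E₄)) (*-congˡ (^-homo-* q E₃ E₄))) ⟩
          (sgn t * (signPower κ i * signPower κ e)) * (q ^ b * (q ^ E₃ * q ^ E₄))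
            ≈⟨ solve 6 (λ t x y b z w → (t :* (x :* y)) :* (b :* (z :* w)) := (t :* b) :* ((x :* z) :* (y :* w))) refl _ _ _ _ _ _ ⟩
          sgn t * q ^ b * ((signPower κ i * q ^ E₃) * (signPower κ e * q ^ E₄)) ∎
          where
          E₁ = exponent m a a′ (i ℤ.+ e)
          E₂ = exponent m b′ b (e ℤ.- i ℤ.- + 1)
          E₃ = exponent (m ℕ.+ m) (m ℕ.+ X) r i
          E₄ = exponent (m ℕ.+ m) d (m ℕ.+ Y′) e

      θ : Sign → ℕ → Carrier
      θ s a = θ′ s a (m ∸ a)

      private
        α₁ β₁ : Sign → ℕ → Carrier
        α₁ s x = α s x (m ∸ x)
        β₁ s x = β s x (m ∸ x)

      θ-reflect : ∀ s {a} → a ≤ m → θ s (m ∸ a) ≈ θ s a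
      θ-reflect s {a} a≤m = trans (*-congˡ (reflexive (≡.cong (halfTheta s) (ℕ.m∸[m∸n]≡n a≤m)))) (*-comm _ _)

      -- The signs of the two factors multiply to κ. All products with the same κ therefore involve
      -- the same two rows, in the columns 2b + d and d, twice the Weierstrass arguments x and y.
      θ-product : ∀ κ t b d → b ℕ.+ b ℕ.+ d ≤ m →
        θ (κ · t) (b ℕ.+ d) * θ t b
        ≈ qfac⁻¹ N * qfac⁻¹ N *
          (β₁ κ (b ℕ.+ b ℕ.+ d) * α₁ κ d + sgn t * q ^ b * (α₁ κ (b ℕ.+ b ℕ.+ d) * β₁ κ d))
      θ-product κ t b d 2b+d≤m = begin
        θ′ (κ · t) (b ℕ.+ d) (m ∸ (b ℕ.+ d)) * θ′ t b (m ∸ b)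
          ≡⟨ ≡.cong₂ (λ x y → θ′ (κ · t) (b ℕ.+ d) x * θ′ t b y)
               (remainder (b ℕ.+ d) (b ℕ.+ r) total-arguments)
               (remainder b (b ℕ.+ d ℕ.+ r) (≡.trans (ℕ.+-comm b _) reflected)) ⟩
        θ′ (κ · t) (b ℕ.+ d) (b ℕ.+ r) * θ′ t b (b ℕ.+ d ℕ.+ r)
          -- The second series is read backwards, with its argument and complement exchanged. Then
          -- the linear term in s depends on X alone and the linear term in e on d alone.
          ≈⟨ *-cong (θ′-series (κ · t) (b ℕ.+ d) (b ℕ.+ r) total-arguments)
                    (trans (*-comm _ _) (θ′-series t (b ℕ.+ d ℕ.+ r) b reflected)) ⟩
        (qfac⁻¹ N * Σ₁) * (qfac⁻¹ N * Σ₂)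
          ≈⟨ solve 3 (λ c x y → (c :* x) :* (c :* y) := c :* c :* (x :* y)) refl (qfac⁻¹ N) Σ₁ Σ₂ ⟩
        qfac⁻¹ N * qfac⁻¹ N * (Σ₁ * Σ₂)
          ≈⟨ *-congˡ (series-product (κ · t) t b d r total-arguments) ⟩
        qfac⁻¹ N * qfac⁻¹ N * (β ((κ · t) · t) X r * α ((κ · t) · t) d (b ℕ.+ b ℕ.+ r)
          + sgn t * q ^ b * (α ((κ · t) · t) X r * β ((κ · t) · t) d (b ℕ.+ b ℕ.+ r)))
          ≡⟨ ≡.cong₂ (λ σ y → qfac⁻¹ N * qfac⁻¹ N * (β σ X r * α σ d y + sgn t * q ^ b * (α σ X r * β σ d y)))
               sign (≡.sym (remainder d (b ℕ.+ b ℕ.+ r) (≡.trans (shuffle₂ b d r) X+r≡m))) ⟩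
        qfac⁻¹ N * qfac⁻¹ N * (β₁ κ X * α₁ κ d + sgn t * q ^ b * (α₁ κ X * β₁ κ d)) ∎
        where
        X = b ℕ.+ b ℕ.+ d
        r = m ∸ X
        Σ₁ = total N (term (κ · t) m (b ℕ.+ d) (b ℕ.+ r))
        Σ₂ = total N (term t m (b ℕ.+ d ℕ.+ r) b)
        remainder : ∀ x y → x ℕ.+ y ≡ m → m ∸ x ≡ y
        remainder x y x+y≡m = ≡.trans (≡.cong (_∸ x) (≡.sym x+y≡m)) (ℕ.m+n∸m≡n x y)
        X+r≡m : X ℕ.+ r ≡ m
        X+r≡m = ℕ.m+[n∸m]≡n 2b+d≤m
        shuffle₁ : ∀ b d r → b ℕ.+ d ℕ.+ (b ℕ.+ r) ≡ b ℕ.+ b ℕ.+ d ℕ.+ r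
        shuffle₁ = ℕRing.solve-∀
        shuffle₂ : ∀ b d r → d ℕ.+ (b ℕ.+ b ℕ.+ r) ≡ b ℕ.+ b ℕ.+ d ℕ.+ r
        shuffle₂ = ℕRing.solve-∀
        shuffle₃ : ∀ b d r → b ℕ.+ d ℕ.+ r ℕ.+ b ≡ b ℕ.+ b ℕ.+ d ℕ.+ r
        shuffle₃ = ℕRing.solve-∀
        total-arguments : b ℕ.+ d ℕ.+ (b ℕ.+ r) ≡ m
        total-arguments = ≡.trans (shuffle₁ b d r) X+r≡m
        reflected : b ℕ.+ d ℕ.+ r ℕ.+ b ≡ m
        reflected = ≡.trans (shuffle₃ b d r) X+r≡m
        sign : (κ · t) · t ≡ κ
        sign = ≡.trans (Sign.*-assoc κ t t) (≡.trans (≡.cong (κ ·_) (Sign.s*s≡+ t)) (Sign.*-identityʳ κ))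

      -- Weierstrass' three-term relation for x, y, z, w with 2w = W, z - w = k, y - z = j, x - y = i.
      -- Each product θ(x + y)θ(x - y) is a 2 × 2 minor of the matrix with rows α, β.
      weierstrass : ∀ κ s₁ s₂ s₃ W i j k →
        i ℕ.+ i ℕ.+ (j ℕ.+ j ℕ.+ (k ℕ.+ k ℕ.+ W)) ≤ m →
        sgn s₂ * q ^ j * ((θ (κ · s₁) (i ℕ.+ (j ℕ.+ j ℕ.+ (k ℕ.+ k ℕ.+ W))) * θ s₁ i)
                          * (θ (κ · s₃) (k ℕ.+ W) * θ s₃ k))
        + (θ (κ · opposite (s₁ · s₂)) (i ℕ.+ j ℕ.+ (k ℕ.+ k ℕ.+ W)) * θ (opposite (s₁ · s₂)) (i ℕ.+ j))
          * (θ (κ · opposite (s₂ · s₃)) (j ℕ.+ k ℕ.+ W) * θ (opposite (s₂ · s₃)) (j ℕ.+ k))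
        ≈ (θ (κ · (s₁ · s₂ · s₃)) (i ℕ.+ j ℕ.+ k ℕ.+ W) * θ (s₁ · s₂ · s₃) (i ℕ.+ j ℕ.+ k))
          * (θ (κ · s₂) (j ℕ.+ (k ℕ.+ k ℕ.+ W)) * θ s₂ j)
      weierstrass κ s₁ s₂ s₃ W i j k X≤m = begin
        r * ((θ (κ · s₁) (i ℕ.+ Y) * θ s₁ i) * (θ (κ · s₃) (k ℕ.+ W) * θ s₃ k))
        + (θ (κ · s₁₂) (i ℕ.+ j ℕ.+ Z) * θ s₁₂ (i ℕ.+ j)) * (θ (κ · s₂₃) (j ℕ.+ k ℕ.+ W) * θ s₂₃ (j ℕ.+ k))
          ≈⟨ +-cong (*-congˡ (*-cong (θ-product κ s₁ i Y X≤m) (θ-product κ s₃ k W Z≤m)))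
                    (*-cong (pair s₁₂ (i ℕ.+ j) Z X (shuffle₁ i j Z) X≤m (- (p * r)) (coefficient s₁ s₂ i j))
                            (pair s₂₃ (j ℕ.+ k) W Y (shuffle₁ j k W) Y≤m (- (r * s)) (coefficient s₂ s₃ j k))) ⟩
        r * ((C * (b X * a Y + p * (a X * b Y))) * (C * (b Z * a W + s * (a Z * b W))))
        + (C * (b X * a Z + - (p * r) * (a X * b Z))) * (C * (b Y * a W + - (r * s) * (a Y * b W)))
          ≈⟨ solve 6 (λ c r x y z w → r :* ((c :* x) :* (c :* y)) :+ (c :* z) :* (c :* w)
                := (c :* c) :* (r :* (x :* y) :+ z :* w)) refl C r _ _ _ _ ⟩
        (C * C) * (r * ((b X * a Y + p * (a X * b Y)) * (b Z * a W + s * (a Z * b W)))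
        + (b X * a Z + - (p * r) * (a X * b Z)) * (b Y * a W + - (r * s) * (a Y * b W)))
          ≈⟨ *-congˡ (plücker p r s (b X) (b Y) (b Z) (b W) (a X) (a Y) (a Z) (a W)) ⟩
        (C * C) * ((b X * a W + p * r * s * (a X * b W)) * (b Y * a Z + r * (a Y * b Z)))
          ≈⟨ solve 3 (λ c x y → (c :* c) :* (x :* y) := (c :* x) :* (c :* y)) refl C _ _ ⟩
        (C * (b X * a W + p * r * s * (a X * b W))) * (C * (b Y * a Z + r * (a Y * b Z)))
          ≈⟨ *-cong (pair s₁₂₃ (i ℕ.+ j ℕ.+ k) W X (shuffle₂ i j k W) X≤m (p * r * s) triple) (θ-product κ s₂ j Z Y≤m) ⟨
        (θ (κ · s₁₂₃) (i ℕ.+ j ℕ.+ k ℕ.+ W) * θ s₁₂₃ (i ℕ.+ j ℕ.+ k)) * (θ (κ · s₂) (j ℕ.+ Z) * θ s₂ j) ∎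
        where
        -- Up to scaling of columns a minor is determined by minus the coefficient of its second
        -- term, and this quantity is multiplicative along X, Y, Z, W. From -p, -r, -s one gets pr,
        -- rs and -prs for the composite pairs, hence an opposite sign for two steps but not for
        -- three.
        s₁₂ = opposite (s₁ · s₂)
        s₂₃ = opposite (s₂ · s₃)
        s₁₂₃ = s₁ · s₂ · s₃
        Z = k ℕ.+ k ℕ.+ W
        Y = j ℕ.+ j ℕ.+ Z
        X = i ℕ.+ i ℕ.+ Y
        C = qfac⁻¹ N * qfac⁻¹ N
        p = sgn s₁ * q ^ i
        r = sgn s₂ * q ^ j
        s = sgn s₃ * q ^ k
        a b : ℕ → Carrier
        a = α₁ κ
        b = β₁ κ
        Y≤m : Y ≤ m
        Y≤m = ℕ.≤-trans (ℕ.m≤n+m Y (i ℕ.+ i)) X≤m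
        Z≤m : Z ≤ m
        Z≤m = ℕ.≤-trans (ℕ.m≤n+m Z (j ℕ.+ j)) Y≤m
        plücker : ∀ p r s bx by bz bw ax ay az aw →
          r * ((bx * ay + p * (ax * by)) * (bz * aw + s * (az * bw)))
            + (bx * az + - (p * r) * (ax * bz)) * (by * aw + - (r * s) * (ay * bw))
          ≈ (bx * aw + p * r * s * (ax * bw)) * (by * az + r * (ay * bz))
        plücker = solve 11 (λ p r s bx by bz bw ax ay az aw →
            r :* ((bx :* ay :+ p :* (ax :* by)) :* (bz :* aw :+ s :* (az :* bw)))
              :+ (bx :* az :+ :- (p :* r) :* (ax :* bz)) :* (by :* aw :+ :- (r :* s) :* (ay :* bw))
            := (bx :* aw :+ p :* r :* s :* (ax :* bw)) :* (by :* az :+ r :* (ay :* bz))) refl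
        pair : ∀ t e d X → e ℕ.+ e ℕ.+ d ≡ X → X ≤ m → ∀ u → sgn t * q ^ e ≈ u →
          θ (κ · t) (e ℕ.+ d) * θ t e ≈ C * (b X * a d + u * (a X * b d))
        pair t e d _ ≡.refl X≤m u eq = trans (θ-product κ t e d X≤m) (*-congˡ (+-congˡ (*-congʳ eq)))
        multiply : ∀ s t i j → sgn (s · t) * q ^ (i ℕ.+ j) ≈ (sgn s * q ^ i) * (sgn t * q ^ j)
        multiply s t i j = trans (*-cong (sgn-· s t) (^-homo-* q i j))
          (solve 4 (λ s t x y → (s :* t) :* (x :* y) := (s :* x) :* (t :* y)) refl (sgn s) (sgn t) (q ^ i) (q ^ j))
        coefficient : ∀ s t i j → sgn (opposite (s · t)) * q ^ (i ℕ.+ j) ≈ - ((sgn s * q ^ i) * (sgn t * q ^ j))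
        coefficient s t i j = trans (*-congʳ (sgn-opposite (s · t)))
          (trans (sym (-‿distribˡ-* _ _)) (-‿cong (multiply s t i j)))
        triple : sgn s₁₂₃ * q ^ (i ℕ.+ j ℕ.+ k) ≈ p * r * s
        triple = trans (multiply (s₁ · s₂) s₃ (i ℕ.+ j) k) (*-congʳ (multiply s₁ s₂ i j))
        shuffle₁ : ∀ i j d → i ℕ.+ j ℕ.+ (i ℕ.+ j) ℕ.+ d ≡ i ℕ.+ i ℕ.+ (j ℕ.+ j ℕ.+ d)
        shuffle₁ = ℕRing.solve-∀
        shuffle₂ : ∀ i j k d → i ℕ.+ j ℕ.+ k ℕ.+ (i ℕ.+ j ℕ.+ k) ℕ.+ d ≡ i ℕ.+ i ℕ.+ (j ℕ.+ j ℕ.+ (k ℕ.+ k ℕ.+ d))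
        shuffle₂ = ℕRing.solve-∀

-- Monomials in theta functions

insert : {A : Set} → (A → ℕ) → A → List A → List A
insert key x []       = x ∷ []
insert key x (y ∷ ys) = if key x ≤ᵇ key y then x ∷ y ∷ ys else y ∷ insert key x ys

sort : {A : Set} → (A → ℕ) → List A → List A
sort key []       = []
sort key (x ∷ xs) = insert key x (sort key xs)

module ListProducts {c ℓ} (R : CommutativeRing c ℓ) where
  open CommutativeRing R
  open import Relation.Binary.Reasoning.Setoid setoid
  open import Algebra.Properties.CommutativeSemigroup *-commutativeSemigroup using (x∙yz≈y∙xz)
  open RingSums R

  module _ {A : Set} (f : A → Carrier) where

    productOver : List A → Carrier
    productOver []       = 1#
    productOver (x ∷ xs) = f x * productOver xs

    productOver-++ : ∀ xs ys → productOver (xs ++ ys) ≈ productOver xs * productOver ys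
    productOver-++ []       ys = sym (*-identityˡ _)
    productOver-++ (x ∷ xs) ys = trans (*-congˡ (productOver-++ xs ys)) (sym (*-assoc _ _ _))

    productOver-insert : ∀ key x xs → productOver (insert key x xs) ≈ f x * productOver xs
    productOver-insert key x []       = refl
    productOver-insert key x (y ∷ ys) with key x ≤ᵇ key y
    ... | true  = refl
    ... | false = trans (*-congˡ (productOver-insert key x ys)) (x∙yz≈y∙xz _ _ _)

    productOver-sort : ∀ key xs → productOver (sort key xs) ≈ productOver xs
    productOver-sort key []       = refl
    productOver-sort key (x ∷ xs) = trans (productOver-insert key x (sort key xs)) (*-congˡ (productOver-sort key xs))

    -- Reduces the equality of two monomials up to order to a computation: for concrete lists the
    -- hypothesis holds by `≡.refl`.
    productOver-sorted : ∀ key xs ys → sort key xs ≡ sort key ys → productOver xs ≈ productOver ys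
    productOver-sorted key xs ys eq = trans (sym (productOver-sort key xs))
      (trans (reflexive (≡.cong productOver eq)) (productOver-sort key ys))

  productOver-map : ∀ {A : Set} {f : A → Carrier} (h : A → A) → (∀ x → f (h x) ≈ f x) →
    ∀ xs → productOver f (map h xs) ≈ productOver f xs
  productOver-map h eq []       = refl
  productOver-map h eq (x ∷ xs) = *-cong (eq x) (productOver-map h eq xs)

Coefficient : Set
Coefficient = Sign × ℕ

_⊗_ : Coefficient → Coefficient → Coefficient
(s , k) ⊗ (t , l) = s · t , k ℕ.+ l

negate : Coefficient → Coefficient
negate (s , k) = opposite s , k

-- Indices of θ modulo 21 up to sign, and residues modulo 42 of the class ± u r.
foldIndex : ℕ → ℕ
foldIndex a = if a ≤ᵇ 10 then a else (if a ≤ᵇ 21 then 21 ∸ a else a)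

foldSigned : Sign × ℕ → Sign × ℕ
foldSigned (s , a) = s , foldIndex a

-- The offset 100 exceeds every index that occurs and so makes the key injective: equal multisets
-- are sorted to identical lists.
signedKey : Sign × ℕ → ℕ
signedKey (Sign.- , a) = a
signedKey (Sign.+ , a) = 100 ℕ.+ a

normalise : List (Sign × ℕ) → List (Sign × ℕ)
normalise xs = sort signedKey (map foldSigned xs)

-- For a unit u and r from 1 to 20 the residues ur and -ur are distinct and nonzero modulo 42, so
-- `Φ (class u r)` is [ur].
class : ℕ → ℕ → List ℕ
class u r = (u ℕ.* r) % 42 ∷ 42 ∸ (u ℕ.* r) % 42 ∷ []

classes : ℕ → List ℕ → List ℕ
classes u = concatMap (class u)

-- setX and setY are the sets S and T of part (i), up to order.
common setX setY : List ℕ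
common = 1 ∷ 3 ∷ 7 ∷ 11 ∷ 17 ∷ 18 ∷ 19 ∷ 20 ∷ []
setX = 4 ∷ 5 ∷ 9 ∷ 16 ∷ common
setY = 2 ∷ 8 ∷ 13 ∷ 15 ∷ common

module Monomials {c ℓ} (R : CommutativeRing c ℓ) (q : CommutativeRing.Carrier R) (N : ℕ) where
  open CommutativeRing R
  open import Algebra.Properties.CommutativeSemiring.Exp commutativeSemiring
  open import Algebra.Properties.Ring ring
  open import Relation.Binary.Reasoning.Setoid setoid
  open RingSums R
  open ListProducts R
  open DifferenceSolver R
  open NilpotentParameter R q N
  open SignedTheta R q N

  coef : Coefficient → Carrier
  coef (s , k) = sgn s * q ^ k

  coef-⊗ : ∀ a b → coef (a ⊗ b) ≈ coef a * coef b
  coef-⊗ (s , k) (t , l) = trans (*-cong (sgn-· s t) (^-homo-* q k l))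
    (solve 4 (λ s t x y → (s :* t) :* (x :* y) := (s :* x) :* (t :* y)) refl (sgn s) (sgn t) (q ^ k) (q ^ l))

  coef-negate : ∀ a → coef (negate a) ≈ - coef a
  coef-negate (s , k) = trans (*-congʳ (sgn-opposite s)) (sym (-‿distribˡ-* _ _))

  φ : ℕ → Carrier
  φ r = ∏ N (λ i → 1# - q ^ (r ℕ.+ 42 ℕ.* i))

  Φ : List ℕ → Carrier
  Φ = productOver φ

  -- The three coefficient conditions say that the monomials s, t, v cancel from the combination.
  cancel-common : ∀ a₀ a₁ a₂ b₀ b₁ b₂ c₀ c₁ c₂ α β γ →
    α ⊗ a₁ ≡ negate (β ⊗ b₁) → α ⊗ a₂ ≡ negate (γ ⊗ c₂) → β ⊗ b₀ ≡ negate (γ ⊗ c₁) →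
    ∀ {u₁ u₂ u₃ s t v} →
    coef a₀ * u₁ + coef a₁ * s + coef a₂ * t ≈ 0# →
    coef b₀ * v + coef b₁ * s + coef b₂ * u₂ ≈ 0# →
    coef c₀ * u₃ + coef c₁ * v + coef c₂ * t ≈ 0# →
    coef (α ⊗ a₀) * u₁ + coef (β ⊗ b₂) * u₂ + coef (γ ⊗ c₀) * u₃ ≈ 0#
  cancel-common a₀ a₁ a₂ b₀ b₁ b₂ c₀ c₁ c₂ α β γ s-cancels t-cancels v-cancels {u₁} {u₂} {u₃} {s} {t} {v} RA RB RC = begin
    coef (α ⊗ a₀) * u₁ + coef (β ⊗ b₂) * u₂ + coef (γ ⊗ c₀) * u₃
      ≈⟨ +-cong (+-cong (*-congʳ (coef-⊗ α a₀)) (*-congʳ (coef-⊗ β b₂))) (*-congʳ (coef-⊗ γ c₀)) ⟩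
    coef α * coef a₀ * u₁ + coef β * coef b₂ * u₂ + coef γ * coef c₀ * u₃
      ≈⟨ trans (+-cong (+-cong (+-congˡ (vanish α a₁ β b₁ s-cancels s)) (vanish α a₂ γ c₂ t-cancels t))
                 (vanish β b₀ γ c₁ v-cancels v))
           (solve 1 (λ x → ((x :+ con (0 , 0)) :+ con (0 , 0)) :+ con (0 , 0) := x) refl _) ⟨
    ((coef α * coef a₀ * u₁ + coef β * coef b₂ * u₂ + coef γ * coef c₀ * u₃
      + (coef α * coef a₁ + coef β * coef b₁) * s)
      + (coef α * coef a₂ + coef γ * coef c₂) * t)
      + (coef β * coef b₀ + coef γ * coef c₁) * v
      ≈⟨ regroup (coef a₀) (coef a₁) (coef a₂) (coef b₀) (coef b₁) (coef b₂) (coef c₀) (coef c₁) (coef c₂)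
           (coef α) (coef β) (coef γ) u₁ u₂ u₃ s t v ⟩
    coef α * (coef a₀ * u₁ + coef a₁ * s + coef a₂ * t)
      + coef β * (coef b₀ * v + coef b₁ * s + coef b₂ * u₂)
      + coef γ * (coef c₀ * u₃ + coef c₁ * v + coef c₂ * t)
      ≈⟨ +-cong (+-cong (*-congˡ RA) (*-congˡ RB)) (*-congˡ RC) ⟩
    coef α * 0# + coef β * 0# + coef γ * 0#
      ≈⟨ solve 3 (λ x y z → x :* con (0 , 0) :+ y :* con (0 , 0) :+ z :* con (0 , 0) := con (0 , 0)) refl _ _ _ ⟩
    0# ∎
    where
    vanish : ∀ α a β b → α ⊗ a ≡ negate (β ⊗ b) → ∀ x →
      (coef α * coef a + coef β * coef b) * x ≈ 0#
    vanish α a β b eq x = begin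
      (coef α * coef a + coef β * coef b) * x
        ≈⟨ *-congʳ (+-cong (sym (coef-⊗ α a)) (sym (coef-⊗ β b))) ⟩
      (coef (α ⊗ a) + coef (β ⊗ b)) * x
        ≈⟨ *-congʳ (+-congʳ (trans (reflexive (≡.cong coef eq)) (coef-negate (β ⊗ b)))) ⟩
      (- coef (β ⊗ b) + coef (β ⊗ b)) * x
        ≈⟨ trans (*-congʳ (-‿inverseˡ _)) (zeroˡ x) ⟩
      0# ∎
    regroup : ∀ a₀ a₁ a₂ b₀ b₁ b₂ c₀ c₁ c₂ α β γ u₁ u₂ u₃ s t v →
      ((α * a₀ * u₁ + β * b₂ * u₂ + γ * c₀ * u₃ + (α * a₁ + β * b₁) * s) + (α * a₂ + γ * c₂) * t) + (β * b₀ + γ * c₁) * v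
      ≈ α * (a₀ * u₁ + a₁ * s + a₂ * t) + β * (b₀ * v + b₁ * s + b₂ * u₂) + γ * (c₀ * u₃ + c₁ * v + c₂ * t)
    regroup = solve 18 (λ a₀ a₁ a₂ b₀ b₁ b₂ c₀ c₁ c₂ α β γ u₁ u₂ u₃ s t v →
      ((α :* a₀ :* u₁ :+ β :* b₂ :* u₂ :+ γ :* c₀ :* u₃ :+ (α :* a₁ :+ β :* b₁) :* s) :+ (α :* a₂ :+ γ :* c₂) :* t) :+ (β :* b₀ :+ γ :* c₁) :* v
      := α :* (a₀ :* u₁ :+ a₁ :* s :+ a₂ :* t) :+ β :* (b₀ :* v :+ b₁ :* s :+ b₂ :* u₂) :+ γ :* (c₀ :* u₃ :+ c₁ :* v :+ c₂ :* t)) refl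

  module NilpotentMonomials (q^N≈0 : q ^ N ≈ 0#) where
    open Nilpotent q^N≈0
    open SignedNilpotent q^N≈0
    open Period 21

    Θ : List (Sign × ℕ) → Carrier
    Θ = productOver λ (s , a) → θ s a

    θ-fold : ∀ s a → θ s (foldIndex a) ≈ θ s a
    θ-fold s a with a ≤ᵇ 10
    ... | true = refl
    ... | false with a ≤ᵇ 21 in eq
    ...   | true  = θ-reflect s (ℕ.≤ᵇ⇒≤ a 21 (≡.subst T (≡.sym eq) tt))
    ...   | false = refl

    Θ-normalise : ∀ xs ys → normalise xs ≡ normalise ys → Θ xs ≈ Θ ys
    Θ-normalise xs ys eq = begin
      Θ xs                   ≈⟨ productOver-map foldSigned (λ (s , a) → θ-fold s a) xs ⟨
      Θ (map foldSigned xs)  ≈⟨ productOver-sorted _ signedKey (map foldSigned xs) (map foldSigned ys) eq ⟩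
      Θ (map foldSigned ys)  ≈⟨ productOver-map foldSigned (λ (s , a) → θ-fold s a) ys ⟩
      Θ ys                   ∎

    -- As a record, the equation keeps its coefficients and monomials readable in its type, so they
    -- can be permuted and normalised symbolically.
    record Relation (x y z : Coefficient × List (Sign × ℕ)) : Set ℓ where
      constructor relation
      field
        holds : coef (proj₁ x) * Θ (proj₂ x) + coef (proj₁ y) * Θ (proj₂ y) + coef (proj₁ z) * Θ (proj₂ z) ≈ 0#

    rotate : ∀ {x y z} → Relation x y z → Relation y z x
    rotate (relation eq) = relation (trans (trans (+-comm _ _) (sym (+-assoc _ _ _))) eq)

    exchange : ∀ {x y z} → Relation x y z → Relation y x z
    exchange (relation eq) = relation (trans (+-congʳ (+-comm _ _)) eq)

    rewriteTerms : ∀ {a b c xs ys zs xs′ ys′ zs′} →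
      normalise xs ≡ normalise xs′ → normalise ys ≡ normalise ys′ → normalise zs ≡ normalise zs′ →
      Relation (a , xs) (b , ys) (c , zs) → Relation (a , xs′) (b , ys′) (c , zs′)
    rewriteTerms {xs = xs} {ys} {zs} {xs′} {ys′} {zs′} x y z (relation eq) = relation (trans (sym (+-cong (+-cong
      (*-congˡ (Θ-normalise xs xs′ x)) (*-congˡ (Θ-normalise ys ys′ y))) (*-congˡ (Θ-normalise zs zs′ z)))) eq)

    weierstrassRelation : ∀ κ s₁ s₂ s₃ W i j k →
      T (i ℕ.+ i ℕ.+ (j ℕ.+ j ℕ.+ (k ℕ.+ k ℕ.+ W)) ≤ᵇ 21) →
      Relation
        ((s₂ , j) , (κ · s₁ , i ℕ.+ (j ℕ.+ j ℕ.+ (k ℕ.+ k ℕ.+ W))) ∷ (s₁ , i) ∷ (κ · s₃ , k ℕ.+ W) ∷ (s₃ , k) ∷ [])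
        ((Sign.+ , 0) , (κ · opposite (s₁ · s₂) , i ℕ.+ j ℕ.+ (k ℕ.+ k ℕ.+ W)) ∷ (opposite (s₁ · s₂) , i ℕ.+ j)
                        ∷ (κ · opposite (s₂ · s₃) , j ℕ.+ k ℕ.+ W) ∷ (opposite (s₂ · s₃) , j ℕ.+ k) ∷ [])
        ((Sign.- , 0) , (κ · (s₁ · s₂ · s₃) , i ℕ.+ j ℕ.+ k ℕ.+ W) ∷ (s₁ · s₂ · s₃ , i ℕ.+ j ℕ.+ k)
                        ∷ (κ · s₂ , j ℕ.+ (k ℕ.+ k ℕ.+ W)) ∷ (s₂ , j) ∷ [])
    weierstrassRelation κ s₁ s₂ s₃ W i j k X≤21 = relation (trans
      (flatten _ _ _ _ _ _ _ _ _ _ _ _ _)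
      (trans (+-congʳ (weierstrass κ s₁ s₂ s₃ W i j k (ℕ.≤ᵇ⇒≤ _ _ X≤21))) (-‿inverseʳ _)))
      where
      flatten : ∀ r a b c d a′ b′ c′ d′ a″ b″ c″ d″ →
        r * (a * (b * (c * (d * 1#)))) + (1# * 1#) * (a′ * (b′ * (c′ * (d′ * 1#)))) + (- 1# * 1#) * (a″ * (b″ * (c″ * (d″ * 1#))))
        ≈ (r * ((a * b) * (c * d)) + (a′ * b′) * (c′ * d′)) - (a″ * b″) * (c″ * d″)
      flatten = solve 13 (λ r a b c d a′ b′ c′ d′ a″ b″ c″ d″ →
        r :* (a :* (b :* (c :* (d :* con (1 , 0))))) :+ (con (1 , 0) :* con (1 , 0)) :* (a′ :* (b′ :* (c′ :* (d′ :* con (1 , 0)))))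
          :+ (:- con (1 , 0) :* con (1 , 0)) :* (a″ :* (b″ :* (c″ :* (d″ :* con (1 , 0)))))
        := (r :* ((a :* b) :* (c :* d)) :+ (a′ :* b′) :* (c′ :* d′)) :- (a″ :* b″) :* (c″ :* d″)) refl

    -- Theta functions as products over residue classes modulo 42

    halfTheta-exponents : ∀ s a → halfTheta s a ≈ ∏ (N ℕ.+ N) (λ i → 1# + sgn s * q ^ (a ℕ.+ 21 ℕ.* i))
    halfTheta-exponents s a = ∏-cong (N ℕ.+ N) λ i → +-congˡ (trans (*-assoc _ _ _)
      (*-congˡ (trans (*-congˡ (^-assocʳ q 21 i)) (sym (^-homo-* q a (21 ℕ.* i))))))

    -- This is where period 21 becomes modulus 42: even and odd i give the progressions of a and of
    -- a + 21.
    halfTheta-minus : ∀ a → halfTheta Sign.- a ≈ φ a * φ (a ℕ.+ 21)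
    halfTheta-minus a = begin
      halfTheta Sign.- a
        ≈⟨ halfTheta-exponents Sign.- a ⟩
      ∏ (N ℕ.+ N) (λ i → 1# + - 1# * q ^ (a ℕ.+ 21 ℕ.* i))
        ≈⟨ ∏-cong (N ℕ.+ N) (λ i → +-congˡ (-1*x≈-x _)) ⟩
      ∏ (N ℕ.+ N) (λ i → 1# - q ^ (a ℕ.+ 21 ℕ.* i))
        ≡⟨ ≡.cong (λ n → ∏ n (λ i → 1# - q ^ (a ℕ.+ 21 ℕ.* i))) (double N) ⟩
      ∏ (N ℕ.* 2) (λ i → 1# - q ^ (a ℕ.+ 21 ℕ.* i))
        ≈⟨ ∏-blocks N 2 _ ⟩
      ∏ N (λ i → (1# * (1# - q ^ (a ℕ.+ 21 ℕ.* (i ℕ.* 2 ℕ.+ 0)))) * (1# - q ^ (a ℕ.+ 21 ℕ.* (i ℕ.* 2 ℕ.+ 1))))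
        ≈⟨ ∏-cong N (λ i → *-cong (trans (*-identityˡ _) (reflexive (≡.cong (λ k → 1# - q ^ k) (even a i))))
                                  (reflexive (≡.cong (λ k → 1# - q ^ k) (odd a i)))) ⟩
      ∏ N (λ i → (1# - q ^ (a ℕ.+ 42 ℕ.* i)) * (1# - q ^ (a ℕ.+ 21 ℕ.+ 42 ℕ.* i)))
        ≈⟨ ∏-distrib-* N _ _ ⟩
      φ a * φ (a ℕ.+ 21) ∎
      where
      double : ∀ n → n ℕ.+ n ≡ n ℕ.* 2
      double = ℕRing.solve-∀
      even : ∀ a i → a ℕ.+ 21 ℕ.* (i ℕ.* 2 ℕ.+ 0) ≡ a ℕ.+ 42 ℕ.* i
      even = ℕRing.solve-∀
      odd : ∀ a i → a ℕ.+ 21 ℕ.* (i ℕ.* 2 ℕ.+ 1) ≡ a ℕ.+ 21 ℕ.+ 42 ℕ.* i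
      odd = ℕRing.solve-∀

    halfTheta-both : ∀ a → halfTheta Sign.- a * halfTheta Sign.+ a ≈ φ (a ℕ.+ a)
    halfTheta-both a = begin
      halfTheta Sign.- a * halfTheta Sign.+ a
        ≈⟨ *-cong (halfTheta-exponents Sign.- a) (halfTheta-exponents Sign.+ a) ⟩
      _ ≈⟨ ∏-distrib-* (N ℕ.+ N) _ _ ⟨
      ∏ (N ℕ.+ N) (λ i → (1# + - 1# * q ^ (a ℕ.+ 21 ℕ.* i)) * (1# + 1# * q ^ (a ℕ.+ 21 ℕ.* i)))
        ≈⟨ ∏-cong (N ℕ.+ N) (λ i → trans (difference-of-squares _) (+-congˡ (-‿cong (square a i)))) ⟩
      ∏ (N ℕ.+ N) (λ i → 1# - q ^ (a ℕ.+ a ℕ.+ 42 ℕ.* i))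
        ≈⟨ ∏-stable _ (ℕ.m≤m+n N N) (λ i N≤i → trans (+-congˡ (trans (-‿cong (q^≈0 _
             (ℕ.≤-trans N≤i (ℕ.≤-trans (ℕ.m≤n*m i 42) (ℕ.m≤n+m _ (a ℕ.+ a)))))) -0#≈0#)) (+-identityʳ 1#)) ⟩
      φ (a ℕ.+ a) ∎
      where
      difference-of-squares : ∀ x → (1# + - 1# * x) * (1# + 1# * x) ≈ 1# - x * x
      difference-of-squares = solve 1 (λ x →
        (con (1 , 0) :+ :- con (1 , 0) :* x) :* (con (1 , 0) :+ con (1 , 0) :* x) := con (1 , 0) :- x :* x) refl
      square : ∀ a i → q ^ (a ℕ.+ 21 ℕ.* i) * q ^ (a ℕ.+ 21 ℕ.* i) ≈ q ^ (a ℕ.+ a ℕ.+ 42 ℕ.* i)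
      square a i = trans (sym (^-homo-* q (a ℕ.+ 21 ℕ.* i) _)) (reflexive (≡.cong (q ^_) (lemma a i)))
        where
        lemma : ∀ a i → a ℕ.+ 21 ℕ.* i ℕ.+ (a ℕ.+ 21 ℕ.* i) ≡ a ℕ.+ a ℕ.+ 42 ℕ.* i
        lemma = ℕRing.solve-∀

    θ-minus : ∀ a → θ Sign.- a ≈ Φ (a ∷ a ℕ.+ 21 ∷ 21 ∸ a ∷ 21 ∸ a ℕ.+ 21 ∷ [])
    θ-minus a = trans (*-cong (halfTheta-minus a) (halfTheta-minus (21 ∸ a)))
      (solve 4 (λ x y z w → (x :* y) :* (z :* w) := x :* (y :* (z :* (w :* con (1 , 0))))) refl _ _ _ _)

    θ-both : ∀ a → θ Sign.- a * θ Sign.+ a ≈ Φ (a ℕ.+ a ∷ (21 ∸ a) ℕ.+ (21 ∸ a) ∷ [])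
    θ-both a = begin
      (halfTheta Sign.- a * halfTheta Sign.- (21 ∸ a)) * (halfTheta Sign.+ a * halfTheta Sign.+ (21 ∸ a))
        ≈⟨ solve 4 (λ x y z w → (x :* y) :* (z :* w) := (x :* z) :* ((y :* w) :* con (1 , 0))) refl _ _ _ _ ⟩
      (halfTheta Sign.- a * halfTheta Sign.+ a) * ((halfTheta Sign.- (21 ∸ a) * halfTheta Sign.+ (21 ∸ a)) * 1#)
        ≈⟨ *-cong (halfTheta-both a) (*-congʳ (halfTheta-both (21 ∸ a))) ⟩
      Φ (a ℕ.+ a ∷ (21 ∸ a) ℕ.+ (21 ∸ a) ∷ []) ∎

    Positive : List ℕ → Set
    Positive []       = ⊤
    Positive (r ∷ rs) = NonZero r × Positive rs

    unit-φ : ∀ r .{{_ : NonZero r}} → Unit (φ r)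
    unit-φ r = unit-∏ N λ i → unit-1-q^ (r ℕ.+ 42 ℕ.* i) {{ℕ.>-nonZero (ℕ.≤-trans (ℕ.>-nonZero⁻¹ r) (ℕ.m≤m+n r _))}}

    unit-Φ : ∀ rs → Positive rs → Unit (Φ rs)
    unit-Φ []       _            = 1# , *-identityˡ 1#
    unit-Φ (r ∷ rs) (r≢0 , rs>0) = unit-* (unit-φ r {{r≢0}}) (unit-Φ rs rs>0)

    conjugate : ℕ → ℕ → ℕ
    conjugate u a = foldIndex ((u ℕ.* a) % 21)

    minusResidues bothResidues : ℕ → List ℕ
    minusResidues x = x ∷ x ℕ.+ 21 ∷ 21 ∸ x ∷ 21 ∸ x ℕ.+ 21 ∷ []
    bothResidues x = x ℕ.+ x ∷ (21 ∸ x) ℕ.+ (21 ∸ x) ∷ []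

    -- Here x = `conjugate u a` is known only up to sign modulo 21. That suffices: since u is odd, ±
    -- ua and ± u(21 - a) together are all residues modulo 42 that are ± x modulo 21, and doubling
    -- determines ± 2ua modulo 42. For given u and a both laws are checked by evaluation.
    MinusLaw BothLaw : ℕ → ℕ → Set
    MinusLaw u a = sort id (minusResidues (conjugate u a)) ≡ sort id (class u a ++ class u (21 ∸ a))
    BothLaw u a = sort id (bothResidues (conjugate u a)) ≡ sort id (class u (a ℕ.+ a))

    minus-law : ∀ u a → MinusLaw u a → θ Sign.- (conjugate u a) ≈ Φ (class u a) * Φ (class u (21 ∸ a))
    minus-law u a eq = trans (θ-minus (conjugate u a))
      (trans (productOver-sorted φ id (minusResidues (conjugate u a)) (class u a ++ class u (21 ∸ a)) eq)
             (productOver-++ φ (class u a) (class u (21 ∸ a))))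

    both-law : ∀ u a → BothLaw u a → θ Sign.- (conjugate u a) * θ Sign.+ (conjugate u a) ≈ Φ (class u (a ℕ.+ a))
    both-law u a eq = trans (θ-both (conjugate u a))
      (productOver-sorted φ id (bothResidues (conjugate u a)) (class u (a ℕ.+ a)) eq)

    Φ-classes-∷ : ∀ u r rs → Φ (classes u (r ∷ rs)) ≈ Φ (class u r) * Φ (classes u rs)
    Φ-classes-∷ u r rs = productOver-++ φ (class u r) (classes u rs)

    scale : ∀ {a b c x y z} M {x′ y′ z′} → x * M ≈ x′ → y * M ≈ y′ → z * M ≈ z′ →
      a * x + b * y + c * z ≈ 0# → a * x′ + b * y′ + c * z′ ≈ 0#
    scale {a} {b} {c} {x} {y} {z} M {x′} {y′} {z′} x≈ y≈ z≈ eq = begin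
      a * x′ + b * y′ + c * z′
        ≈⟨ +-cong (+-cong (*-congˡ x≈) (*-congˡ y≈)) (*-congˡ z≈) ⟨
      a * (x * M) + b * (y * M) + c * (z * M)
        ≈⟨ solve 7 (λ a b c x y z m → a :* (x :* m) :+ b :* (y :* m) :+ c :* (z :* m)
             := (a :* x :+ b :* y :+ c :* z) :* m) refl a b c x y z M ⟩
      (a * x + b * y + c * z) * M  ≈⟨ *-congʳ eq ⟩
      0# * M                       ≈⟨ zeroˡ M ⟩
      0#                           ∎

    module Combination (u : ℕ) where

      private
        -- The sign is the one in front of q inside the factors, so `Sign.-` belongs to P and
        -- `Sign.+` to N, with index ua.
        P⁻ P⁺ : ℕ → Sign × ℕ
        P⁻ a = Sign.- , conjugate u a
        P⁺ a = Sign.+ , conjugate u a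

        p n b : ℕ → Carrier
        p a = θ Sign.- (conjugate u a)
        n a = θ Sign.+ (conjugate u a)
        b r = Φ (class u r)

      -- The monomials are those for u = 1 with indices multiplied by u, whereas the nine
      -- coefficients stay free because they change with u. The equations on α, β, γ say that after
      -- scaling by these the three mixed monomials cancel in pairs.
      combine : All (MinusLaw u) (1 ∷ 2 ∷ 3 ∷ 4 ∷ 5 ∷ 6 ∷ 7 ∷ 8 ∷ 9 ∷ 10 ∷ []) →
        All (BothLaw u) (1 ∷ 2 ∷ 3 ∷ 5 ∷ 6 ∷ 7 ∷ []) →
        Positive (classes u (6 ∷ 10 ∷ 12 ∷ 14 ∷ [])) →
        ∀ {a₀ a₁ a₂ b₀ b₁ b₂ c₀ c₁ c₂} α β γ →
        α ⊗ a₁ ≡ negate (β ⊗ b₁) → α ⊗ a₂ ≡ negate (γ ⊗ c₂) → β ⊗ b₀ ≡ negate (γ ⊗ c₁) →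
        Relation (a₀ , P⁺ 1 ∷ P⁻ 6 ∷ P⁺ 6 ∷ P⁻ 7 ∷ []) (a₁ , P⁺ 2 ∷ P⁻ 3 ∷ P⁺ 3 ∷ P⁻ 10 ∷ []) (a₂ , P⁻ 3 ∷ P⁻ 4 ∷ P⁺ 4 ∷ P⁺ 9 ∷ []) →
        Relation (b₀ , P⁻ 1 ∷ P⁻ 4 ∷ P⁻ 6 ∷ P⁻ 8 ∷ []) (b₁ , P⁻ 1 ∷ P⁻ 6 ∷ P⁻ 8 ∷ P⁻ 10 ∷ []) (b₂ , P⁻ 2 ∷ P⁻ 5 ∷ P⁻ 7 ∷ P⁻ 9 ∷ []) →
        Relation (c₀ , P⁻ 2 ∷ P⁻ 7 ∷ P⁻ 9 ∷ P⁻ 10 ∷ []) (c₁ , P⁺ 2 ∷ P⁺ 3 ∷ P⁺ 5 ∷ P⁺ 7 ∷ []) (c₂ , P⁺ 4 ∷ P⁺ 5 ∷ P⁺ 7 ∷ P⁺ 9 ∷ []) →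
        coef (α ⊗ a₀) * Φ (classes u setY) + coef (β ⊗ b₂) * Φ (classes u setX)
          + coef (γ ⊗ c₀) * (Φ (classes u setX) * Φ (classes u setY)) ≈ 0#
      combine (p₁ ∷ p₂ ∷ p₃ ∷ p₄ ∷ p₅ ∷ p₆ ∷ p₇ ∷ p₈ ∷ p₉ ∷ p₁₀ ∷ []) (m₁ ∷ m₂ ∷ m₃ ∷ m₅ ∷ m₆ ∷ m₇ ∷ []) K>0
        {a₀} {a₁} {a₂} {b₀} {b₁} {b₂} {c₀} {c₁} {c₂} α β γ s-cancels t-cancels v-cancels
        (relation RA) (relation RB) (relation RC) =
        -- The factor Z completes the two products of four to the twelve factors of `setY` and of
        -- `setX`, and the product of sixteen, which contains Z once, to the product of both.
        scale Z
          (append 2 8 13 15)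
          (append 4 5 9 16)
          (trans (solve 3 (λ x y c → (x :* y :* c) :* c := (x :* c) :* (y :* c)) refl F₁ F₂ Z)
            (*-cong (append 4 5 9 16)
                    (append 2 8 13 15)))
          (unit-cancel K-unit (trans distribute (trans full (sym (zeroʳ K)))))
        where
        K F₁ F₂ Z : Carrier
        K = Φ (classes u (6 ∷ 10 ∷ 12 ∷ 14 ∷ []))
        F₁ = b 4 * (b 5 * (b 9 * b 16))
        F₂ = b 2 * (b 8 * (b 13 * b 15))
        Z = Φ (classes u common)

        expand : ∀ w x y z rs → Φ (classes u (w ∷ x ∷ y ∷ z ∷ rs)) ≈ b w * (b x * (b y * (b z * Φ (classes u rs))))
        expand w x y z rs = trans (Φ-classes-∷ u w (x ∷ y ∷ z ∷ rs)) (*-congˡ (trans (Φ-classes-∷ u x (y ∷ z ∷ rs))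
          (*-congˡ (trans (Φ-classes-∷ u y (z ∷ rs)) (*-congˡ (Φ-classes-∷ u z rs))))))

        append : ∀ w x y z → b w * (b x * (b y * b z)) * Z ≈ Φ (classes u (w ∷ x ∷ y ∷ z ∷ common))
        append w x y z = trans
          (solve 5 (λ x y z w c → (x :* (y :* (z :* w))) :* c := x :* (y :* (z :* (w :* c)))) refl (b w) (b x) (b y) (b z) Z)
          (sym (expand w x y z common))

        K-unit : Unit K
        K-unit = unit-Φ _ K>0

        K≈ : K ≈ b 6 * (b 10 * (b 12 * (b 14 * 1#)))
        K≈ = expand 6 10 12 14 []

        Z≈ : Z ≈ b 1 * (b 3 * (b 7 * (b 11 * (b 17 * (b 18 * (b 19 * (b 20 * 1#)))))))
        Z≈ = trans (expand 1 3 7 11 (17 ∷ 18 ∷ 19 ∷ 20 ∷ [])) (*-congˡ (*-congˡ (*-congˡ (*-congˡ (expand 17 18 19 20 [])))))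

        -- The last factor P₅ serves three ends: in the first product it joins N₅ to give [10], in
        -- the second it supplies [5][16], and in the third it is the one P missing from P₁, ...,
        -- P₁₀.
        MA MB MC : Carrier
        MA = p 1 * (p 8 * (p 6 * (n 5 * (n 7 * p 5))))
        MB = n 2 * (p 3 * (n 3 * (n 5 * (n 7 * p 5))))
        MC = p 1 * (p 3 * (p 4 * (p 6 * (p 8 * p 5))))

        one : ∀ w x y z → w * (x * (y * (z * 1#))) ≈ w * (x * (y * z))
        one w x y z = *-congˡ (*-congˡ (*-congˡ (*-identityʳ z)))

        u₁ : Θ (P⁺ 1 ∷ P⁻ 6 ∷ P⁺ 6 ∷ P⁻ 7 ∷ []) * MA ≈ K * F₂
        u₁ = begin
          (n 1 * (p 6 * (n 6 * (p 7 * 1#)))) * MA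
            ≈⟨ *-congʳ (one _ _ _ _) ⟩
          (n 1 * (p 6 * (n 6 * p 7))) * MA
            ≈⟨ solve 9 (λ n1 p6 n6 p7 p1 p8 n5 n7 p5 →
                 (n1 :* (p6 :* (n6 :* p7))) :* (p1 :* (p8 :* (p6 :* (n5 :* (n7 :* p5)))))
                 := ((p1 :* n1) :* (p6 :* n6)) :* (((p5 :* n5) :* (p7 :* n7)) :* (p8 :* p6)))
               refl (n 1) (p 6) (n 6) (p 7) (p 1) (p 8) (n 5) (n 7) (p 5) ⟩
          ((p 1 * n 1) * (p 6 * n 6)) * (((p 5 * n 5) * (p 7 * n 7)) * (p 8 * p 6))
            ≈⟨ *-cong (*-cong (both-law u 1 m₁) (both-law u 6 m₆)) (*-cong (*-cong (both-law u 5 m₅) (both-law u 7 m₇))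
                 (*-cong (minus-law u 8 p₈) (minus-law u 6 p₆))) ⟩
          (b 2 * b 12) * ((b 10 * b 14) * ((b 8 * b 13) * (b 6 * b 15)))
            ≈⟨ solve 8 (λ b2 b12 b10 b14 b8 b13 b6 b15 →
                 (b2 :* b12) :* ((b10 :* b14) :* ((b8 :* b13) :* (b6 :* b15)))
                 := (b6 :* (b10 :* (b12 :* (b14 :* con (1 , 0))))) :* (b2 :* (b8 :* (b13 :* b15))))
               refl (b 2) (b 12) (b 10) (b 14) (b 8) (b 13) (b 6) (b 15) ⟩
          (b 6 * (b 10 * (b 12 * (b 14 * 1#)))) * F₂
            ≈⟨ *-congʳ K≈ ⟨
          K * F₂ ∎

        u₂ : Θ (P⁻ 2 ∷ P⁻ 5 ∷ P⁻ 7 ∷ P⁻ 9 ∷ []) * MB ≈ K * F₁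
        u₂ = begin
          (p 2 * (p 5 * (p 7 * (p 9 * 1#)))) * MB
            ≈⟨ *-congʳ (one _ _ _ _) ⟩
          (p 2 * (p 5 * (p 7 * p 9))) * MB
            ≈⟨ solve 9 (λ p2 p5 p7 p9 n2 p3 n3 n5 n7 →
                 (p2 :* (p5 :* (p7 :* p9))) :* (n2 :* (p3 :* (n3 :* (n5 :* (n7 :* p5)))))
                 := ((p2 :* n2) :* (p3 :* n3)) :* (((p5 :* n5) :* (p7 :* n7)) :* (p5 :* p9)))
               refl (p 2) (p 5) (p 7) (p 9) (n 2) (p 3) (n 3) (n 5) (n 7) ⟩
          ((p 2 * n 2) * (p 3 * n 3)) * (((p 5 * n 5) * (p 7 * n 7)) * (p 5 * p 9))
            ≈⟨ *-cong (*-cong (both-law u 2 m₂) (both-law u 3 m₃)) (*-cong (*-cong (both-law u 5 m₅) (both-law u 7 m₇))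
                 (*-cong (minus-law u 5 p₅) (minus-law u 9 p₉))) ⟩
          (b 4 * b 6) * ((b 10 * b 14) * ((b 5 * b 16) * (b 9 * b 12)))
            ≈⟨ solve 8 (λ b4 b6 b10 b14 b5 b16 b9 b12 →
                 (b4 :* b6) :* ((b10 :* b14) :* ((b5 :* b16) :* (b9 :* b12)))
                 := (b6 :* (b10 :* (b12 :* (b14 :* con (1 , 0))))) :* (b4 :* (b5 :* (b9 :* b16))))
               refl (b 4) (b 6) (b 10) (b 14) (b 5) (b 16) (b 9) (b 12) ⟩
          (b 6 * (b 10 * (b 12 * (b 14 * 1#)))) * F₁
            ≈⟨ *-congʳ K≈ ⟨
          K * F₁ ∎

        -- The product contains each of P₁, ..., P₁₀ exactly once, hence each of [1], ..., [20]
        -- exactly once; without the four factors of K sixteen remain.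
        u₃ : Θ (P⁻ 2 ∷ P⁻ 7 ∷ P⁻ 9 ∷ P⁻ 10 ∷ []) * MC ≈ K * (F₁ * F₂ * Z)
        u₃ = begin
          (p 2 * (p 7 * (p 9 * (p 10 * 1#)))) * MC
            ≈⟨ *-congʳ (one _ _ _ _) ⟩
          (p 2 * (p 7 * (p 9 * p 10))) * MC
            ≈⟨ *-cong (*-cong (minus-law u 2 p₂) (*-cong (minus-law u 7 p₇) (*-cong (minus-law u 9 p₉) (minus-law u 10 p₁₀))))
                 (*-cong (minus-law u 1 p₁) (*-cong (minus-law u 3 p₃) (*-cong (minus-law u 4 p₄) (*-cong (minus-law u 6 p₆)
                   (*-cong (minus-law u 8 p₈) (minus-law u 5 p₅)))))) ⟩
          _ ≈⟨ solve 20 (λ b1 b2 b3 b4 b5 b6 b7 b8 b9 b10 b11 b12 b13 b14 b15 b16 b17 b18 b19 b20 →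
                 ((b2 :* b19) :* ((b7 :* b14) :* ((b9 :* b12) :* (b10 :* b11))))
                 :* ((b1 :* b20) :* ((b3 :* b18) :* ((b4 :* b17) :* ((b6 :* b15) :* ((b8 :* b13) :* (b5 :* b16))))))
                 := (b6 :* (b10 :* (b12 :* (b14 :* con (1 , 0)))))
                    :* ((b4 :* (b5 :* (b9 :* b16))) :* (b2 :* (b8 :* (b13 :* b15)))
                        :* (b1 :* (b3 :* (b7 :* (b11 :* (b17 :* (b18 :* (b19 :* (b20 :* con (1 , 0)))))))))))
               refl (b 1) (b 2) (b 3) (b 4) (b 5) (b 6) (b 7) (b 8) (b 9) (b 10)
                 (b 11) (b 12) (b 13) (b 14) (b 15) (b 16) (b 17) (b 18) (b 19) (b 20) ⟩
          _ ≈⟨ *-cong K≈ (*-congˡ Z≈) ⟨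
          K * (F₁ * F₂ * Z) ∎

        s≈ : Θ (P⁻ 1 ∷ P⁻ 6 ∷ P⁻ 8 ∷ P⁻ 10 ∷ []) * MB ≈ Θ (P⁺ 2 ∷ P⁻ 3 ∷ P⁺ 3 ∷ P⁻ 10 ∷ []) * MA
        s≈ = trans (*-congʳ (one _ _ _ _)) (trans
          (solve 10 (λ p1 p6 p8 p10 n2 p3 n3 n5 n7 p5 →
            (p1 :* (p6 :* (p8 :* p10))) :* (n2 :* (p3 :* (n3 :* (n5 :* (n7 :* p5)))))
            := (n2 :* (p3 :* (n3 :* p10))) :* (p1 :* (p8 :* (p6 :* (n5 :* (n7 :* p5))))))
            refl (p 1) (p 6) (p 8) (p 10) (n 2) (p 3) (n 3) (n 5) (n 7) (p 5))
          (*-congʳ (sym (one _ _ _ _))))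

        t≈ : Θ (P⁺ 4 ∷ P⁺ 5 ∷ P⁺ 7 ∷ P⁺ 9 ∷ []) * MC ≈ Θ (P⁻ 3 ∷ P⁻ 4 ∷ P⁺ 4 ∷ P⁺ 9 ∷ []) * MA
        t≈ = trans (*-congʳ (one _ _ _ _)) (trans
          (solve 10 (λ n4 n5 n7 n9 p1 p3 p4 p6 p8 p5 →
            (n4 :* (n5 :* (n7 :* n9))) :* (p1 :* (p3 :* (p4 :* (p6 :* (p8 :* p5)))))
            := (p3 :* (p4 :* (n4 :* n9))) :* (p1 :* (p8 :* (p6 :* (n5 :* (n7 :* p5))))))
            refl (n 4) (n 5) (n 7) (n 9) (p 1) (p 3) (p 4) (p 6) (p 8) (p 5))
          (*-congʳ (sym (one _ _ _ _))))

        v≈ : Θ (P⁺ 2 ∷ P⁺ 3 ∷ P⁺ 5 ∷ P⁺ 7 ∷ []) * MC ≈ Θ (P⁻ 1 ∷ P⁻ 4 ∷ P⁻ 6 ∷ P⁻ 8 ∷ []) * MB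
        v≈ = trans (*-congʳ (one _ _ _ _)) (trans
          (solve 10 (λ n2 n3 n5 n7 p1 p3 p4 p6 p8 p5 →
            (n2 :* (n3 :* (n5 :* n7))) :* (p1 :* (p3 :* (p4 :* (p6 :* (p8 :* p5)))))
            := (p1 :* (p4 :* (p6 :* p8))) :* (n2 :* (p3 :* (n3 :* (n5 :* (n7 :* p5))))))
            refl (n 2) (n 3) (n 5) (n 7) (p 1) (p 3) (p 4) (p 6) (p 8) (p 5))
          (*-congʳ (sym (one _ _ _ _))))

        full : coef (α ⊗ a₀) * (K * F₂) + coef (β ⊗ b₂) * (K * F₁) + coef (γ ⊗ c₀) * (K * (F₁ * F₂ * Z)) ≈ 0#
        full = cancel-common a₀ a₁ a₂ b₀ b₁ b₂ c₀ c₁ c₂ α β γ s-cancels t-cancels v-cancels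
          (scale MA u₁ refl refl RA) (scale MB refl s≈ u₂ RB) (scale MC u₃ v≈ t≈ RC)

        distribute : K * (coef (α ⊗ a₀) * F₂ + coef (β ⊗ b₂) * F₁ + coef (γ ⊗ c₀) * (F₁ * F₂ * Z))
          ≈ coef (α ⊗ a₀) * (K * F₂) + coef (β ⊗ b₂) * (K * F₁) + coef (γ ⊗ c₀) * (K * (F₁ * F₂ * Z))
        distribute = solve 7 (λ k x y z f g h → k :* (x :* f :+ y :* g :+ z :* h)
          := x :* (k :* f) :+ y :* (k :* g) :+ z :* (k :* h)) refl K _ _ _ F₂ F₁ (F₁ * F₂ * Z)

-- The identity for each of the six units modulo 42 up to sign

module Instances {c ℓ} (R : CommutativeRing c ℓ) (q : CommutativeRing.Carrier R) (N : ℕ) where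
  open CommutativeRing R
  open import Algebra.Properties.CommutativeSemiring.Exp commutativeSemiring
  open Monomials R q N

  -- Divided by both products, the first term becomes a times the generating function for `setX`,
  -- the second b times the one for `setY`, and the third the bare monomial c.
  ThreeTerm : ℕ → Coefficient → Coefficient → Coefficient → Set _
  ThreeTerm u a b c = coef a * Φ (classes u setY) + coef b * Φ (classes u setX)
    + coef c * (Φ (classes u setX) * Φ (classes u setY)) ≈ 0#

  module _ (q^N≈0 : q ^ N ≈ 0#) where
    open NilpotentMonomials q^N≈0

    -- The arguments W, i, j, k of weierstrassRelation are solved for from the indices in the relations
    -- of the header, multiplied by u and reduced to 1, ..., 10 modulo 21 and sign.
    threeTerm-1 : ThreeTerm 1 (Sign.- , 0) (Sign.+ , 1) (Sign.+ , 0)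
    threeTerm-1 = Combination.combine 1
      (≡.refl ∷ ≡.refl ∷ ≡.refl ∷ ≡.refl ∷ ≡.refl ∷ ≡.refl ∷ ≡.refl ∷ ≡.refl ∷ ≡.refl ∷ ≡.refl ∷ [])
      (≡.refl ∷ ≡.refl ∷ ≡.refl ∷ ≡.refl ∷ ≡.refl ∷ ≡.refl ∷ [])
      -- The multipliers are 1, q, -1. The second relation needs q because its mixed monomials have
      -- coefficients 1 and q up to sign, while their partners have q in the first relation and q²
      -- in the third.
      _ (Sign.+ , 0) (Sign.+ , 1) (Sign.- , 0) ≡.refl ≡.refl ≡.refl
      (rewriteTerms ≡.refl ≡.refl ≡.refl (rotate (rotate (weierstrassRelation Sign.- Sign.+ Sign.+ Sign.- 0 2 1 3 tt))))
      (rewriteTerms ≡.refl ≡.refl ≡.refl (rotate (exchange (weierstrassRelation Sign.+ Sign.- Sign.- Sign.- 2 1 1 4 tt))))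
      (rewriteTerms ≡.refl ≡.refl ≡.refl (rotate (rotate (weierstrassRelation Sign.+ Sign.+ Sign.- Sign.+ 1 5 2 2 tt))))

    threeTerm-5 : ThreeTerm 5 (Sign.- , 0) (Sign.+ , 0) (Sign.- , 2)
    threeTerm-5 = Combination.combine 5
      (≡.refl ∷ ≡.refl ∷ ≡.refl ∷ ≡.refl ∷ ≡.refl ∷ ≡.refl ∷ ≡.refl ∷ ≡.refl ∷ ≡.refl ∷ ≡.refl ∷ [])
      (≡.refl ∷ ≡.refl ∷ ≡.refl ∷ ≡.refl ∷ ≡.refl ∷ ≡.refl ∷ [])
      _ (Sign.+ , 0) (Sign.+ , 0) (Sign.+ , 2) ≡.refl ≡.refl ≡.refl
      (rewriteTerms ≡.refl ≡.refl ≡.refl (exchange (rotate (weierstrassRelation Sign.- Sign.+ Sign.+ Sign.- 0 3 5 1 tt))))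
      (rewriteTerms ≡.refl ≡.refl ≡.refl (rotate (exchange (weierstrassRelation Sign.+ Sign.- Sign.- Sign.- 1 5 2 1 tt))))
      (rewriteTerms ≡.refl ≡.refl ≡.refl (exchange (rotate (weierstrassRelation Sign.+ Sign.+ Sign.- Sign.+ 1 1 3 3 tt))))

    threeTerm-11 : ThreeTerm 11 (Sign.+ , 0) (Sign.- , 0) (Sign.- , 2)
    threeTerm-11 = Combination.combine 11
      (≡.refl ∷ ≡.refl ∷ ≡.refl ∷ ≡.refl ∷ ≡.refl ∷ ≡.refl ∷ ≡.refl ∷ ≡.refl ∷ ≡.refl ∷ ≡.refl ∷ [])
      (≡.refl ∷ ≡.refl ∷ ≡.refl ∷ ≡.refl ∷ ≡.refl ∷ ≡.refl ∷ [])
      _ (Sign.+ , 0) (Sign.+ , 0) (Sign.- , 1) ≡.refl ≡.refl ≡.refl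
      (rewriteTerms ≡.refl ≡.refl ≡.refl (rotate (weierstrassRelation Sign.- Sign.+ Sign.+ Sign.- 0 6 1 2 tt)))
      (rewriteTerms ≡.refl ≡.refl ≡.refl (weierstrassRelation Sign.+ Sign.- Sign.- Sign.- 1 2 1 3 tt))
      (rewriteTerms ≡.refl ≡.refl ≡.refl (rotate (exchange (weierstrassRelation Sign.+ Sign.- Sign.+ Sign.- 1 1 1 5 tt))))

    threeTerm-13 : ThreeTerm 13 (Sign.+ , 0) (Sign.- , 2) (Sign.- , 0)
    threeTerm-13 = Combination.combine 13
      (≡.refl ∷ ≡.refl ∷ ≡.refl ∷ ≡.refl ∷ ≡.refl ∷ ≡.refl ∷ ≡.refl ∷ ≡.refl ∷ ≡.refl ∷ ≡.refl ∷ [])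
      (≡.refl ∷ ≡.refl ∷ ≡.refl ∷ ≡.refl ∷ ≡.refl ∷ ≡.refl ∷ [])
      _ (Sign.+ , 0) (Sign.- , 2) (Sign.- , 0) ≡.refl ≡.refl ≡.refl
      (rewriteTerms ≡.refl ≡.refl ≡.refl (exchange (weierstrassRelation Sign.- Sign.- Sign.- Sign.- 0 4 3 3 tt)))
      (rewriteTerms ≡.refl ≡.refl ≡.refl (rotate (rotate (weierstrassRelation Sign.+ Sign.- Sign.- Sign.- 2 1 1 4 tt))))
      (rewriteTerms ≡.refl ≡.refl ≡.refl (exchange (weierstrassRelation Sign.+ Sign.+ Sign.+ Sign.+ 1 5 2 2 tt)))

    threeTerm-17 : ThreeTerm 17 (Sign.- , 3) (Sign.+ , 0) (Sign.- , 0)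
    threeTerm-17 = Combination.combine 17
      (≡.refl ∷ ≡.refl ∷ ≡.refl ∷ ≡.refl ∷ ≡.refl ∷ ≡.refl ∷ ≡.refl ∷ ≡.refl ∷ ≡.refl ∷ ≡.refl ∷ [])
      (≡.refl ∷ ≡.refl ∷ ≡.refl ∷ ≡.refl ∷ ≡.refl ∷ ≡.refl ∷ [])
      _ (Sign.+ , 1) (Sign.- , 0) (Sign.- , 0) ≡.refl ≡.refl ≡.refl
      (rewriteTerms ≡.refl ≡.refl ≡.refl (rotate (exchange (weierstrassRelation Sign.- Sign.+ Sign.- Sign.- 0 4 2 3 tt))))
      (rewriteTerms ≡.refl ≡.refl ≡.refl (exchange (weierstrassRelation Sign.+ Sign.- Sign.- Sign.- 1 2 1 3 tt)))
      (rewriteTerms ≡.refl ≡.refl ≡.refl (rotate (weierstrassRelation Sign.+ Sign.+ Sign.+ Sign.+ 1 1 1 5 tt)))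

    threeTerm-19 : ThreeTerm 19 (Sign.- , 0) (Sign.+ , 0) (Sign.+ , 3)
    threeTerm-19 = Combination.combine 19
      (≡.refl ∷ ≡.refl ∷ ≡.refl ∷ ≡.refl ∷ ≡.refl ∷ ≡.refl ∷ ≡.refl ∷ ≡.refl ∷ ≡.refl ∷ ≡.refl ∷ [])
      (≡.refl ∷ ≡.refl ∷ ≡.refl ∷ ≡.refl ∷ ≡.refl ∷ ≡.refl ∷ [])
      _ (Sign.+ , 0) (Sign.+ , 0) (Sign.+ , 0) ≡.refl ≡.refl ≡.refl
      (rewriteTerms ≡.refl ≡.refl ≡.refl (rotate (rotate (weierstrassRelation Sign.- Sign.- Sign.+ Sign.- 0 1 2 6 tt))))
      (rewriteTerms ≡.refl ≡.refl ≡.refl (rotate (rotate (weierstrassRelation Sign.+ Sign.- Sign.- Sign.- 1 5 2 1 tt))))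
      (rewriteTerms ≡.refl ≡.refl ≡.refl (weierstrassRelation Sign.+ Sign.- Sign.+ Sign.- 1 1 3 3 tt))

-- Power series and partition counts

open import Defs

Series : Set
Series = ℕ → ℤ

one X : Series
one zero    = + 1
one (suc n) = + 0
X zero    = + 0
X (suc n) = one n

infixl 7 _⊛_
-- The Cauchy product in the recursive form fg = f(0) g + q f₁ g, where f₁ is the shifted series
-- `f ∘ suc`.
_⊛_ : Series → Series → Series
(f ⊛ g) zero    = f 0 ℤ.* g 0
(f ⊛ g) (suc n) = f 0 ℤ.* g (suc n) ℤ.+ (f ∘ suc ⊛ g) n

⊛-cong≤ : ∀ {f f′ g g′} n → (∀ i → i ≤ n → f i ≡ f′ i) → (∀ i → i ≤ n → g i ≡ g′ i) → (f ⊛ g) n ≡ (f′ ⊛ g′) n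
⊛-cong≤ zero    f≡ g≡ = ≡.cong₂ ℤ._*_ (f≡ 0 z≤n) (g≡ 0 z≤n)
⊛-cong≤ (suc n) f≡ g≡ = ≡.cong₂ ℤ._+_ (≡.cong₂ ℤ._*_ (f≡ 0 z≤n) (g≡ (suc n) ℕ.≤-refl))
  (⊛-cong≤ n (λ i i≤n → f≡ (suc i) (s≤s i≤n)) (λ i i≤n → g≡ i (ℕ.m≤n⇒m≤1+n i≤n)))

-- The mirror image of the defining recursion, which treats the factors asymmetrically;
-- commutativity follows by comparing the two.
⊛-sucʳ : ∀ f g n → (f ⊛ g) (suc n) ≡ (f ⊛ g ∘ suc) n ℤ.+ f (suc n) ℤ.* g 0
⊛-sucʳ f g zero    = ≡.refl
⊛-sucʳ f g (suc n) = ≡.trans (≡.cong (λ z → f 0 ℤ.* g (suc (suc n)) ℤ.+ z) (⊛-sucʳ (f ∘ suc) g n))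
  (≡.sym (ℤ.+-assoc (f 0 ℤ.* g (suc (suc n))) _ _))

⊛-comm : ∀ f g n → (f ⊛ g) n ≡ (g ⊛ f) n
⊛-comm f g zero    = ℤ.*-comm (f 0) (g 0)
⊛-comm f g (suc n) = ≡.trans
  (≡.cong₂ ℤ._+_ (ℤ.*-comm (f 0) (g (suc n))) (⊛-comm (f ∘ suc) g n))
  (≡.trans (ℤ.+-comm (g (suc n) ℤ.* f 0) _) (≡.sym (⊛-sucʳ g f n)))

⊛-distribʳ : ∀ f g h n → ((λ i → f i ℤ.+ g i) ⊛ h) n ≡ (f ⊛ h) n ℤ.+ (g ⊛ h) n
⊛-distribʳ f g h zero    = ℤ.*-distribʳ-+ (h 0) (f 0) (g 0)
⊛-distribʳ f g h (suc n) = ≡.trans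
  (≡.cong (λ z → (f 0 ℤ.+ g 0) ℤ.* h (suc n) ℤ.+ z) (⊛-distribʳ (f ∘ suc) (g ∘ suc) h n))
  (lemma (f 0) (g 0) (h (suc n)) _ _)
  where
  lemma : ∀ a b c x y → (a ℤ.+ b) ℤ.* c ℤ.+ (x ℤ.+ y) ≡ (a ℤ.* c ℤ.+ x) ℤ.+ (b ℤ.* c ℤ.+ y)
  lemma = ℤRing.solve-∀

⊛-scale : ∀ c f g n → ((λ i → c ℤ.* f i) ⊛ g) n ≡ c ℤ.* (f ⊛ g) n
⊛-scale c f g zero    = ℤ.*-assoc c (f 0) (g 0)
⊛-scale c f g (suc n) = ≡.trans (≡.cong (λ z → c ℤ.* f 0 ℤ.* g (suc n) ℤ.+ z) (⊛-scale c (f ∘ suc) g n))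
  (lemma c (f 0) (g (suc n)) _)
  where
  lemma : ∀ c a b x → c ℤ.* a ℤ.* b ℤ.+ c ℤ.* x ≡ c ℤ.* (a ℤ.* b ℤ.+ x)
  lemma = ℤRing.solve-∀

⊛-assoc : ∀ f g h n → ((f ⊛ g) ⊛ h) n ≡ (f ⊛ (g ⊛ h)) n
⊛-assoc f g h zero    = ℤ.*-assoc (f 0) (g 0) (h 0)
⊛-assoc f g h (suc n) = begin
  f 0 ℤ.* g 0 ℤ.* h (suc n) ℤ.+ ((f ⊛ g) ∘ suc ⊛ h) n
    ≡⟨ ≡.cong (λ z → f 0 ℤ.* g 0 ℤ.* h (suc n) ℤ.+ z) (⊛-distribʳ (λ i → f 0 ℤ.* g (suc i)) (f ∘ suc ⊛ g) h n) ⟩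
  f 0 ℤ.* g 0 ℤ.* h (suc n) ℤ.+ (((λ i → f 0 ℤ.* g (suc i)) ⊛ h) n ℤ.+ ((f ∘ suc ⊛ g) ⊛ h) n)
    ≡⟨ ≡.cong₂ (λ x y → f 0 ℤ.* g 0 ℤ.* h (suc n) ℤ.+ (x ℤ.+ y)) (⊛-scale (f 0) (g ∘ suc) h n) (⊛-assoc (f ∘ suc) g h n) ⟩
  f 0 ℤ.* g 0 ℤ.* h (suc n) ℤ.+ (f 0 ℤ.* (g ∘ suc ⊛ h) n ℤ.+ (f ∘ suc ⊛ (g ⊛ h)) n)
    ≡⟨ lemma (f 0) (g 0) (h (suc n)) _ _ ⟩
  f 0 ℤ.* (g 0 ℤ.* h (suc n) ℤ.+ (g ∘ suc ⊛ h) n) ℤ.+ (f ∘ suc ⊛ (g ⊛ h)) n ∎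
  where
  open ≡.≡-Reasoning
  lemma : ∀ a b c x y → a ℤ.* b ℤ.* c ℤ.+ (a ℤ.* x ℤ.+ y) ≡ a ℤ.* (b ℤ.* c ℤ.+ x) ℤ.+ y
  lemma = ℤRing.solve-∀

⊛-zeroˡ : ∀ g n → ((λ _ → + 0) ⊛ g) n ≡ + 0
⊛-zeroˡ g zero    = ≡.refl
⊛-zeroˡ g (suc n) = ≡.trans (ℤ.+-identityˡ _) (⊛-zeroˡ g n)

⊛-identityˡ : ∀ g n → (one ⊛ g) n ≡ g n
⊛-identityˡ g zero    = ℤ.*-identityˡ (g 0)
⊛-identityˡ g (suc n) = ≡.trans (≡.cong₂ ℤ._+_ (ℤ.*-identityˡ (g (suc n))) (⊛-zeroˡ g n)) (ℤ.+-identityʳ _)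

delay : ℕ → Series → Series
delay zero    f n       = f n
delay (suc k) f zero    = + 0
delay (suc k) f (suc n) = delay k f n

X-⊛ : ∀ f n → (X ⊛ f) n ≡ delay 1 f n
X-⊛ f zero    = ≡.refl
X-⊛ f (suc n) = ≡.trans (ℤ.+-identityˡ _) (⊛-identityˡ f n)

delay-≥ : ∀ k f n → delay k f (k ℕ.+ n) ≡ f n
delay-≥ zero    f n = ≡.refl
delay-≥ (suc k) f n = delay-≥ k f n

delay-< : ∀ k f n → n < k → delay k f n ≡ + 0
delay-< (suc k) f zero    _         = ≡.refl
delay-< (suc k) f (suc n) (s≤s n<k) = delay-< k f n n<k

-- ℤ[[q]] with series identified when their first N coefficients agree.
truncatedSeries : ℕ → CommutativeRing 0ℓ 0ℓ
truncatedSeries N = record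
  { Carrier = Series
  ; _≈_ = λ f g → ∀ i → i < N → f i ≡ g i
  ; _+_ = λ f g i → f i ℤ.+ g i
  ; _*_ = _⊛_
  ; -_ = λ f i → ℤ.- f i
  ; 0# = λ _ → + 0
  ; 1# = one
  ; isCommutativeRing = record
    { isRing = record
      { +-isAbelianGroup = record
        { isGroup = record
          { isMonoid = record
            { isSemigroup = record
              { isMagma = record
                { isEquivalence = record
                  { refl = λ _ _ → ≡.refl
                  ; sym = λ p i i<N → ≡.sym (p i i<N)
                  ; trans = λ p r i i<N → ≡.trans (p i i<N) (r i i<N)
                  }
                ; ∙-cong = λ p r i i<N → ≡.cong₂ ℤ._+_ (p i i<N) (r i i<N)
                }
              ; assoc = λ f g h i _ → ℤ.+-assoc (f i) (g i) (h i)
              }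
            ; identity = (λ f i _ → ℤ.+-identityˡ (f i)) , (λ f i _ → ℤ.+-identityʳ (f i))
            }
          ; inverse = (λ f i _ → ℤ.+-inverseˡ (f i)) , (λ f i _ → ℤ.+-inverseʳ (f i))
          ; ⁻¹-cong = λ p i i<N → ≡.cong ℤ.-_ (p i i<N)
          }
        ; comm = λ f g i _ → ℤ.+-comm (f i) (g i)
        }
      ; *-cong = λ p r i i<N → ⊛-cong≤ i (λ j j≤i → p j (ℕ.≤-<-trans j≤i i<N)) (λ j j≤i → r j (ℕ.≤-<-trans j≤i i<N))
      ; *-assoc = λ f g h i _ → ⊛-assoc f g h i
      ; *-identity = (λ f i _ → ⊛-identityˡ f i) , (λ f i _ → ≡.trans (⊛-comm f one i) (⊛-identityˡ f i))
      ; distrib = (λ f g h i _ → ≡.trans (⊛-comm f _ i) (≡.trans (⊛-distribʳ g h f i)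
                     (≡.cong₂ ℤ._+_ (⊛-comm g f i) (⊛-comm h f i))))
                , (λ f g h i _ → ⊛-distribʳ g h f i)
      }
    ; *-comm = λ f g i _ → ⊛-comm f g i
    }
  }

-- Generating functions of partitions by largest part

module Counting (S : ℕ → Bool) where

  count : (f k n : ℕ) → ℕ
  count f k n = length (filter (λ xs → T? (all S xs)) (partsLe f k n))

  part : ℕ → ℕ → ℕ
  part k c = if S k then c else 0

  length-filter-map : ∀ k xss →
    length (filter (λ xs → T? (all S xs)) (map (k ∷_) xss)) ≡ part k (length (filter (λ xs → T? (all S xs)) xss))
  length-filter-map k [] with S k
  ... | true  = ≡.refl
  ... | false = ≡.refl
  length-filter-map k (xs ∷ xss) with S k | length-filter-map k xss
  ... | false | eq = eq
  ... | true  | eq with all S xs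
  ...   | true  = ≡.cong suc eq
  ...   | false = eq

  count-suc : ∀ f k n → count (suc f) (suc k) (suc n) ≡
    count (suc f) k (suc n) ℕ.+ (if suc k ≤ᵇ suc n then part (suc k) (count f (suc k) (n ∸ k)) else 0)
  count-suc f k n = ≡.trans (≡.cong length (filter-++ (λ xs → T? (all S xs)) (partsLe (suc f) k (suc n)) _))
    (≡.trans (length-++ (filter (λ xs → T? (all S xs)) (partsLe (suc f) k (suc n))))
      (≡.cong (count (suc f) k (suc n) ℕ.+_) new))
    where
    new : length (filter (λ xs → T? (all S xs)) (if suc k ≤ᵇ suc n then map (suc k ∷_) (partsLe f (suc k) (n ∸ k)) else []))
          ≡ (if suc k ≤ᵇ suc n then part (suc k) (count f (suc k) (n ∸ k)) else 0)
    new with suc k ≤ᵇ suc n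
    ... | true  = length-filter-map (suc k) (partsLe f (suc k) (n ∸ k))
    ... | false = ≡.refl

  count-zero : ∀ f k → count f k 0 ≡ 1
  count-zero zero    k       = ≡.refl
  count-zero (suc f) zero    = ≡.refl
  count-zero (suc f) (suc k) = ≡.refl

  -- Removing a part k + 1 costs one unit of fuel but lowers n by k + 1, so the recursion meets
  -- surplus fuel. To be a statement about generating functions it must not depend on the surplus.
  count-fuel : ∀ f f′ k n → n ≤ f → n ≤ f′ → count f k n ≡ count f′ k n
  count-fuel f       f′       k       zero    _         _          = ≡.trans (count-zero f k) (≡.sym (count-zero f′ k))
  count-fuel (suc f) (suc f′) zero    (suc n) _         _          = ≡.refl
  count-fuel (suc f) (suc f′) (suc k) (suc n) (s≤s n≤f) (s≤s n≤f′) = ≡.trans (count-suc f k n)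
    (≡.trans (≡.cong₂ (λ x y → x ℕ.+ (if suc k ≤ᵇ suc n then part (suc k) y else 0))
      (count-fuel (suc f) (suc f′) k (suc n) (s≤s n≤f) (s≤s n≤f′))
      (count-fuel f f′ (suc k) (n ∸ k) (ℕ.≤-trans (ℕ.m∸n≤m n k) n≤f) (ℕ.≤-trans (ℕ.m∸n≤m n k) n≤f′)))
    (≡.sym (count-suc f′ k n)))

  -- Generating function of the partitions with all parts in S and at most k.
  G : ℕ → Series
  G k n = + count n k n

  G-suc-≥ : ∀ k m → G (suc k) (suc k ℕ.+ m) ≡ G k (suc k ℕ.+ m) ℤ.+ (if S (suc k) then G (suc k) m else + 0)
  G-suc-≥ k m = ≡.trans (≡.cong +_ (count-suc (k ℕ.+ m) k (k ℕ.+ m)))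
    (≡.trans (≡.cong (λ b → + (count (suc k ℕ.+ m) k (suc k ℕ.+ m) ℕ.+
        (if b then part (suc k) (count (k ℕ.+ m) (suc k) (k ℕ.+ m ∸ k)) else 0))) le)
      (≡.cong (λ z → G k (suc k ℕ.+ m) ℤ.+ z) new))
    where
    le : (suc k ≤ᵇ suc k ℕ.+ m) ≡ true
    le with suc k ≤ᵇ suc k ℕ.+ m | ℕ.≤⇒≤ᵇ (ℕ.m≤m+n (suc k) m)
    ... | true | _ = ≡.refl
    new : + part (suc k) (count (k ℕ.+ m) (suc k) (k ℕ.+ m ∸ k)) ≡ (if S (suc k) then G (suc k) m else + 0)
    new with S (suc k)
    ... | false = ≡.refl
    ... | true  = ≡.cong +_ (≡.trans (≡.cong (count (k ℕ.+ m) (suc k)) (ℕ.m+n∸m≡n k m))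
                    (count-fuel (k ℕ.+ m) m (suc k) m (ℕ.m≤n+m m k) ℕ.≤-refl))

  G-suc-< : ∀ k n → n ≤ k → G (suc k) n ≡ G k n
  G-suc-< k zero    _    = ≡.cong +_ (≡.trans (count-zero 0 (suc k)) (≡.sym (count-zero 0 k)))
  G-suc-< k (suc n) n<k  = ≡.trans (≡.cong +_ (count-suc n k n))
    (≡.trans (≡.cong (λ b → + (count (suc n) k (suc n) ℕ.+ (if b then part (suc k) (count n (suc k) (n ∸ k)) else 0))) gt)
      (≡.cong +_ (ℕ.+-identityʳ _)))
    where
    gt : (suc k ≤ᵇ suc n) ≡ false
    gt with suc k ≤ᵇ suc n | ℕ.≤ᵇ⇒≤ (suc k) (suc n)
    ... | true  | le = ⊥-elim (ℕ.<⇒≱ (s≤s n<k) (le tt))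
    ... | false | _  = ≡.refl

  -- A partition with parts at most k + 1 either avoids k + 1 or, if k + 1 lies in S, arises by
  -- adding one such part to a partition of the same kind.
  G-suc : ∀ k n → G (suc k) n ≡ G k n ℤ.+ delay (suc k) (λ m → if S (suc k) then G (suc k) m else + 0) n
  G-suc k n with suc k ℕ.≤? n
  ... | yes k<n with ℕ.m≤n⇒∃[o]m+o≡n k<n
  ...   | m , ≡.refl = ≡.trans (G-suc-≥ k m) (≡.cong (λ z → G k (suc k ℕ.+ m) ℤ.+ z) (≡.sym (delay-≥ (suc k) _ m)))
  G-suc k n | no k≮n = ≡.trans (G-suc-< k n (ℕ.≤-pred (ℕ.≰⇒> k≮n)))
    (≡.sym (≡.trans (≡.cong (λ z → G k n ℤ.+ z) (delay-< (suc k) _ n (ℕ.≰⇒> k≮n))) (ℤ.+-identityʳ _)))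

  G-stable : ∀ n j → G (n ℕ.+ j) n ≡ + p S n
  G-stable n zero    = ≡.cong (λ k → G k n) (ℕ.+-identityʳ n)
  G-stable n (suc j) = ≡.trans (≡.cong (λ k → G k n) (ℕ.+-suc n j))
    (≡.trans (G-suc-< (n ℕ.+ j) n (ℕ.m≤m+n n j)) (G-stable n j))

  G-0 : ∀ n → G 0 n ≡ one n
  G-0 zero    = ≡.refl
  G-0 (suc n) = ≡.refl

pm-periodic : ∀ m .{{_ : NonZero m}} rs i r → pm m rs (i ℕ.* m ℕ.+ r) ≡ pm m rs r
pm-periodic m []       i r = ≡.refl
pm-periodic m (x ∷ rs) i r = ≡.cong₂ _∨_
  (≡.cong₂ (λ a b → (a ≡ᵇ x % m) ∨ (b ≡ᵇ 0)) (shift r)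
    (≡.trans (≡.cong (_% m) (ℕ.+-assoc (i ℕ.* m) r x)) (shift (r ℕ.+ x))))
  (pm-periodic m rs i r)
  where
  shift : ∀ r → (i ℕ.* m ℕ.+ r) % m ≡ r % m
  shift r = ≡.trans (≡.cong (_% m) (ℕ.+-comm (i ℕ.* m) r)) ([m+kn]%n≡m%n r i m)

select : ℕ → (ℕ → Bool) → List ℕ
select zero    S = []
select (suc n) S = if S n then n ∷ select n S else select n S

-- Only coefficients up to q^M matter, so we compute modulo q^(M + 1).
module Truncation (M : ℕ) where
  N = suc M
  R = truncatedSeries N
  open CommutativeRing R
  open import Algebra.Properties.CommutativeSemiring.Exp commutativeSemiring
  open import Algebra.Properties.Ring ring
  open import Relation.Binary.Reasoning.Setoid setoid
  open RingSums R
  open ListProducts R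
  open DifferenceSolver R
  open SignedTheta R X N
  open Monomials R X N
  open Instances R X N

  X^-* : ∀ k f n → (X ^ k * f) n ≡ delay k f n
  X^-* zero    f n = ⊛-identityˡ f n
  X^-* (suc k) f n = ≡.trans (⊛-assoc X (X ^ k) f n) (≡.trans (X-⊛ (X ^ k * f) n) (step n))
    where
    step : ∀ n → delay 1 (X ^ k * f) n ≡ delay (suc k) f n
    step zero    = ≡.refl
    step (suc n) = X^-* k f n

  X^N≈0 : X ^ N ≈ 0#
  X^N≈0 i i<N = ≡.trans (≡.sym (*-identityʳ (X ^ N) i i<N)) (≡.trans (X^-* N one i) (delay-< N one i i<N))

  module _ (S : ℕ → Bool) where
    open Counting S

    partFactor : ℕ → Series
    partFactor k = if S k then 1# - X ^ k else 1#

    G-partFactor : ∀ k → G (suc k) * partFactor (suc k) ≈ G k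
    G-partFactor k = go (S (suc k)) (G-suc k)
      where
      go : ∀ b → (∀ n → G (suc k) n ≡ G k n ℤ.+ delay (suc k) (λ m → if b then G (suc k) m else + 0) n) →
        G (suc k) * (if b then 1# - X ^ suc k else 1#) ≈ G k
      go true eq = begin
        G (suc k) * (1# - X ^ suc k)
          ≈⟨ solve 2 (λ g x → g :* (con (1 , 0) :- x) := g :- x :* g) refl (G (suc k)) (X ^ suc k) ⟩
        G (suc k) - X ^ suc k * G (suc k)
          ≈⟨ (λ n _ → ≡.cong₂ (λ x y → x ℤ.- y) (eq n) (X^-* (suc k) (G (suc k)) n)) ⟩
        (λ n → G k n ℤ.+ delay (suc k) (G (suc k)) n ℤ.- delay (suc k) (G (suc k)) n)
          ≈⟨ (λ n _ → lemma (G k n) (delay (suc k) (G (suc k)) n)) ⟩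
        G k ∎
        where
        lemma : ∀ x y → x ℤ.+ y ℤ.- y ≡ x
        lemma = ℤRing.solve-∀
      go false eq = trans (*-identityʳ (G (suc k))) λ n _ → ≡.trans (eq n)
        (≡.trans (≡.cong (λ z → G k n ℤ.+ z) (delay-zero (suc k) n)) (ℤ.+-identityʳ (G k n)))
        where
        delay-zero : ∀ k n → delay k (λ _ → + 0) n ≡ + 0
        delay-zero zero    n       = ≡.refl
        delay-zero (suc k) zero    = ≡.refl
        delay-zero (suc k) (suc n) = delay-zero k n

    G-product : ∀ k → G k * ∏ k (partFactor ∘ suc) ≈ 1#
    G-product zero    = trans (*-identityʳ (G 0)) λ n _ → G-0 n
    G-product (suc k) = begin
      G (suc k) * (∏ k (partFactor ∘ suc) * partFactor (suc k))
        ≈⟨ solve 3 (λ g x y → g :* (x :* y) := (g :* y) :* x) refl (G (suc k)) (∏ k (partFactor ∘ suc)) (partFactor (suc k)) ⟩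
      (G (suc k) * partFactor (suc k)) * ∏ k (partFactor ∘ suc)
        ≈⟨ *-congʳ {∏ k (partFactor ∘ suc)} {G (suc k) * partFactor (suc k)} {G k} (G-partFactor k) ⟩
      G k * ∏ k (partFactor ∘ suc)
        ≈⟨ G-product k ⟩
      1# ∎

    ∏-select : ∀ n → ∏ n (λ r → if S r then φ r else 1#) ≈ Φ (select n S)
    ∏-select zero    = refl
    ∏-select (suc n) with S n
    ... | true  = trans (*-comm _ (φ n)) (*-congˡ {φ n} (∏-select n))
    ... | false = trans (*-identityʳ _) (∏-select n)

    -- Write each index as 42i + r and exchange the products over i and r. By periodicity the column
    -- of r consists either of the factors of `φ r` or of ones.
    ∏-partFactor : (∀ i r → S (i ℕ.* 42 ℕ.+ r) ≡ S r) → ∏ (N ℕ.* 42) partFactor ≈ Φ (select 42 S)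
    ∏-partFactor periodic = begin
      ∏ (N ℕ.* 42) partFactor
        ≈⟨ ∏-blocks N 42 partFactor ⟩
      ∏ N (λ i → ∏ 42 (λ r → partFactor (i ℕ.* 42 ℕ.+ r)))
        ≈⟨ ∏-swap N 42 (λ i r → partFactor (i ℕ.* 42 ℕ.+ r)) ⟩
      ∏ 42 (λ r → ∏ N (λ i → partFactor (i ℕ.* 42 ℕ.+ r)))
        ≈⟨ ∏-cong 42 column ⟩
      ∏ 42 (λ r → if S r then φ r else 1#)
        ≈⟨ ∏-select 42 ⟩
      Φ (select 42 S) ∎
      where
      index : ∀ i r → i ℕ.* 42 ℕ.+ r ≡ r ℕ.+ 42 ℕ.* i
      index = ℕRing.solve-∀
      column : ∀ r → ∏ N (λ i → partFactor (i ℕ.* 42 ℕ.+ r)) ≈ (if S r then φ r else 1#)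
      column r = trans (∏-cong N λ i → reflexive (≡.cong₂ (λ b k → if b then 1# - X ^ k else 1#) (periodic i r) (index i r))) (pull (S r))
        where
        pull : ∀ b → ∏ N (λ i → if b then 1# - X ^ (r ℕ.+ 42 ℕ.* i) else 1#) ≈ (if b then φ r else 1#)
        pull true  = refl
        pull false = ∏-one N λ _ _ → refl

  -- This is 42N - 1: the indices from 0 to `largest` fill exactly N blocks of 42.
  largest : ℕ
  largest = 41 ℕ.+ M ℕ.* 42

  G-Φ : ∀ rs u set → pm 42 rs 0 ≡ false → sort id (select 42 (pm 42 rs)) ≡ sort id (classes u set) →
    Counting.G (pm 42 rs) largest * Φ (classes u set) ≈ 1#
  G-Φ rs u set S0 eq = begin
    G largest * Φ (classes u set)
      ≈⟨ *-congˡ {G largest} (productOver-sorted φ id (select 42 S) (classes u set) eq) ⟨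
    G largest * Φ (select 42 S)
      ≈⟨ *-congˡ {G largest} (∏-partFactor S (pm-periodic 42 rs)) ⟨
    G largest * ∏ (suc largest) (partFactor S)
      ≈⟨ *-congˡ {G largest} (∏-suc largest (partFactor S)) ⟩
    G largest * (partFactor S 0 * ∏ largest (partFactor S ∘ suc))
      -- Index 0 belongs to the first block but is not a part. By `S0` its factor is 1, where
      -- membership would have given 1 - X^0 = 0.
      ≈⟨ *-congˡ {G largest} (*-congʳ {∏ largest (partFactor S ∘ suc)} (reflexive (≡.cong (λ b → if b then 1# - X ^ 0 else 1#) S0))) ⟩
    G largest * (1# * ∏ largest (partFactor S ∘ suc))
      ≈⟨ *-congˡ {G largest} (*-identityˡ _) ⟩
    G largest * ∏ largest (partFactor S ∘ suc)
      ≈⟨ G-product S largest ⟩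
    1# ∎
    where
    S = pm 42 rs
    open Counting S using (G)

  counts : (ℕ → Bool) → Series
  counts S n = + p S n

  G-counts : ∀ S → Counting.G S largest ≈ counts S
  G-counts S n (s≤s n≤M) with ℕ.m≤n⇒∃[o]m+o≡n (ℕ.≤-trans n≤M (ℕ.≤-trans (ℕ.m≤m*n M 42) (ℕ.m≤n+m (M ℕ.* 42) 41)))
  ... | j , eq = ≡.trans (≡.cong (λ k → Counting.G S k n) (≡.sym eq)) (Counting.G-stable S n j)

  signed : Sign → ℤ → ℤ
  signed Sign.+ x = x
  signed Sign.- x = ℤ.- x

  coef-* : ∀ s k f n → n < N → (coef (s , k) * f) n ≡ signed s (delay k f n)
  coef-* Sign.+ k f n n<N = ≡.trans (trans (*-congʳ {f} (*-identityˡ (X ^ k))) refl n n<N) (X^-* k f n)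
  coef-* Sign.- k f n n<N = ≡.trans
    (trans (*-congʳ {f} (-1*x≈-x (X ^ k))) (sym (-‿distribˡ-* (X ^ k) f)) n n<N) (≡.cong ℤ.-_ (X^-* k f n))

  -- Multiply the three-term identity by both generating functions and take the coefficient of q^M,
  -- the highest one that survives modulo q^(M+1).
  counts-relation : ∀ xs ys u a b c → ThreeTerm u a b c →
    pm 42 xs 0 ≡ false → sort id (select 42 (pm 42 xs)) ≡ sort id (classes u setX) →
    pm 42 ys 0 ≡ false → sort id (select 42 (pm 42 ys)) ≡ sort id (classes u setY) →
    signed (proj₁ a) (delay (proj₂ a) (counts (pm 42 xs)) M)
      ℤ.+ signed (proj₁ b) (delay (proj₂ b) (counts (pm 42 ys)) M)
      ℤ.+ signed (proj₁ c) (delay (proj₂ c) one M) ≡ + 0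
  counts-relation xs ys u a b c three x0 xeq y0 yeq = ≡.trans
    (≡.sym (≡.cong₂ ℤ._+_ (≡.cong₂ ℤ._+_ (coef-* (proj₁ a) (proj₂ a) _ M M<N) (coef-* (proj₁ b) (proj₂ b) _ M M<N))
      (coef-* (proj₁ c) (proj₂ c) one M M<N)))
    (series M M<N)
    where
    M<N : M < N
    M<N = ℕ.n<1+n M
    GX GY ΦX ΦY A B C : Series
    GX = counts (pm 42 xs)
    GY = counts (pm 42 ys)
    ΦX = Φ (classes u setX)
    ΦY = Φ (classes u setY)
    A = coef a
    B = coef b
    C = coef c
    X-inverse : GX * ΦX ≈ 1#
    X-inverse = trans (*-congʳ {ΦX} (sym (G-counts (pm 42 xs)))) (G-Φ xs u setX x0 xeq)
    Y-inverse : GY * ΦY ≈ 1#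
    Y-inverse = trans (*-congʳ {ΦY} (sym (G-counts (pm 42 ys)))) (G-Φ ys u setY y0 yeq)
    series : A * GX + B * GY + C * 1# ≈ 0#
    series = begin
      A * GX + B * GY + C * 1#
        ≈⟨ solve 5 (λ a x b y c → a :* x :+ b :* y :+ c :* con (1 , 0)
             := a :* (x :* con (1 , 0)) :+ b :* (y :* con (1 , 0)) :+ c :* (con (1 , 0) :* con (1 , 0))) refl A GX B GY C ⟩
      A * (GX * 1#) + B * (GY * 1#) + C * (1# * 1#)
        ≈⟨ +-cong {A * (GX * 1#) + B * (GY * 1#)} {A * (GX * (GY * ΦY)) + B * (GY * (GX * ΦX))}
             (+-cong {A * (GX * 1#)} {A * (GX * (GY * ΦY))}
               (*-congˡ {A} (*-congˡ {GX} (sym Y-inverse))) (*-congˡ {B} (*-congˡ {GY} (sym X-inverse))))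
             (*-congˡ {C} (*-cong {1#} {GX * ΦX} (sym X-inverse) (sym Y-inverse))) ⟩
      A * (GX * (GY * ΦY)) + B * (GY * (GX * ΦX)) + C * ((GX * ΦX) * (GY * ΦY))
        ≈⟨ solve 7 (λ a b c x y f g → a :* (x :* (y :* g)) :+ b :* (y :* (x :* f)) :+ c :* ((x :* f) :* (y :* g))
             := (x :* y) :* (a :* g :+ b :* f :+ c :* (f :* g))) refl A B C GX GY ΦX ΦY ⟩
      (GX * GY) * (A * ΦY + B * ΦX + C * (ΦX * ΦY))
        ≈⟨ *-congˡ {GX * GY} three ⟩
      (GX * GY) * 0#
        ≈⟨ zeroʳ (GX * GY) ⟩
      0# ∎

-- The six identities

private
  -x+y≡0 : ∀ {x y} → ℤ.- + x ℤ.+ + y ℤ.+ + 0 ≡ + 0 → x ≡ y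
  -x+y≡0 {x} {y} eq = ℤ.+-injective
    (≡.trans (lemma (+ x) (+ y)) (≡.trans (≡.cong (λ z → + y ℤ.- z) eq) (ℤ.+-identityʳ (+ y))))
    where
    lemma : ∀ x y → x ≡ y ℤ.- (ℤ.- x ℤ.+ y ℤ.+ + 0)
    lemma = ℤRing.solve-∀

  x-y≡0 : ∀ {x y} → + x ℤ.+ ℤ.- + y ℤ.+ + 0 ≡ + 0 → x ≡ y
  x-y≡0 {x} {y} eq = ≡.sym (-x+y≡0 (≡.trans (≡.cong (λ z → z ℤ.+ + 0) (ℤ.+-comm (ℤ.- + y) (+ x))) eq))

  S₁ T₁ S₂ T₂ S₃ T₃ S₄ T₄ S₅ T₅ S₆ T₆ : List ℕ
  S₁ = 1 ∷ 3 ∷ 4 ∷ 5 ∷ 7 ∷ 9 ∷ 11 ∷ 16 ∷ 17 ∷ 18 ∷ 19 ∷ 20 ∷ []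
  T₁ = 1 ∷ 2 ∷ 3 ∷ 7 ∷ 8 ∷ 11 ∷ 13 ∷ 15 ∷ 17 ∷ 18 ∷ 19 ∷ 20 ∷ []
  S₂ = 1 ∷ 2 ∷ 5 ∷ 6 ∷ 7 ∷ 9 ∷ 10 ∷ 11 ∷ 13 ∷ 15 ∷ 16 ∷ 19 ∷ []
  T₂ = 1 ∷ 3 ∷ 4 ∷ 5 ∷ 6 ∷ 7 ∷ 11 ∷ 13 ∷ 15 ∷ 16 ∷ 17 ∷ 20 ∷ []
  S₃ = 1 ∷ 3 ∷ 4 ∷ 5 ∷ 7 ∷ 9 ∷ 10 ∷ 11 ∷ 12 ∷ 17 ∷ 19 ∷ 20 ∷ []
  T₃ = 1 ∷ 2 ∷ 5 ∷ 7 ∷ 8 ∷ 9 ∷ 10 ∷ 11 ∷ 12 ∷ 13 ∷ 15 ∷ 19 ∷ []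
  S₄ = 2 ∷ 3 ∷ 5 ∷ 7 ∷ 8 ∷ 9 ∷ 10 ∷ 11 ∷ 13 ∷ 17 ∷ 18 ∷ 19 ∷ []
  T₄ = 1 ∷ 3 ∷ 5 ∷ 7 ∷ 8 ∷ 11 ∷ 13 ∷ 15 ∷ 16 ∷ 17 ∷ 18 ∷ 20 ∷ []
  S₅ = 3 ∷ 4 ∷ 5 ∷ 7 ∷ 8 ∷ 9 ∷ 10 ∷ 11 ∷ 12 ∷ 13 ∷ 17 ∷ 19 ∷ []
  T₅ = 1 ∷ 4 ∷ 5 ∷ 7 ∷ 9 ∷ 12 ∷ 13 ∷ 15 ∷ 16 ∷ 17 ∷ 19 ∷ 20 ∷ []
  S₆ = 1 ∷ 2 ∷ 4 ∷ 5 ∷ 6 ∷ 7 ∷ 9 ∷ 13 ∷ 15 ∷ 16 ∷ 17 ∷ 19 ∷ []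
  T₆ = 1 ∷ 2 ∷ 3 ∷ 6 ∷ 7 ∷ 8 ∷ 10 ∷ 11 ∷ 13 ∷ 15 ∷ 17 ∷ 19 ∷ []

  relation-i : ∀ n → _
  relation-i n = Truncation.counts-relation n S₁ T₁ 1 (Sign.- , 0) (Sign.+ , 1) (Sign.+ , 0)
    (Instances.threeTerm-1 (Truncation.R n) X (suc n) (Truncation.X^N≈0 n)) ≡.refl ≡.refl ≡.refl ≡.refl

  i : ∀ n → 1 ≤ n → p (pm 42 S₁) n ≡ p (pm 42 T₁) (n ∸ 1)
  i n@(suc _) _ = -x+y≡0 (relation-i n)

  -- Multiplication by 5 carries `setX` to T and `setY` to S, so the sets exchange roles compared
  -- with part (i). The same happens in (iii), (v) and (vi), but not in (iv).
  relation-ii : ∀ n → _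
  relation-ii n = Truncation.counts-relation n T₂ S₂ 5 (Sign.- , 0) (Sign.+ , 0) (Sign.- , 2)
    (Instances.threeTerm-5 (Truncation.R n) X (suc n) (Truncation.X^N≈0 n)) ≡.refl ≡.refl ≡.refl ≡.refl

  ii : ∀ n → n ≢ 2 → p (pm 42 S₂) n ≡ p (pm 42 T₂) n
  -- The coefficient of q² in the monomial reduces to 0 only once n is known to be 0, 1 or at least
  -- 3, hence the separate cases. At n = 2 it is 1 and the counts differ.
  ii 0 _ = ≡.sym (-x+y≡0 (relation-ii 0))
  ii 1 _ = ≡.sym (-x+y≡0 (relation-ii 1))
  ii 2 n≢2 = ⊥-elim (n≢2 ≡.refl)
  ii n@(suc (suc (suc _))) _ = ≡.sym (-x+y≡0 (relation-ii n))

  relation-iii : ∀ n → _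
  relation-iii n = Truncation.counts-relation n T₃ S₃ 11 (Sign.+ , 0) (Sign.- , 0) (Sign.- , 2)
    (Instances.threeTerm-11 (Truncation.R n) X (suc n) (Truncation.X^N≈0 n)) ≡.refl ≡.refl ≡.refl ≡.refl

  iii : ∀ n → n ≢ 2 → p (pm 42 S₃) n ≡ p (pm 42 T₃) n
  iii 0 _ = ≡.sym (x-y≡0 (relation-iii 0))
  iii 1 _ = ≡.sym (x-y≡0 (relation-iii 1))
  iii 2 n≢2 = ⊥-elim (n≢2 ≡.refl)
  iii n@(suc (suc (suc _))) _ = ≡.sym (x-y≡0 (relation-iii n))

  relation-iv : ∀ n → _
  relation-iv n = Truncation.counts-relation n S₄ T₄ 13 (Sign.+ , 0) (Sign.- , 2) (Sign.- , 0)
    (Instances.threeTerm-13 (Truncation.R n) X (suc n) (Truncation.X^N≈0 n)) ≡.refl ≡.refl ≡.refl ≡.refl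

  iv : ∀ n → 2 ≤ n → p (pm 42 S₄) n ≡ p (pm 42 T₄) (n ∸ 2)
  iv n@(suc (suc _)) _ = x-y≡0 (relation-iv n)
  iv 1 (s≤s ())

  relation-v : ∀ n → _
  relation-v n = Truncation.counts-relation n T₅ S₅ 17 (Sign.- , 3) (Sign.+ , 0) (Sign.- , 0)
    (Instances.threeTerm-17 (Truncation.R n) X (suc n) (Truncation.X^N≈0 n)) ≡.refl ≡.refl ≡.refl ≡.refl

  v : ∀ n → 3 ≤ n → p (pm 42 S₅) n ≡ p (pm 42 T₅) (n ∸ 3)
  v n@(suc (suc (suc _))) _ = ≡.sym (-x+y≡0 (relation-v n))
  v 1 (s≤s ())
  v 2 (s≤s (s≤s ()))

  relation-vi : ∀ n → _
  relation-vi n = Truncation.counts-relation n T₆ S₆ 19 (Sign.- , 0) (Sign.+ , 0) (Sign.+ , 3)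
    (Instances.threeTerm-19 (Truncation.R n) X (suc n) (Truncation.X^N≈0 n)) ≡.refl ≡.refl ≡.refl ≡.refl

  vi : ∀ n → n ≢ 3 → p (pm 42 S₆) n ≡ p (pm 42 T₆) n
  vi 0 _ = ≡.sym (-x+y≡0 (relation-vi 0))
  vi 1 _ = ≡.sym (-x+y≡0 (relation-vi 1))
  vi 2 _ = ≡.sym (-x+y≡0 (relation-vi 2))
  vi 3 n≢3 = ⊥-elim (n≢3 ≡.refl)
  vi n@(suc (suc (suc (suc _)))) _ = ≡.sym (-x+y≡0 (relation-vi n))

theorem5p3 : ((n : ℕ) → 1 ≤ n →
    p (pm 42 (1 ∷ 3 ∷ 4 ∷ 5 ∷ 7 ∷ 9 ∷ 11 ∷ 16 ∷ 17 ∷ 18 ∷ 19 ∷ 20 ∷ [])) n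
    ≡ p (pm 42 (1 ∷ 2 ∷ 3 ∷ 7 ∷ 8 ∷ 11 ∷ 13 ∷ 15 ∷ 17 ∷ 18 ∷ 19 ∷ 20 ∷ [])) (n ∸ 1))
    × ((n : ℕ) → n ≢ 2 →
    p (pm 42 (1 ∷ 2 ∷ 5 ∷ 6 ∷ 7 ∷ 9 ∷ 10 ∷ 11 ∷ 13 ∷ 15 ∷ 16 ∷ 19 ∷ [])) n
    ≡ p (pm 42 (1 ∷ 3 ∷ 4 ∷ 5 ∷ 6 ∷ 7 ∷ 11 ∷ 13 ∷ 15 ∷ 16 ∷ 17 ∷ 20 ∷ [])) n)
    × ((n : ℕ) → n ≢ 2 →
    p (pm 42 (1 ∷ 3 ∷ 4 ∷ 5 ∷ 7 ∷ 9 ∷ 10 ∷ 11 ∷ 12 ∷ 17 ∷ 19 ∷ 20 ∷ [])) n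
    ≡ p (pm 42 (1 ∷ 2 ∷ 5 ∷ 7 ∷ 8 ∷ 9 ∷ 10 ∷ 11 ∷ 12 ∷ 13 ∷ 15 ∷ 19 ∷ [])) n)
    × ((n : ℕ) → 2 ≤ n →
    p (pm 42 (2 ∷ 3 ∷ 5 ∷ 7 ∷ 8 ∷ 9 ∷ 10 ∷ 11 ∷ 13 ∷ 17 ∷ 18 ∷ 19 ∷ [])) n
    ≡ p (pm 42 (1 ∷ 3 ∷ 5 ∷ 7 ∷ 8 ∷ 11 ∷ 13 ∷ 15 ∷ 16 ∷ 17 ∷ 18 ∷ 20 ∷ [])) (n ∸ 2))
    × ((n : ℕ) → 3 ≤ n →
    p (pm 42 (3 ∷ 4 ∷ 5 ∷ 7 ∷ 8 ∷ 9 ∷ 10 ∷ 11 ∷ 12 ∷ 13 ∷ 17 ∷ 19 ∷ [])) n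
    ≡ p (pm 42 (1 ∷ 4 ∷ 5 ∷ 7 ∷ 9 ∷ 12 ∷ 13 ∷ 15 ∷ 16 ∷ 17 ∷ 19 ∷ 20 ∷ [])) (n ∸ 3))
    × ((n : ℕ) → n ≢ 3 →
    p (pm 42 (1 ∷ 2 ∷ 4 ∷ 5 ∷ 6 ∷ 7 ∷ 9 ∷ 13 ∷ 15 ∷ 16 ∷ 17 ∷ 19 ∷ [])) n
    ≡ p (pm 42 (1 ∷ 2 ∷ 3 ∷ 6 ∷ 7 ∷ 8 ∷ 10 ∷ 11 ∷ 13 ∷ 15 ∷ 17 ∷ 19 ∷ [])) n)
theorem5p3 = i , ii , iii , iv , v , vi
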